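{- Every prime graph with at least $5$ vertices has at least $2$ non-essential vertices unless it is locally equivalent to a cycle graph.
   Context: All graphs are finite and simple. For a vertex $v$ of a graph $G$, the local complementation $G*v$ is the graph on $V(G)$ obtained from $G$ by replacing the edges among the neighbors of $v$ by their complement, i.e. $E(G*v)=E(G)\triangle\{xy: x,y \text{ distinct neighbors of } v\}$. Two graphs are locally equivalent if one can be obtained from the other by a sequence of local complementations. For an edge $vw$, the pivoting is $G\wedge vw := G*v*w*v$. Let $G/v$ denote $G\setminus v$ if $v$ has no neighbor, and otherwise $G\wedge vw\setminus v$ for an arbitrary neighbor $w$ of $v$ (this is well defined up to local equivalence, so its primality does not depend on the choice of $w$). A split of a graph is a partition $(A,B)$ of its vertex set with $\min\{|A|,|B|\}\ge 2$ such that for some $A'\subseteq A$, $B'\subseteq B$, vertices $x\in A$, $y\in B$ are adjacent iff $x\in A'$ and $y\in B'$. A graph is prime if it has no split. A vertex $v$ of $G$ is non-essential if at least two of $G\setminus v$, $G*v\setminus v$, $G/v$ are prime. -}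

module Defs where

open import Data.Nat using (ℕ; zero; suc; _≤_)
open import Data.Nat.Base using (_≡ᵇ_)
open import Data.Fin using (Fin; toℕ; punchIn; _≟_)
open import Data.Bool using (Bool; true; false; _∧_; _∨_; not; _xor_)
open import Data.Product using (Σ; ∃; ∃-syntax; _×_; _,_)
open import Data.Sum using (_⊎_)
open import Relation.Binary.PropositionalEquality using (_≡_; _≢_)
open import Relation.Nullary using (¬_)
open import Relation.Nullary.Decidable using (⌊_⌋)
open import Function.Bundles using (_↔_; Inverse)

Graph : ℕ → Set
Graph n = Fin n → Fin n → Bool

IsSimple : ∀ {n} → Graph n → Set
IsSimple {n} G = (∀ (x y : Fin n) → G x y ≡ G y x) × (∀ (x : Fin n) → G x x ≡ false)

_*_ : ∀ {n} → Graph n → Fin n → Graph n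
(G * v) x y = G x y xor (G v x ∧ G v y ∧ not ⌊ x ≟ y ⌋)

pivot : ∀ {n} → Graph n → Fin n → Fin n → Graph n
pivot G v w = ((G * v) * w) * v

delete : ∀ {n} → Graph (suc n) → Fin (suc n) → Graph n
delete G v x y = G (punchIn v x) (punchIn v y)

data LocEq {n : ℕ} : Graph n → Graph n → Set where
  done : ∀ {G H} → (∀ x y → G x y ≡ H x y) → LocEq G H
  step : ∀ {G H} (v : Fin n) → LocEq (G * v) H → LocEq G H

Split : ∀ {n} → Graph n → Set
Split {n} G =
  Σ (Fin n → Bool) λ A →
  (∃[ a₁ ] ∃[ a₂ ] (a₁ ≢ a₂ × A a₁ ≡ true × A a₂ ≡ true)) ×
  (∃[ b₁ ] ∃[ b₂ ] (b₁ ≢ b₂ × A b₁ ≡ false × A b₂ ≡ false)) ×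
  Σ (Fin n → Bool) λ A' → Σ (Fin n → Bool) λ B' →
    (∀ x → A' x ≡ true → A x ≡ true) ×
    (∀ y → B' y ≡ true → A y ≡ false) ×
    (∀ x y → A x ≡ true → A y ≡ false →
       (G x y ≡ true → (A' x ≡ true × B' y ≡ true)) ×
       ((A' x ≡ true × B' y ≡ true) → G x y ≡ true))

Prime : ∀ {n} → Graph n → Set
Prime G = ¬ Split G

-- Primality of G / v: if v has no neighbour, G \ v is prime; otherwise
-- (G ∧ vw) \ v is prime for (every) neighbour w of v.
PrimeSlash : ∀ {n} → Graph (suc n) → Fin (suc n) → Set
PrimeSlash G v =
  ((∀ w → G v w ≡ false) → Prime (delete G v)) ×
  (∀ w → G v w ≡ true → Prime (delete (pivot G v w) v))

NonEssential : ∀ {n} → Graph (suc n) → Fin (suc n) → Set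
NonEssential G v =
  (Prime (delete G v) × Prime (delete (G * v) v)) ⊎
  (Prime (delete G v) × PrimeSlash G v) ⊎
  (Prime (delete (G * v) v) × PrimeSlash G v)

cycAdj : (n : ℕ) → Fin n → Fin n → Bool
cycAdj n i j =
  (suc (toℕ i) ≡ᵇ toℕ j) ∨ (suc (toℕ j) ≡ᵇ toℕ i) ∨
  ((toℕ i ≡ᵇ 0) ∧ (suc (toℕ j) ≡ᵇ n)) ∨ ((toℕ j ≡ᵇ 0) ∧ (suc (toℕ i) ≡ᵇ n))

IsCycle : ∀ {n} → Graph n → Set
IsCycle {n} H = Σ (Fin n ↔ Fin n) λ f →
  ∀ x y → H x y ≡ cycAdj n (Inverse.to f x) (Inverse.to f y)

LocEqCycle : ∀ {n} → Graph n → Set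
LocEqCycle G = ∃[ H ] (IsCycle H × LocEq G H)

{-# OPTIONS --safe #-}

-- Attach to G the space of vectors c ∈ F₂ⁿ, where c has at a vertex v the colour (c v , (G c) v) ∈ F₂²
-- (the isotropic system of G).  Any two vectors are orthogonal for the sum of the local symplectic forms,
-- local complementation only recolours coordinatewise, the vectors supported in A form a space of dimension
-- r A = |A| − cutrank A, and the three elementary minors at v correspond to the three nonzero colours at v.
-- For a prime graph no nonzero vector has support of size at most 2; call a set of size 3 supporting a vector
-- a triple.  Uncrossing two splits of different colours puts every essential (= not non-essential) vertex in a
-- triple, and an analogue of Tutte's triangle lemma extends a triple {a,b,c} with a and b essential to a second
-- triple containing a and exactly one of b, c.  Hence, if at most one vertex is non-essential, a maximal
-- sequence of vertices whose consecutive threes are triples has an essential end, and it can only fail to be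
-- prolonged there by closing up around all of V; the triples are then the coloured rows of a cycle, and
-- reading off a graph from the colours by local complementations shows that G is locally equivalent to it.
module Submission where

open import Defs
open import Data.Nat as ℕ using (ℕ; zero; suc; _≤_; _<_; z≤n; s≤s; _+_)
import Data.Nat.Properties as ℕₚ
open import Data.Fin using (Fin; zero; suc; toℕ; fromℕ<; punchIn; punchOut; _≟_)
open import Data.Fin.Patterns using (0F; 1F; 2F; 3F; 4F)
import Data.Fin.Properties as Finₚ
open import Data.Bool using (Bool; true; false; T; _∧_; _∨_; not; _xor_; if_then_else_)
import Data.Bool.Properties as Boolₚ
open import Data.List using (List; []; _∷_; _++_; _ʳ++_; length; map; filter; allFin)
open import Data.List.Relation.Unary.All as All using (All; []; _∷_)
open import Data.List.Relation.Unary.AllPairs using ([]; _∷_)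
open import Data.List.Relation.Unary.Any using (here; there)
open import Data.List.Relation.Unary.Unique.Propositional using (Unique)
open import Data.List.Membership.Propositional using (_∈_)
import Data.List.Membership.Propositional.Properties as ∈ₚ
open import Data.Product using (∃; ∃-syntax; _×_; _,_; proj₁; proj₂)
open import Data.Sum using (_⊎_; inj₁; inj₂; [_,_]′)
open import Data.Unit using (tt)
open import Data.Empty using (⊥; ⊥-elim)
import Data.Vec.Functional as VF
open import Algebra.Bundles using (CommutativeRing)
import Algebra.Properties.CommutativeMonoid.Sum
import Algebra.Properties.Semiring.Sum
open import Function using (_∘_; id)
open import Function.Bundles using (_↔_; Inverse; mk↔ₛ′)
open import Relation.Binary.PropositionalEquality
open import Relation.Nullary using (¬_; Dec; yes; no)
open import Relation.Nullary.Decidable using (⌊_⌋; True; toWitness; map′; ¬?; _×-dec_; _⊎-dec_; _→-dec_)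

-- In uncrossing, both sets have cutrank at most 2 and primality gives their intersection and union
-- cutrank at least 2, so submodularity alone yields only equality. The contradiction needs one
-- extra dimension: a vector supported in the union that is not a sum of vectors supported in the
-- two sets. Two different colours at a vertex supply it, since such a sum would be orthogonal to a
-- vector of the other colour, and orthogonal nonzero colours in F₂² coincide. The same coincidence
-- governs overlapping triples: two triples meeting in one vertex have equal colours there, two
-- triples meeting in two vertices have different colours at both. So an unexpected triple usually
-- contradicts two consecutive triples of a chain. The exceptions live in small graphs: on 5
-- vertices every 3-set is a triple, which closes the cycle at once, while from 6 vertices on no
-- 4-set contains three triples.

module ⊕ = Algebra.Properties.Semiring.Sum (CommutativeRing.semiring Boolₚ.xor-∧-commutativeRing)
module Σℕ = Algebra.Properties.CommutativeMonoid.Sum ℕₚ.+-0-commutativeMonoid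

-- Colours and the isotropic system of a graph

¬true⇒false : ∀ {b} → ¬ (b ≡ true) → b ≡ false
¬true⇒false {false} _ = refl
¬true⇒false {true}  h = ⊥-elim (h refl)

¬false⇒true : ∀ {b} → ¬ (b ≡ false) → b ≡ true
¬false⇒true {true}  _ = refl
¬false⇒true {false} h = ⊥-elim (h refl)

true≢false : ∀ {b} → b ≡ true → b ≡ false → ⊥
true≢false refl ()

∧-true : ∀ {a b} → a ∧ b ≡ true → a ≡ true × b ≡ true
∧-true {true} {true} _ = refl , refl

xor-cancelʳ : ∀ a b → (a xor b) xor b ≡ a
xor-cancelʳ false false = refl
xor-cancelʳ false true  = refl
xor-cancelʳ true  false = refl
xor-cancelʳ true  true  = refl

same : ∀ {n} → Fin n → Fin n → Bool
same x y = ⌊ x ≟ y ⌋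

same-refl : ∀ {n} (x : Fin n) → same x x ≡ true
same-refl x with x ≟ x
... | yes _ = refl
... | no  h = ⊥-elim (h refl)

same-≢ : ∀ {n} {x y : Fin n} → x ≢ y → same x y ≡ false
same-≢ {x = x} {y} h with x ≟ y
... | yes e = ⊥-elim (h e)
... | no  _ = refl

⊕-single : ∀ {n} (f : Fin n → Bool) v → (∀ w → w ≢ v → f w ≡ false) → ⊕.sum f ≡ f v
⊕-single {suc n} f v h = trans (⊕.sum-remove {i = v} f)
  (trans (cong (f v xor_) (trans (⊕.sum-cong-≗ λ j → h (punchIn v j) (Finₚ.punchInᵢ≢i v j)) (⊕.sum-replicate-zero n)))
         (Boolₚ.xor-identityʳ _))

⊕-pair : ∀ {n} (f : Fin n → Bool) v w → v ≢ w →
  (∀ y → y ≢ v → y ≢ w → f y ≡ false) → ⊕.sum f ≡ f v xor f w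
⊕-pair {suc n} f v w v≢w h = trans (⊕.sum-remove {i = v} f)
  (cong (f v xor_) (trans
    (⊕-single (f ∘ punchIn v) w′ λ j j≢ → h (punchIn v j) (Finₚ.punchInᵢ≢i v j)
       λ e → j≢ (Finₚ.punchIn-injective v j w′ (trans e (sym pw))))
    (cong f pw)))
  where
  w′ = punchOut v≢w
  pw : punchIn v w′ ≡ w
  pw = Finₚ.punchIn-punchOut v≢w

K : Set
K = Bool × Bool

pattern 0ᴷ = (false , false)

infixl 6 _+ᴷ_
_+ᴷ_ : K → K → K
(x , z) +ᴷ (x′ , z′) = (x xor x′) , (z xor z′)

ω : K → K → Bool
ω (x , z) (x′ , z′) = (x ∧ z′) xor (z ∧ x′)

≟0 : (k : K) → Dec (k ≡ 0ᴷ)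
≟0 0ᴷ = yes refl
≟0 (false , true) = no λ ()
≟0 (true , _) = no λ ()

ω-zeroʳ : ∀ k → ω k 0ᴷ ≡ false
ω-zeroʳ (false , false) = refl
ω-zeroʳ (false , true)  = refl
ω-zeroʳ (true , false)  = refl
ω-zeroʳ (true , true)   = refl

ω-self : ∀ k → ω k k ≡ false
ω-self (false , false) = refl
ω-self (false , true)  = refl
ω-self (true , false)  = refl
ω-self (true , true)   = refl

-- The form is alternating and nondegenerate on a plane over F₂, so the orthogonal complement of a
-- nonzero colour is the line it spans, which has only one nonzero element.
ω-false : ∀ {k l} → k ≢ 0ᴷ → l ≢ 0ᴷ → ω k l ≡ false → k ≡ l
ω-false {false , false} k≢ l≢ _ = ⊥-elim (k≢ refl)
ω-false {k} {false , false} k≢ l≢ _ = ⊥-elim (l≢ refl)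
ω-false {false , true} {false , true} k≢ l≢ _ = refl
ω-false {true , false} {true , false} k≢ l≢ _ = refl
ω-false {true , true}  {true , true}  k≢ l≢ _ = refl
ω-false {true , false} {false , true} k≢ l≢ ()
ω-false {true , true}  {false , true} k≢ l≢ ()

ω-true : ∀ {k l} → k ≢ 0ᴷ → l ≢ 0ᴷ → k ≢ l → ω k l ≡ true
ω-true k≢ l≢ k≢l = ¬false⇒true λ e → k≢l (ω-false k≢ l≢ e)

ω-true⇒≢ : ∀ {k l} → ω k l ≡ true → k ≢ l
ω-true⇒≢ {k} e refl = true≢false e (ω-self k)

ω-true⇒≢0ˡ : ∀ {k l} → ω k l ≡ true → k ≢ 0ᴷ
ω-true⇒≢0ˡ () refl

ω-true⇒≢0ʳ : ∀ {k l} → ω k l ≡ true → l ≢ 0ᴷ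
ω-true⇒≢0ʳ {k} e refl = true≢false e (ω-zeroʳ k)

+ᴷ-identityʳ : ∀ k → k +ᴷ 0ᴷ ≡ k
+ᴷ-identityʳ (x , z) = cong₂ _,_ (Boolₚ.xor-identityʳ x) (Boolₚ.xor-identityʳ z)

+ᴷ-self : ∀ k → k +ᴷ k ≡ 0ᴷ
+ᴷ-self (x , z) = cong₂ _,_ (Boolₚ.xor-same x) (Boolₚ.xor-same z)

+ᴷ-≢0 : ∀ {k l} → k ≢ l → k +ᴷ l ≢ 0ᴷ
+ᴷ-≢0 {x , z} {x′ , z′} k≢l e = k≢l (cong₂ _,_ (f x x′ (cong proj₁ e)) (f z z′ (cong proj₂ e)))
  where
  f : ∀ a b → a xor b ≡ false → a ≡ b
  f false false _ = refl
  f true  true  _ = refl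

Vec₂ : ℕ → Set
Vec₂ n = Fin n → Bool

infixl 6 _⊞_
_⊞_ : ∀ {n} → Vec₂ n → Vec₂ n → Vec₂ n
(c ⊞ d) v = c v xor d v

unit : ∀ {n} → Fin n → Vec₂ n
unit v w = same w v

module Space {n : ℕ} (G : Graph n) where

  z : Vec₂ n → Fin n → Bool
  z c v = ⊕.sum λ w → G v w ∧ c w

  col : Vec₂ n → Fin n → K
  col c v = c v , z c v

  z-cong : ∀ {c d} → c ≗ d → ∀ v → z c v ≡ z d v
  z-cong h v = ⊕.sum-cong-≗ λ w → cong (G v w ∧_) (h w)

  z-⊞ : ∀ c d v → z (c ⊞ d) v ≡ z c v xor z d v
  z-⊞ c d v = trans (⊕.sum-cong-≗ λ w → Boolₚ.∧-distribˡ-xor (G v w) (c w) (d w))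
                    (⊕.∑-distrib-+ (λ w → G v w ∧ c w) (λ w → G v w ∧ d w))

  z-unit : ∀ u v → z (unit u) v ≡ G v u
  z-unit u v = trans (⊕-single _ u λ w w≢ → trans (cong (G v w ∧_) (same-≢ w≢)) (Boolₚ.∧-zeroʳ _))
                     (trans (cong (G v u ∧_) (same-refl u)) (Boolₚ.∧-identityʳ _))

  z-∅ : ∀ {c} → (∀ v → c v ≡ false) → ∀ v → z c v ≡ false
  z-∅ h v = trans (⊕.sum-cong-≗ λ w → trans (cong (G v w ∧_) (h w)) (Boolₚ.∧-zeroʳ (G v w))) (⊕.sum-replicate-zero n)

  col-⊞ : ∀ c d v → col (c ⊞ d) v ≡ col c v +ᴷ col d v
  col-⊞ c d v = cong (c v xor d v ,_) (z-⊞ c d v)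

  module _ (G-sym : ∀ x y → G x y ≡ G y x) where

    -- The two halves of the sum are the products of c with G d and of G c with d. They are equal
    -- because the adjacency matrix is symmetric, and cancel over F₂.
    isotropic : ∀ c d → ⊕.sum (λ v → ω (col c v) (col d v)) ≡ false
    isotropic c d = trans (⊕.∑-distrib-+ (λ v → c v ∧ z d v) (λ v → z c v ∧ d v))
      (trans (cong (_xor ⊕.sum (λ v → z c v ∧ d v)) lhs) (Boolₚ.xor-same (⊕.sum (λ v → z c v ∧ d v))))
      where
      lhs : ⊕.sum (λ v → c v ∧ z d v) ≡ ⊕.sum (λ v → z c v ∧ d v)
      lhs = trans (⊕.sum-cong-≗ λ v → ⊕.*-distribˡ-sum (c v) (λ w → G v w ∧ d w))
        (trans (⊕.∑-comm (λ v w → c v ∧ (G v w ∧ d w)))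
        (⊕.sum-cong-≗ λ w → trans
          (⊕.sum-cong-≗ λ v → trans (sym (Boolₚ.∧-assoc (c v) (G v w) (d w)))
             (cong (_∧ d w) (trans (Boolₚ.∧-comm (c v) _) (cong (_∧ c v) (G-sym v w)))))
          (sym (⊕.*-distribʳ-sum (d w) (λ v → G w v ∧ c v)))))

    -- The form in which orthogonality is mostly used: a sum with a single undecided term decides
    -- it. With `ω-false` it identifies two nonzero colours at `v`.
    commute-at : ∀ c d v → (∀ w → w ≢ v → ω (col c w) (col d w) ≡ false) →
      ω (col c v) (col d v) ≡ false
    commute-at c d v h = trans (sym (⊕-single _ v h)) (isotropic c d)

    commute-pair : ∀ c d v w → v ≢ w →
      (∀ y → y ≢ v → y ≢ w → ω (col c y) (col d y) ≡ false) →
      ω (col c v) (col d v) ≡ ω (col c w) (col d w)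
    commute-pair c d v w v≢w h = f _ _ (trans (sym (⊕-pair _ v w v≢w h)) (isotropic c d))
      where
      f : ∀ a b → a xor b ≡ false → a ≡ b
      f false false _ = refl
      f true  true  _ = refl

-- Finite subsets and dimensions

Sub : ℕ → Set
Sub n = Fin n → Bool

infix 4 _⊆_
_⊆_ : ∀ {n} → Sub n → Sub n → Set
A ⊆ B = ∀ v → A v ≡ true → B v ≡ true

⊆-false : ∀ {n} {A B : Sub n} → A ⊆ B → ∀ v → B v ≡ false → A v ≡ false
⊆-false h v e = ¬true⇒false λ a → true≢false (h v a) e

infixl 7 _∩_ _∖_
infixl 6 _∪_ _∪₁_
_∩_ _∪_ : ∀ {n} → Sub n → Sub n → Sub n
(A ∩ B) v = A v ∧ B v
(A ∪ B) v = A v ∨ B v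

_∖_ _∪₁_ : ∀ {n} → Sub n → Fin n → Sub n
(A ∖ v) w = A w ∧ not (same w v)
(A ∪₁ v) w = A w ∨ same w v

∁ : ∀ {n} → Sub n → Sub n
∁ A v = not (A v)

⟦_⟧ : Bool → ℕ
⟦ b ⟧ = if b then 1 else 0

# : ∀ {n} → Sub n → ℕ
# A = Σℕ.sum (λ v → ⟦ A v ⟧)

#-cong : ∀ {n} {A B : Sub n} → A ≗ B → # A ≡ # B
#-cong h = Σℕ.sum-cong-≗ λ v → cong ⟦_⟧ (h v)

∖-self : ∀ {n} (A : Sub n) v → (A ∖ v) v ≡ false
∖-self A v = trans (cong (λ b → A v ∧ not b) (same-refl v)) (Boolₚ.∧-zeroʳ (A v))

∖-≢ : ∀ {n} (A : Sub n) {v w} → w ≢ v → (A ∖ v) w ≡ A w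
∖-≢ A {v} {w} h = trans (cong (λ b → A w ∧ not b) (same-≢ h)) (Boolₚ.∧-identityʳ (A w))

∖-⊆ : ∀ {n} {A : Sub n} {v} → A ∖ v ⊆ A
∖-⊆ w h = proj₁ (∧-true h)

∖-true⇒≢ : ∀ {n} (A : Sub n) {v w} → (A ∖ v) w ≡ true → w ≢ v
∖-true⇒≢ A h refl = true≢false h (∖-self A _)

∪₁-self : ∀ {n} (A : Sub n) v → (A ∪₁ v) v ≡ true
∪₁-self A v = trans (cong (A v ∨_) (same-refl v)) (Boolₚ.∨-zeroʳ (A v))

∪₁-≢ : ∀ {n} (A : Sub n) {v w} → w ≢ v → (A ∪₁ v) w ≡ A w
∪₁-≢ A {v} {w} h = trans (cong (A w ∨_) (same-≢ h)) (Boolₚ.∨-identityʳ (A w))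

∪₁-⊇ : ∀ {n} {A : Sub n} {v} → A ⊆ A ∪₁ v
∪₁-⊇ {A = A} w h rewrite h = refl

∪₁-true : ∀ {n} (A : Sub n) {v w} → (A ∪₁ v) w ≡ true → w ≡ v ⊎ A w ≡ true
∪₁-true A {v} {w} h with w ≟ v
... | yes e = inj₁ e
... | no  _ = inj₂ (trans (sym (Boolₚ.∨-identityʳ (A w))) h)

∪₁-false : ∀ {n} (A : Sub n) {v w} → (A ∪₁ v) w ≡ false → w ≢ v × A w ≡ false
∪₁-false A {v} {w} h = (λ { refl → true≢false (∪₁-self A _) h }) , ⊆-false (∪₁-⊇ {A = A} {v}) w h

#-∖ : ∀ {n} (A : Sub n) v → A v ≡ true → # A ≡ suc (# (A ∖ v))
#-∖ {suc n} A v h = trans (Σℕ.sum-remove {i = v} (λ w → ⟦ A w ⟧)) (trans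
  (cong₂ _+_ (cong ⟦_⟧ h) (Σℕ.sum-cong-≗ λ j → sym (cong ⟦_⟧ (∖-≢ A (Finₚ.punchInᵢ≢i v j)))))
  (cong suc (sym (trans (Σℕ.sum-remove {i = v} (λ w → ⟦ (A ∖ v) w ⟧))
    (cong (λ b → ⟦ b ⟧ + Σℕ.sum (λ j → ⟦ (A ∖ v) (punchIn v j) ⟧)) (∖-self A v))))))

#-empty : ∀ {n} (A : Sub n) → (∀ v → A v ≡ false) → # A ≡ 0
#-empty {n} A h = trans (#-cong h) (Σℕ.sum-replicate-zero n)

#-nonempty : ∀ {n} (A : Sub n) → 1 ≤ # A → ∃ λ v → A v ≡ true
#-nonempty A h with Finₚ.any? (λ v → A v Boolₚ.≟ true)
... | yes e = e
... | no ¬e = ⊥-elim (ℕₚ.1+n≰n (subst (1 ≤_) (#-empty A λ v → ¬true⇒false λ e → ¬e (v , e)) h))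

#-two : ∀ {n} (A : Sub n) → 2 ≤ # A → ∃ λ a → ∃ λ b → a ≢ b × A a ≡ true × A b ≡ true
#-two A h with #-nonempty A (ℕₚ.≤-trans (s≤s z≤n) h)
... | a , Aa with #-nonempty (A ∖ a) (ℕₚ.≤-pred (subst (2 ≤_) (#-∖ A a Aa) h))
...   | b , Ab = a , b , (λ e → ∖-true⇒≢ A Ab (sym e)) , Aa , ∖-⊆ {A = A} b Ab

#-pos : ∀ {n} (A : Sub n) {v} → A v ≡ true → 1 ≤ # A
#-pos A {v} h = subst (1 ≤_) (sym (#-∖ A v h)) (s≤s z≤n)

#-≥2 : ∀ {n} (A : Sub n) {a b} → a ≢ b → A a ≡ true → A b ≡ true → 2 ≤ # A
#-≥2 A {a} {b} a≢b Aa Ab = subst (2 ≤_) (sym (#-∖ A a Aa))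
  (s≤s (#-pos (A ∖ a) (trans (∖-≢ A (a≢b ∘ sym)) Ab)))

#-split : ∀ {n} (A B : Sub n) → # A ≡ # (A ∩ B) + # (A ∩ ∁ B)
#-split A B = trans (Σℕ.sum-cong-≗ λ v → f (A v) (B v))
                    (Σℕ.∑-distrib-+ (λ v → ⟦ A v ∧ B v ⟧) (λ v → ⟦ A v ∧ not (B v) ⟧))
  where
  f : ∀ a b → ⟦ a ⟧ ≡ ⟦ a ∧ b ⟧ + ⟦ a ∧ not b ⟧
  f false b     = refl
  f true  false = refl
  f true  true  = refl

#-modular : ∀ {n} (A B : Sub n) → # A + # B ≡ # (A ∩ B) + # (A ∪ B)
#-modular A B = trans (sym (Σℕ.∑-distrib-+ (λ v → ⟦ A v ⟧) (λ v → ⟦ B v ⟧)))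
  (trans (Σℕ.sum-cong-≗ λ v → f (A v) (B v))
         (Σℕ.∑-distrib-+ (λ v → ⟦ A v ∧ B v ⟧) (λ v → ⟦ A v ∨ B v ⟧)))
  where
  f : ∀ a b → ⟦ a ⟧ + ⟦ b ⟧ ≡ ⟦ a ∧ b ⟧ + ⟦ a ∨ b ⟧
  f false b     = refl
  f true  false = refl
  f true  true  = refl

#-mono : ∀ {n} {A B : Sub n} → A ⊆ B → # A ≤ # B
#-mono {A = A} {B} h = subst₂ _≤_ (#-cong λ v → f (A v) (B v) (h v)) (sym (#-split B A)) (ℕₚ.m≤m+n (# (B ∩ A)) _)
  where
  f : ∀ a b → (a ≡ true → b ≡ true) → b ∧ a ≡ a
  f false b h = Boolₚ.∧-zeroʳ b
  f true  b h = trans (Boolₚ.∧-identityʳ b) (h refl)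

#-full : ∀ n → # {n} (λ _ → true) ≡ n
#-full zero    = refl
#-full (suc n) = cong suc (#-full n)

#-∁ : ∀ {n} (A : Sub n) → # A + # (∁ A) ≡ n
#-∁ {n} A = trans (sym (#-split (λ _ → true) A)) (#-full n)

#-∪₁ : ∀ {n} (A : Sub n) v → A v ≡ false → # (A ∪₁ v) ≡ suc (# A)
#-∪₁ A v h = trans (#-∖ (A ∪₁ v) v (∪₁-self A v)) (cong suc (#-cong f))
  where
  f : (A ∪₁ v) ∖ v ≗ A
  f w with w ≟ v
  ... | yes refl = trans (Boolₚ.∧-zeroʳ _) (sym h)
  ... | no  _    = trans (Boolₚ.∧-identityʳ _) (Boolₚ.∨-identityʳ (A w))

-- Exhaustive search through F₂ⁿ. Vectors are functions and are met by the search only up to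
-- pointwise equality, hence the first argument.
vec? : ∀ {n} {P : Vec₂ n → Set} → (∀ {c d} → c ≗ d → P c → P d) → (∀ c → Dec (P c)) → Dec (∃ P)
vec? {zero} resp P? = map′ (λ p → _ , p) (λ { (c , p) → resp (λ ()) p }) (P? λ ())
vec? {suc n} {P} resp P? = map′
  [ (λ { (c , p) → _ , p }) , (λ { (c , p) → _ , p }) ]′ back
  (vec? (λ h → resp (cons-cong true h)) (λ c → P? (true VF.∷ c)) ⊎-dec
   vec? (λ h → resp (cons-cong false h)) (λ c → P? (false VF.∷ c)))
  where
  cons-cong : ∀ b {c d : Vec₂ n} → c ≗ d → (b VF.∷ c) ≗ (b VF.∷ d)
  cons-cong b h zero    = refl
  cons-cong b h (suc i) = h i
  η : ∀ b (c : Vec₂ (suc n)) → c zero ≡ b → c ≗ (b VF.∷ (c ∘ suc))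
  η b c e zero    = e
  η b c e (suc i) = refl
  back : ∃ P → _
  back (c , p) with c zero in e
  ... | true  = inj₁ (c ∘ suc , resp (η true c e) p)
  ... | false = inj₂ (c ∘ suc , resp (η false c e) p)

char : {A : Set} → Dec A → ℕ
char (yes _) = 1
char (no  _) = 0

char-mono : {A B : Set} (a : Dec A) (b : Dec B) → (A → B) → char a ≤ char b
char-mono (yes a) (yes b) f = s≤s z≤n
char-mono (yes a) (no ¬b) f = ⊥-elim (¬b (f a))
char-mono (no ¬a) b       f = z≤n

char-yes : {A : Set} (a : Dec A) → A → char a ≡ 1
char-yes (yes _) _ = refl
char-yes (no ¬a) a = ⊥-elim (¬a a)

char-no : {A : Set} (a : Dec A) → ¬ A → char a ≡ 0
char-no (yes a) ¬a = ⊥-elim (¬a a)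
char-no (no _)  _  = refl

char-≤1 : {A : Set} (a : Dec A) → char a ≤ 1
char-≤1 (yes _) = s≤s z≤n
char-≤1 (no _)  = z≤n

-- The two coordinates of the colour at a vertex, read as linear functionals on F₂ⁿ. Subspaces are
-- presented as common kernels of lists of them, so no bases have to be chosen.
data Bit (n : ℕ) : Set where
  xbit zbit : Fin n → Bit n

vertex : ∀ {n} → Bit n → Fin n
vertex (xbit v) = v
vertex (zbit v) = v

xbits bits : ∀ n → List (Bit n)
xbits n = map xbit (allFin n)
bits n = xbits n ++ map zbit (allFin n)

∈-xbits : ∀ {n} (v : Fin n) → xbit v ∈ xbits n
∈-xbits v = ∈ₚ.∈-map⁺ xbit (∈ₚ.∈-allFin v)

∈-bits : ∀ {n} (f : Bit n) → f ∈ bits n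
∈-bits (xbit v) = ∈ₚ.∈-++⁺ˡ (∈-xbits v)
∈-bits {n} (zbit v) = ∈ₚ.∈-++⁺ʳ (xbits n) (∈ₚ.∈-map⁺ zbit (∈ₚ.∈-allFin v))

module Rank {n : ℕ} (G : Graph n) where
  open Space G public

  ev : Bit n → Vec₂ n → Bool
  ev (xbit v) c = c v
  ev (zbit v) c = z c v

  ev-cong : ∀ f {c d} → c ≗ d → ev f c ≡ ev f d
  ev-cong (xbit v) h = h v
  ev-cong (zbit v) h = z-cong h v

  ev-⊞ : ∀ f c d → ev f (c ⊞ d) ≡ ev f c xor ev f d
  ev-⊞ (xbit v) c d = refl
  ev-⊞ (zbit v) c d = z-⊞ c d v

  ev-∅ : ∀ f {c} → (∀ v → c v ≡ false) → ev f c ≡ false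
  ev-∅ (xbit v) h = h v
  ev-∅ (zbit v) h = z-∅ h v

  Ker : List (Bit n) → Vec₂ n → Set
  Ker F c = All (λ f → ev f c ≡ false) F

  Ker-cong : ∀ {F c d} → c ≗ d → Ker F c → Ker F d
  Ker-cong h = All.map λ {f} e → trans (sym (ev-cong f h)) e

  Ker-⊞ : ∀ {F c d} → Ker F c → Ker F d → Ker F (c ⊞ d)
  Ker-⊞ [] [] = []
  Ker-⊞ {f ∷ F} {c} {d} (p ∷ ps) (q ∷ qs) = trans (ev-⊞ f c d) (cong₂ _xor_ p q) ∷ Ker-⊞ ps qs

  Ker-∅ : ∀ F {c} → (∀ v → c v ≡ false) → Ker F c
  Ker-∅ F h = All.tabulate λ {f} _ → ev-∅ f h

  Ker-swap : ∀ {f g F c} → Ker (f ∷ g ∷ F) c → Ker (g ∷ f ∷ F) c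
  Ker-swap (p ∷ q ∷ r) = q ∷ p ∷ r

  Ker-ʳ++⁺ : ∀ fs {F c} → Ker fs c → Ker F c → Ker (fs ʳ++ F) c
  Ker-ʳ++⁺ []       []       q = q
  Ker-ʳ++⁺ (f ∷ fs) (p ∷ ps) q = Ker-ʳ++⁺ fs ps (p ∷ q)

  Ker-ʳ++⁻ : ∀ fs {F c} → Ker (fs ʳ++ F) c → Ker fs c × Ker F c
  Ker-ʳ++⁻ []       p = [] , p
  Ker-ʳ++⁻ (f ∷ fs) p with Ker-ʳ++⁻ fs p
  ... | q , (e ∷ r) = (e ∷ q) , r

  Moves : List (Bit n) → Bit n → Set
  Moves F f = ∃ λ c → Ker F c × ev f c ≡ true

  moves? : ∀ F f → Dec (Moves F f)
  moves? F f = vec? (λ { h (k , e) → Ker-cong h k , trans (sym (ev-cong f h)) e })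
                    (λ c → All.all? (λ g → ev g c Boolₚ.≟ false) F ×-dec (ev f c Boolₚ.≟ true))

  -- The dimension lost when `f` is imposed on `Ker F`.
  b : List (Bit n) → Bit n → ℕ
  b F f = char (moves? F f)

  b-mono : ∀ {F F′} f → (∀ {c} → Ker F c → Ker F′ c) → b F f ≤ b F′ f
  b-mono {F} {F′} f h = char-mono (moves? F f) (moves? F′ f) λ { (c , k , e) → c , h k , e }

  -- Both sides are the dimension lost on imposing `f` and `g` together.
  b-swap : ∀ F f g → b F f + b (f ∷ F) g ≡ b F g + b (g ∷ F) f
  b-swap F f g with moves? F f | moves? (f ∷ F) g | moves? F g | moves? (g ∷ F) f
  ... | yes _ | yes _ | yes _ | yes _ = refl
  ... | yes _ | no _  | yes _ | no _  = refl
  ... | yes _ | no _  | no _  | yes _ = refl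
  ... | no _  | yes _ | yes _ | no _  = refl
  ... | no _  | no _  | no _  | no _  = refl
  ... | _ | yes (c , (_ ∷ k) , e) | no ¬p | _ = ⊥-elim (¬p (c , k , e))
  ... | no ¬p | _ | _ | yes (c , (_ ∷ k) , e) = ⊥-elim (¬p (c , k , e))
  ... | no ¬p | no ¬q | yes (c , k , e) | _ =
    ⊥-elim (¬q (c , (¬true⇒false (λ e′ → ¬p (c , k , e′)) ∷ k) , e))
  ... | yes (c , k , e) | _ | no ¬p | no ¬q =
    ⊥-elim (¬q (c , (¬true⇒false (λ e′ → ¬p (c , k , e′)) ∷ k) , e))
  -- `c` moves `f`, and `d` moves `g` while `f` vanishes on it. If `g` vanishes on `c`, then `c`
  -- still moves `f` inside the kernel of `g`; otherwise `c ⊞ d` does.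
  ... | yes (c , k , e) | yes (d , (e₀ ∷ k′) , e₁) | yes _ | no ¬q with ev g c in eq
  ...   | false = ⊥-elim (¬q (c , (eq ∷ k) , e))
  ...   | true  = ⊥-elim (¬q (c ⊞ d , (trans (ev-⊞ g c d) (cong₂ _xor_ eq e₁) ∷ Ker-⊞ k k′)
                                    , trans (ev-⊞ f c d) (cong₂ _xor_ e e₀)))
  b-swap F f g | yes _ | no ¬q | yes (d , k′ , e₁) | yes (c , (e₀ ∷ k) , e) with ev f d in eq
  ...   | false = ⊥-elim (¬q (d , (eq ∷ k′) , e₁))
  ...   | true  = ⊥-elim (¬q (d ⊞ c , (trans (ev-⊞ f d c) (cong₂ _xor_ eq e) ∷ Ker-⊞ k′ k)
                                    , trans (ev-⊞ g d c) (cong₂ _xor_ e₁ e₀)))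

  -- The number of bits in fs that are not determined by their predecessors on Ker F.
  rk : List (Bit n) → List (Bit n) → ℕ
  rk F []       = 0
  rk F (f ∷ fs) = b F f + rk (f ∷ F) fs

  rk-mono : ∀ {F F′} fs → (∀ {c} → Ker F c → Ker F′ c) → rk F fs ≤ rk F′ fs
  rk-mono []       h = z≤n
  rk-mono (f ∷ fs) h = ℕₚ.+-mono-≤ (b-mono f h) (rk-mono fs λ { (p ∷ k) → p ∷ h k })

  rk-swap : ∀ F f fs → b F f + rk (f ∷ F) fs ≡ rk F fs + b (fs ʳ++ F) f
  rk-swap F f []       = ℕₚ.+-comm _ 0
  rk-swap F f (g ∷ fs) = begin
    b F f + (b (f ∷ F) g + rk (g ∷ f ∷ F) fs)    ≡⟨ ℕₚ.+-assoc (b F f) _ _ ⟨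
    (b F f + b (f ∷ F) g) + rk (g ∷ f ∷ F) fs    ≡⟨ cong₂ _+_ (b-swap F f g) (ℕₚ.≤-antisym (rk-mono fs Ker-swap) (rk-mono fs Ker-swap)) ⟩
    (b F g + b (g ∷ F) f) + rk (f ∷ g ∷ F) fs    ≡⟨ ℕₚ.+-assoc (b F g) _ _ ⟩
    b F g + (b (g ∷ F) f + rk (f ∷ g ∷ F) fs)    ≡⟨ cong (b F g +_) (rk-swap (g ∷ F) f fs) ⟩
    b F g + (rk (g ∷ F) fs + b (fs ʳ++ g ∷ F) f) ≡⟨ ℕₚ.+-assoc (b F g) _ _ ⟨
    (b F g + rk (g ∷ F) fs) + b (fs ʳ++ g ∷ F) f ∎
    where open ≡-Reasoning

  -- All bits together leave only the zero vector, so the number of bits independent on `Ker F` is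
  -- the dimension of `Ker F`.
  dim : List (Bit n) → ℕ
  dim F = rk F (bits n)

  -- By `rk-swap`, `f` may be imposed before all bits or after them; after them it costs nothing,
  -- being one of them.
  dim-∷ : ∀ F f → dim F ≡ b F f + dim (f ∷ F)
  dim-∷ F f = sym (trans (rk-swap F f (bits n)) (trans (cong (dim F +_) (char-no (moves? (bits n ʳ++ F) f) ¬m)) (ℕₚ.+-identityʳ _)))
    where
    ¬m : ¬ Moves (bits n ʳ++ F) f
    ¬m (c , k , e) = true≢false e (All.lookup (proj₁ (Ker-ʳ++⁻ (bits n) k)) (∈-bits f))

  dim-mono : ∀ {F F′} → (∀ {c} → Ker F c → Ker F′ c) → dim F ≤ dim F′
  dim-mono = rk-mono (bits n)

  dim-cong : ∀ {F F′} → (∀ {c} → Ker F c → Ker F′ c) → (∀ {c} → Ker F′ c → Ker F c) → dim F ≡ dim F′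
  dim-cong h h′ = ℕₚ.≤-antisym (dim-mono h) (dim-mono h′)

  dim-zero : ∀ {F} → (∀ {c} → Ker F c → ∀ v → c v ≡ false) → dim F ≡ 0
  dim-zero {F} h = go F (bits n) h
    where
    go : ∀ F fs → (∀ {c} → Ker F c → ∀ v → c v ≡ false) → rk F fs ≡ 0
    go F []       h = refl
    go F (f ∷ fs) h = cong₂ _+_ (char-no (moves? F f) λ { (c , k , e) → true≢false e (ev-∅ f (h k)) })
                                (go (f ∷ F) fs λ { (_ ∷ k) → h k })

  -- A vector of `Ker F` is determined by its coordinates in `B`: imposing these one at a time costs
  -- at most one dimension each and ends at zero.
  dim-bound : ∀ m (B : Sub n) F → # B ≡ m →
    (∀ {c} → Ker F c → (∀ v → B v ≡ true → c v ≡ false) → ∀ v → c v ≡ false) → dim F ≤ m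
  dim-bound zero B F e h = ℕₚ.≤-reflexive (dim-zero λ k → h k λ v Bv → ⊥-elim (ℕₚ.1+n≰n (subst (1 ≤_) e (#-pos B Bv))))
  dim-bound (suc m) B F e h with #-nonempty B (subst (1 ≤_) (sym e) (s≤s z≤n))
  ... | v , Bv = subst (_≤ suc m) (sym (dim-∷ F (xbit v)))
    (ℕₚ.+-mono-≤ (char-≤1 (moves? F (xbit v)))
      (dim-bound m (B ∖ v) (xbit v ∷ F) (ℕₚ.suc-injective (trans (sym (#-∖ B v Bv)) e)) h′))
    where
    h′ : ∀ {c} → Ker (xbit v ∷ F) c → (∀ w → (B ∖ v) w ≡ true → c w ≡ false) → ∀ w → c w ≡ false
    h′ {c} (p ∷ k) q = h k f
      where
      f : ∀ w → B w ≡ true → c w ≡ false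
      f w Bw with w ≟ v
      ... | yes refl = p
      ... | no  w≢v  = q w (trans (∖-≢ B w≢v) Bw)

  -- A functional that is nonzero on `Ker F` is nonzero on the larger `Ker F′`, so imposing `fs`
  -- costs `Ker F′` at least as much.
  supermodular : ∀ fs {F F′} → (∀ {c} → Ker F c → Ker F′ c) →
    dim F + dim (fs ʳ++ F′) ≤ dim (fs ʳ++ F) + dim F′
  -- `x` lies outside the sum of `Ker F` and the kernel of `fs`. While `fs` is imposed, `x` is
  -- corrected by vectors of `Ker F` so as to stay in the kernel; the correction has to fail
  -- somewhere, and there the functional costs `Ker F′` a dimension but `Ker F` none.
  supermodular-< : ∀ fs {F F′} x → (∀ {c} → Ker F c → Ker F′ c) → Ker F′ x →
    (∀ s → Ker F s → ¬ Ker fs (x ⊞ s)) →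
    suc (dim F + dim (fs ʳ++ F′)) ≤ dim (fs ʳ++ F) + dim F′

  private
    shift : ∀ {β β′ p q q′ p′ t t′ k} → t ≡ β + p → t′ ≡ β′ + p′ → β ≤ β′ → k + (p + q) ≤ q′ + p′ → k + (t + q) ≤ q′ + t′
    shift {β} {β′} {p} {q} {q′} {p′} {k = k} refl refl h h′ = begin
      k + (β + p + q)   ≡⟨ cong (k +_) (ℕₚ.+-assoc β p q) ⟩
      k + (β + (p + q)) ≡⟨ ℕₚ.+-assoc k β _ ⟨
      k + β + (p + q)   ≡⟨ cong (_+ (p + q)) (ℕₚ.+-comm k β) ⟩
      β + k + (p + q)   ≡⟨ ℕₚ.+-assoc β k _ ⟩
      β + (k + (p + q)) ≤⟨ ℕₚ.+-mono-≤ h h′ ⟩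
      β′ + (q′ + p′)    ≡⟨ ℕₚ.+-assoc β′ q′ p′ ⟨
      β′ + q′ + p′      ≡⟨ cong (_+ p′) (ℕₚ.+-comm β′ q′) ⟩
      q′ + β′ + p′      ≡⟨ ℕₚ.+-assoc q′ β′ p′ ⟩
      q′ + (β′ + p′)    ∎
      where open ℕₚ.≤-Reasoning

    lift : ∀ {f F F′} → (∀ {c} → Ker F c → Ker F′ c) → ∀ {c} → Ker (f ∷ F) c → Ker (f ∷ F′) c
    lift h (p ∷ k) = p ∷ h k

  supermodular [] {F} {F′} h = ℕₚ.≤-refl
  supermodular (f ∷ fs) {F} {F′} h =
    shift {k = 0} (dim-∷ F f) (dim-∷ F′ f) (b-mono f h) (supermodular fs (lift h))

  supermodular-< [] {F} x h kx ¬k = ⊥-elim (¬k (λ _ → false) (Ker-∅ F λ _ → refl) [])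
  supermodular-< (f ∷ fs) {F} {F′} x h kx ¬k with ev f x in eq
  ... | false = shift {k = 1} (dim-∷ F f) (dim-∷ F′ f) (b-mono f h)
    (supermodular-< fs x (lift h) (eq ∷ kx)
      λ { s (e ∷ k) ks → ¬k s k (trans (ev-⊞ f x s) (cong₂ _xor_ eq e) ∷ ks) })
  ... | true with moves? F f in meq
  ...   | yes (s₀ , k₀ , e₀) = shift {k = 1} (dim-∷ F f) (dim-∷ F′ f) (b-mono f h)
    (supermodular-< fs (x ⊞ s₀) (lift h) (trans (ev-⊞ f x s₀) (cong₂ _xor_ eq e₀) ∷ Ker-⊞ kx (h k₀))
      λ { s (e ∷ k) ks → ¬k (s₀ ⊞ s) (Ker-⊞ k₀ k)
           (trans (ev-⊞ f x (s₀ ⊞ s)) (cong₂ _xor_ eq (trans (ev-⊞ f s₀ s) (cong₂ _xor_ e₀ e)))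
            ∷ Ker-cong (λ v → Boolₚ.xor-assoc (x v) (s₀ v) (s v)) ks) })
  ...   | no _ = shift {β = 0} {β′ = 0} {q′ = dim (fs ʳ++ f ∷ F)} {p′ = dim F′} {k = 1}
    (trans (dim-∷ F f) (cong (_+ dim (f ∷ F)) (cong char meq)))
    refl z≤n
    (ℕₚ.≤-trans (s≤s (supermodular fs (lift h))) (ℕₚ.≤-reflexive
      (trans (sym (ℕₚ.+-suc (dim (fs ʳ++ f ∷ F)) _)) (cong (dim (fs ʳ++ f ∷ F) +_) (sym (trans (dim-∷ F′ f)
         (cong (_+ dim (f ∷ F′)) (char-yes (moves? F′ f) (x , kx , eq)))))))))

-- Cutrank: supermodularity, duality and primality

mkSplit : ∀ {n} {G : Graph n} (A A′ B′ : Sub n) → 2 ≤ # A → 2 ≤ # (∁ A) →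
  (∀ x y → A x ≡ true → A y ≡ false → G x y ≡ A′ x ∧ B′ y) → Split G
mkSplit A A′ B′ 2≤A 2≤∁A h with #-two (∁ A) 2≤∁A
... | a , b , a≢b , p , q = A , #-two A 2≤A , (a , b , a≢b , Boolₚ.not-injective p , Boolₚ.not-injective q) ,
  (λ x → A x ∧ A′ x) , (λ y → not (A y) ∧ B′ y) , (λ x e → proj₁ (∧-true e)) ,
  (λ y e → Boolₚ.not-injective (proj₁ (∧-true e))) ,
  λ x y Ax ¬Ay → let e = h x y Ax ¬Ay in
    (λ g → let p , q = ∧-true {A′ x} (trans (sym e) g) in cong₂ _∧_ Ax p , cong₂ _∧_ (cong not ¬Ay) q) ,
    λ { (p , q) → trans e (cong₂ _∧_ (proj₂ (∧-true {A x} p)) (proj₂ (∧-true {not (A y)} q))) }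

module Conn {n : ℕ} (G : Graph n) where
  open Rank G public

  Supp : Vec₂ n → Sub n → Set
  Supp c A = ∀ v → A v ≡ false → col c v ≡ 0ᴷ

  Supp-⊆ : ∀ {c A B} → A ⊆ B → Supp c A → Supp c B
  Supp-⊆ {A = A} {B} h s v Bv = s v (⊆-false {A = A} {B} h v Bv)

  Supp-∖ : ∀ {c A v} → Supp c A → col c v ≡ 0ᴷ → Supp c (A ∖ v)
  Supp-∖ {c} {A} {v} s e w h with w ≟ v
  ... | yes refl = e
  ... | no  w≢v  = s w (trans (sym (Boolₚ.∧-identityʳ (A w))) h)

  Supp-cong : ∀ {c d A} → c ≗ d → Supp c A → Supp d A
  Supp-cong h s v e = trans (cong₂ _,_ (sym (h v)) (sym (z-cong h v))) (s v e)

  supp? : ∀ c A → Dec (Supp c A)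
  supp? c A = Finₚ.all? λ v → (A v Boolₚ.≟ false) →-dec ≟0 (col c v)

  out : Sub n → List (Bit n)
  out A = filter (λ f → A (vertex f) Boolₚ.≟ false) (bits n)

  Ker-out⁺ : ∀ {c A} → Supp c A → Ker (out A) c
  Ker-out⁺ {c} {A} s = All.tabulate λ {f} f∈ → at f (proj₂ (∈ₚ.∈-filter⁻ (λ f → A (vertex f) Boolₚ.≟ false) {xs = bits n} f∈))
    where
    at : ∀ f → A (vertex f) ≡ false → ev f c ≡ false
    at (xbit v) e = cong proj₁ (s v e)
    at (zbit v) e = cong proj₂ (s v e)

  Ker-out⁻ : ∀ {c A} → Ker (out A) c → Supp c A
  Ker-out⁻ {c} {A} k v e = cong₂ _,_ (at (xbit v) e) (at (zbit v) e)
    where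
    at : ∀ f → A (vertex f) ≡ false → ev f c ≡ false
    at f e = All.lookup k (∈ₚ.∈-filter⁺ (λ f → A (vertex f) Boolₚ.≟ false) (∈-bits f) e)

  r : Sub n → ℕ
  r A = dim (out A)

  r-mono : ∀ {A B} → A ⊆ B → r A ≤ r B
  r-mono {A} {B} h = dim-mono λ {c} k → Ker-out⁺ {c} {B} (Supp-⊆ {c} {A} {B} h (Ker-out⁻ {c} {A} k))

  r-cong : ∀ {A B} → A ≗ B → r A ≡ r B
  r-cong {A} {B} h = ℕₚ.≤-antisym (r-mono {A} {B} λ v e → trans (sym (h v)) e) (r-mono {B} {A} λ v e → trans (h v) e)

  r-witness : ∀ {A B} → r A < r B → ∃ λ c → Supp c B × ¬ Supp c A
  r-witness {A} {B} lt with vec? {P = λ c → Supp c B × ¬ Supp c A}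
      (λ { {c} {d} h (s , ¬s) → Supp-cong {c} {d} {B} h s , λ t → ¬s (Supp-cong {d} {c} {A} (sym ∘ h) t) })
      (λ c → supp? c B ×-dec ¬? (supp? c A))
  ... | yes w = w
  ... | no ¬w = ⊥-elim (ℕₚ.<⇒≱ lt (dim-mono λ {c} k → Ker-out⁺ {c} {A} (f c (Ker-out⁻ {c} {B} k))))
    where
    f : ∀ c → Supp c B → Supp c A
    f c s with supp? c A
    ... | yes t = t
    ... | no ¬t = ⊥-elim (¬w (c , s , ¬t))

  r-∅ : ∀ A → (∀ v → A v ≡ false) → r A ≡ 0
  r-∅ A h = dim-zero λ {c} k v → cong proj₁ (Ker-out⁻ {c} {A} k v (h v))

  -- The dimension of the space of colours at `v` taken by vectors supported in `B`.
  d : Sub n → Fin n → ℕ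
  d B v = b (out B) (xbit v) + b (xbit v ∷ out B) (zbit v)

  marginal : ∀ B v → r B ≡ d B v + r (B ∖ v)
  marginal B v = trans (dim-∷ (out B) (xbit v)) (trans
    (cong (b (out B) (xbit v) +_) (trans (dim-∷ (xbit v ∷ out B) (zbit v)) (cong (b (xbit v ∷ out B) (zbit v) +_)
      (dim-cong (λ {c} → to {c}) (λ {c} → from {c})))))
    (sym (ℕₚ.+-assoc (b (out B) (xbit v)) _ _)))
    where
    to : ∀ {c} → Ker (zbit v ∷ xbit v ∷ out B) c → Ker (out (B ∖ v)) c
    to {c} (p ∷ q ∷ k) = Ker-out⁺ {c} {B ∖ v} (Supp-∖ {c} {B} (Ker-out⁻ {c} {B} k) (cong₂ _,_ q p))
    from : ∀ {c} → Ker (out (B ∖ v)) c → Ker (zbit v ∷ xbit v ∷ out B) c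
    from {c} k = cong proj₂ e ∷ cong proj₁ e ∷ Ker-out⁺ {c} {B} (Supp-⊆ {c} {B ∖ v} {B} (∖-⊆ {A = B}) s)
      where
      s : Supp c (B ∖ v)
      s = Ker-out⁻ {c} {B ∖ v} k
      e : col c v ≡ 0ᴷ
      e = s v (∖-self B v)

  private
    count₁ : ∀ {P Q : Set} (p : Dec P) (q : Dec Q) → P ⊎ Q → 1 ≤ char p + char q
    count₁ (yes _) q       h = s≤s z≤n
    count₁ (no ¬p) (yes _) h = s≤s z≤n
    count₁ (no ¬p) (no ¬q) h = ⊥-elim ([ ¬p , ¬q ]′ h)

    count₁⁻ : ∀ {P Q : Set} (p : Dec P) (q : Dec Q) → 1 ≤ char p + char q → P ⊎ Q
    count₁⁻ (yes p) q       h = inj₁ p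
    count₁⁻ (no ¬p) (yes q) h = inj₂ q

    count₂ : ∀ {P Q : Set} (p : Dec P) (q : Dec Q) → P → Q → 2 ≤ char p + char q
    count₂ p q hp hq = ℕₚ.≤-reflexive (sym (cong₂ _+_ (char-yes p hp) (char-yes q hq)))

    count₂⁻ : ∀ {P Q : Set} (p : Dec P) (q : Dec Q) → 2 ≤ char p + char q → P × Q
    count₂⁻ (yes p) (yes q) h = p , q
    count₂⁻ (yes p) (no ¬q) (s≤s ())
    count₂⁻ (no ¬p) (yes q) (s≤s ())

  d-≤2 : ∀ B v → d B v ≤ 2
  d-≤2 B v = ℕₚ.+-mono-≤ (char-≤1 (moves? (out B) (xbit v))) (char-≤1 (moves? (xbit v ∷ out B) (zbit v)))

  d-pos : ∀ {c B v} → Supp c B → col c v ≢ 0ᴷ → 1 ≤ d B v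
  d-pos {c} {B} {v} s ≢0 = count₁ (moves? (out B) (xbit v)) (moves? (xbit v ∷ out B) (zbit v)) (go (c v) refl (z c v) refl)
    where
    k : Ker (out B) c
    k = Ker-out⁺ {c} {B} s
    go : ∀ x → c v ≡ x → ∀ y → z c v ≡ y → Moves (out B) (xbit v) ⊎ Moves (xbit v ∷ out B) (zbit v)
    go true  e _ _      = inj₁ (c , k , e)
    go false e true e′  = inj₂ (c , e ∷ k , e′)
    go false e false e′ = ⊥-elim (≢0 (cong₂ _,_ e e′))

  -- What is needed is one vector with first coordinate 1 at `v` and one with colour (0,1) there. If
  -- both given vectors have first coordinate 1, their sum serves as the second.
  d-two : ∀ {c c′ B v} → Supp c B → Supp c′ B → ω (col c v) (col c′ v) ≡ true → 2 ≤ d B v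
  d-two {c} {c′} {B} {v} s s′ h = go (c v) refl (z c v) refl (c′ v) refl (z c′ v) refl h
    where
    k : Ker (out B) c
    k = Ker-out⁺ {c} {B} s
    k′ : Ker (out B) c′
    k′ = Ker-out⁺ {c′} {B} s′
    two : Moves (out B) (xbit v) → Moves (xbit v ∷ out B) (zbit v) → 2 ≤ d B v
    two = count₂ (moves? (out B) (xbit v)) (moves? (xbit v ∷ out B) (zbit v))
    go : ∀ x → c v ≡ x → ∀ y → z c v ≡ y → ∀ x′ → c′ v ≡ x′ → ∀ y′ → z c′ v ≡ y′ →
      ω (x , y) (x′ , y′) ≡ true → 2 ≤ d B v
    go false e true  e₁ true  e′ y′    e₁′ h = two (c′ , k′ , e′) (c , e ∷ k , e₁)
    go true  e y     e₁ false e′ true  e₁′ h = two (c , k , e) (c′ , e′ ∷ k′ , e₁′)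
    go true  e false e₁ true  e′ true  e₁′ h = two (c , k , e)
      (c ⊞ c′ , cong₂ _xor_ e e′ ∷ Ker-⊞ k k′ , trans (z-⊞ c c′ v) (cong₂ _xor_ e₁ e₁′))
    go true  e true  e₁ true  e′ false e₁′ h = two (c , k , e)
      (c ⊞ c′ , cong₂ _xor_ e e′ ∷ Ker-⊞ k k′ , trans (z-⊞ c c′ v) (cong₂ _xor_ e₁ e₁′))
    go false e false e₁ x′ e′ y′ e₁′ ()
    go false e true  e₁ false e′ y′ e₁′ ()
    go true  e false e₁ false e′ false e₁′ ()
    go true  e true  e₁ false e′ false e₁′ ()
    go true  e false e₁ true e′ false e₁′ ()
    go true  e true e₁ true e′ true e₁′ ()

  d-pos⁻ : ∀ B v → 1 ≤ d B v → ∃ λ c → Supp c B × col c v ≢ 0ᴷ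
  d-pos⁻ B v h with count₁⁻ (moves? (out B) (xbit v)) (moves? (xbit v ∷ out B) (zbit v)) h
  ... | inj₁ (c , k , e) = c , Ker-out⁻ {c} {B} k , λ e′ → true≢false e (cong proj₁ e′)
  ... | inj₂ (c , (_ ∷ k) , e) = c , Ker-out⁻ {c} {B} k , λ e′ → true≢false e (cong proj₂ e′)

  d-two⁻ : ∀ B v → 2 ≤ d B v → ∃ λ c → ∃ λ c′ → Supp c B × Supp c′ B × ω (col c v) (col c′ v) ≡ true
  d-two⁻ B v h with count₂⁻ (moves? (out B) (xbit v)) (moves? (xbit v ∷ out B) (zbit v)) h
  ... | (c , k , e) , (c′ , (e₀ ∷ k′) , e₁) = c , c′ , Ker-out⁻ {c} {B} k , Ker-out⁻ {c′} {B} k′ ,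
    trans (cong₂ _xor_ (cong₂ _∧_ e e₁) (cong (z c v ∧_) e₀)) (cong not (Boolₚ.∧-zeroʳ (z c v)))

  private
    ⊆-∖ : ∀ {A B : Sub n} {v} → A ⊆ B → A v ≡ false → A ⊆ B ∖ v
    ⊆-∖ {A} {B} {v} h e w Aw = trans (∖-≢ B λ { refl → true≢false Aw e }) (h w Aw)

  r-step : ∀ {A B c v} → A ⊆ B → A v ≡ false → Supp c B → col c v ≢ 0ᴷ → 1 + r A ≤ r B
  r-step {A} {B} {c} {v} h e s ≢0 = subst (1 + r A ≤_) (sym (marginal B v))
    (ℕₚ.+-mono-≤ (d-pos {c} {B} s ≢0) (r-mono {A} {B ∖ v} (⊆-∖ {A} {B} h e)))

  r-step₂ : ∀ {A B c c′ v} → A ⊆ B → A v ≡ false → Supp c B → Supp c′ B →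
    ω (col c v) (col c′ v) ≡ true → 2 + r A ≤ r B
  r-step₂ {A} {B} {c} {c′} {v} h e s s′ t = subst (2 + r A ≤_) (sym (marginal B v))
    (ℕₚ.+-mono-≤ (d-two {c} {c′} {B} s s′ t) (r-mono {A} {B ∖ v} (⊆-∖ {A} {B} h e)))

  r-pos : ∀ {A c v} → Supp c A → col c v ≢ 0ᴷ → 1 ≤ r A
  r-pos {A} {c} {v} s ≢0 = subst (λ k → suc k ≤ r A) (r-∅ (λ _ → false) λ _ → refl)
    (r-step {λ _ → false} {A} {c} (λ _ ()) refl s ≢0)

  -- The vectors supported in `A` and those supported in `B` span a space of dimension
  -- `r A + r B − r (A ∩ B)` among the vectors supported in `A ∪ B`. The extra 1 is for `x`, which
  -- lies outside this span.
  r-supermodular : ∀ {A B} x → Supp x (A ∪ B) → (∀ s → Supp s B → ¬ Supp (x ⊞ s) A) →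
    suc (r A + r B) ≤ r (A ∩ B) + r (A ∪ B)
  r-supermodular {A} {B} x sx ¬s = begin
    suc (r A + r B) ≡⟨ cong suc (ℕₚ.+-comm (r A) (r B)) ⟩
    suc (r B + r A) ≤⟨ s≤s (ℕₚ.+-monoʳ-≤ (r B) (dim-mono λ {c} k →
        Ker-ʳ++⁺ (out A) k (Ker-out⁺ {c} {A ∪ B} (Supp-⊆ {c} {A} {A ∪ B} (λ v e → cong (_∨ B v) e) (Ker-out⁻ {c} {A} k))))) ⟩
    suc (r B + dim (out A ʳ++ out (A ∪ B)))
      ≤⟨ supermodular-< (out A) x
           (λ {c} k → Ker-out⁺ {c} {A ∪ B} (Supp-⊆ {c} {B} {A ∪ B} (λ v e → trans (cong (A v ∨_) e) (Boolₚ.∨-zeroʳ (A v))) (Ker-out⁻ {c} {B} k)))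
           (Ker-out⁺ {x} {A ∪ B} sx) (λ s k k′ → ¬s s (Ker-out⁻ {s} {B} k) (Ker-out⁻ {x ⊞ s} {A} k′)) ⟩
    dim (out A ʳ++ out B) + r (A ∪ B) ≤⟨ ℕₚ.+-monoˡ-≤ (r (A ∪ B)) (dim-mono λ {c} k →
        Ker-out⁺ {c} {A ∩ B} (meet c (Ker-out⁻ {c} {A} (proj₁ (Ker-ʳ++⁻ (out A) k))) (Ker-out⁻ {c} {B} (proj₂ (Ker-ʳ++⁻ (out A) k))))) ⟩
    r (A ∩ B) + r (A ∪ B) ∎
    where
    open ℕₚ.≤-Reasoning
    meet : ∀ c → Supp c A → Supp c B → Supp c (A ∩ B)
    meet c s t v e with A v in eq
    ... | true  = t v e
    ... | false = s v eq

  -- Only the first coordinates outside `A` have to vanish, so the kernel consists of all vectors on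
  -- `A`. Those supported in `A` are the ones annihilated in addition by the rows of G outside `A`.
  xout : Sub n → List (Bit n)
  xout A = filter (λ f → A (vertex f) Boolₚ.≟ false) (xbits n)

  Ker-xout⁺ : ∀ {c A} → (∀ v → A v ≡ false → c v ≡ false) → Ker (xout A) c
  Ker-xout⁺ {c} {A} h = All.tabulate λ {f} f∈ → at f (∈ₚ.∈-filter⁻ (λ f → A (vertex f) Boolₚ.≟ false) {xs = xbits n} f∈)
    where
    at : ∀ f → f ∈ xbits n × A (vertex f) ≡ false → ev f c ≡ false
    at (xbit v) (_ , e) = h v e
    at (zbit v) (m , e) with ∈ₚ.∈-map⁻ xbit m
    ... | _ , _ , ()

  Ker-xout⁻ : ∀ {c A} → Ker (xout A) c → ∀ v → A v ≡ false → c v ≡ false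
  Ker-xout⁻ {c} {A} k v e = All.lookup k (∈ₚ.∈-filter⁺ (λ f → A (vertex f) Boolₚ.≟ false) (∈-xbits v) e)

  dim-xout : ∀ m A → # A ≡ m → m ≤ dim (xout A)
  dim-xout zero    A e = z≤n
  dim-xout (suc m) A e with #-nonempty A (subst (1 ≤_) (sym e) (s≤s z≤n))
  ... | v , Av = subst (suc m ≤_) (sym (dim-∷ (xout A) (xbit v)))
    (ℕₚ.+-mono-≤ (ℕₚ.≤-reflexive (sym (char-yes (moves? (xout A) (xbit v))
        (unit v , Ker-xout⁺ {unit v} {A} (λ w Aw → same-≢ λ { refl → true≢false Av Aw }) , same-refl v))))
      (ℕₚ.≤-trans (dim-xout m (A ∖ v) (ℕₚ.suc-injective (trans (sym (#-∖ A v Av)) e)))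
        (dim-mono λ {c} k → Ker-xout⁻ {c} {A ∖ v} k v (∖-self A v)
           ∷ Ker-xout⁺ {c} {A} λ w Aw → Ker-xout⁻ {c} {A ∖ v} k w (cong (_∧ not (same w v)) Aw))))

  module Simple (G-simple : IsSimple G) where
    G-sym : ∀ x y → G x y ≡ G y x
    G-sym = proj₁ G-simple

    commute-supp : ∀ {c e A B v} → Supp c A → Supp e B →
      (∀ w → w ≢ v → A w ≡ false ⊎ B w ≡ false) → ω (col c v) (col e v) ≡ false
    commute-supp {c} {e} {v = v} s t h = commute-at G-sym c e v λ w w≢v →
      [ (λ Aw → cong (λ k → ω k (col e w)) (s w Aw))
      , (λ Bw → trans (cong (ω (col c w)) (t w Bw)) (ω-zeroʳ (col c w))) ]′ (h w w≢v)

    -- The two spaces of colours at `v` are orthogonal to each other, and in a symplectic plane the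
    -- orthogonal complement of the whole plane is zero.
    d-sum : ∀ A B v → (∀ w → w ≢ v → A w ≡ false ⊎ B w ≡ false) → d A v + d B v ≤ 2
    d-sum A B v h = go (d A v) refl (d B v) refl (d-≤2 A v) (d-≤2 B v)
      where
      swap⊎ : ∀ {P Q : Set} → P ⊎ Q → Q ⊎ P
      swap⊎ = [ inj₂ , inj₁ ]′
      clash : ∀ A B → (∀ w → w ≢ v → A w ≡ false ⊎ B w ≡ false) → 2 ≤ d A v → 1 ≤ d B v → ⊥
      clash A B h p q with d-two⁻ A v p | d-pos⁻ B v q
      ... | c , c′ , s , s′ , t | e , u , e≢0 = ω-true⇒≢ {col c v} {col c′ v} t (trans
        (ω-false (ω-true⇒≢0ˡ {col c v} {col c′ v} t) e≢0 (commute-supp {c} {e} {A} {B} s u h))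
        (sym (ω-false (ω-true⇒≢0ʳ {col c v} {col c′ v} t) e≢0 (commute-supp {c′} {e} {A} {B} s′ u h))))
      go : ∀ p → d A v ≡ p → ∀ q → d B v ≡ q → d A v ≤ 2 → d B v ≤ 2 → d A v + d B v ≤ 2
      go 0 e _ _ _ l = subst (λ p → p + d B v ≤ 2) (sym e) l
      go (suc p) e 0 e′ l _ = subst (_≤ 2) (sym (trans (cong (d A v +_) e′) (ℕₚ.+-identityʳ _))) l
      go 1 e 1 e′ _ _ = ℕₚ.≤-reflexive (cong₂ _+_ e e′)
      go (suc (suc p)) e (suc q) e′ _ _ = ⊥-elim (clash A B h (subst (2 ≤_) (sym e) (s≤s (s≤s z≤n))) (subst (1 ≤_) (sym e′) (s≤s z≤n)))
      go 1 e (suc (suc q)) e′ _ _ = ⊥-elim (clash B A (λ w n → swap⊎ (h w n)) (subst (2 ≤_) (sym e′) (s≤s (s≤s z≤n))) (subst (1 ≤_) (sym e) (s≤s z≤n)))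

    private
      -- The colours at v of vectors supported in A are orthogonal to those of vectors supported in ∁ (A ∖ v),
      -- so adding v to one side and removing it from the other costs at most 2 dimensions.
      duality-≤ : ∀ m A → # A ≡ m → r A + n ≤ r (∁ A) + (m + m)
      duality-≤ zero A e = begin
        r A + n         ≡⟨ cong (_+ n) (r-∅ A empty) ⟩
        n               ≤⟨ dim-xout n (λ _ → true) (#-full n) ⟩
        dim (xout (λ _ → true)) ≤⟨ dim-mono (λ {c} _ → Ker-out⁺ {c} {∁ A} λ v ¬Av → ⊥-elim (true≢false (cong not (empty v)) ¬Av)) ⟩
        r (∁ A)         ≡⟨ ℕₚ.+-identityʳ _ ⟨
        r (∁ A) + 0     ∎
        where
        open ℕₚ.≤-Reasoning
        empty : ∀ v → A v ≡ false
        empty v = ¬true⇒false λ Av → ℕₚ.1+n≰n (subst (1 ≤_) e (#-pos A Av))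
      duality-≤ (suc m) A e with #-nonempty A (subst (1 ≤_) (sym e) (s≤s z≤n))
      ... | v , Av = begin
        r A + n                                    ≡⟨ cong (_+ n) (marginal A v) ⟩
        d A v + r (A ∖ v) + n                      ≡⟨ ℕₚ.+-assoc (d A v) _ n ⟩
        d A v + (r (A ∖ v) + n)                    ≤⟨ ℕₚ.+-monoʳ-≤ (d A v) (duality-≤ m (A ∖ v) (ℕₚ.suc-injective (trans (sym (#-∖ A v Av)) e))) ⟩
        d A v + (r (∁ (A ∖ v)) + (m + m))          ≡⟨ cong (λ k → d A v + (k + (m + m))) (trans (marginal (∁ (A ∖ v)) v) (cong (d (∁ (A ∖ v)) v +_) (r-cong {∁ (A ∖ v) ∖ v} {∁ A} ptw))) ⟩
        d A v + (d (∁ (A ∖ v)) v + r (∁ A) + (m + m)) ≡⟨ cong (d A v +_) (ℕₚ.+-assoc (d (∁ (A ∖ v)) v) _ _) ⟩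
        d A v + (d (∁ (A ∖ v)) v + (r (∁ A) + (m + m))) ≡⟨ ℕₚ.+-assoc (d A v) _ _ ⟨
        d A v + d (∁ (A ∖ v)) v + (r (∁ A) + (m + m)) ≤⟨ ℕₚ.+-monoˡ-≤ (r (∁ A) + (m + m)) (d-sum A (∁ (A ∖ v)) v disj) ⟩
        2 + (r (∁ A) + (m + m))                    ≡⟨ trans (cong suc (sym (ℕₚ.+-suc (r (∁ A)) (m + m)))) (trans (sym (ℕₚ.+-suc (r (∁ A)) (suc (m + m)))) (cong (λ k → r (∁ A) + suc k) (sym (ℕₚ.+-suc m m)))) ⟩
        r (∁ A) + (suc m + suc m)                  ∎
        where
        open ℕₚ.≤-Reasoning
        ptw : ∁ (A ∖ v) ∖ v ≗ ∁ A
        ptw w with w ≟ v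
        ... | yes refl = trans (Boolₚ.∧-zeroʳ _) (sym (cong not Av))
        ... | no  _    = trans (Boolₚ.∧-identityʳ _) (cong not (Boolₚ.∧-identityʳ (A w)))
        disj : ∀ w → w ≢ v → A w ≡ false ⊎ ∁ (A ∖ v) w ≡ false
        disj w w≢v with A w in eq
        ... | false = inj₁ refl
        ... | true  = inj₂ (cong not (trans (cong (true ∧_) (cong not (same-≢ w≢v))) refl))

      duality-≤′ : ∀ A → r A + # (∁ A) ≤ r (∁ A) + # A
      duality-≤′ A = ℕₚ.+-cancelʳ-≤ (# A) _ _ (begin
        r A + # (∁ A) + # A   ≡⟨ ℕₚ.+-assoc (r A) _ _ ⟩
        r A + (# (∁ A) + # A) ≡⟨ cong (r A +_) (trans (ℕₚ.+-comm (# (∁ A)) (# A)) (#-∁ A)) ⟩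
        r A + n               ≤⟨ duality-≤ (# A) A refl ⟩
        r (∁ A) + (# A + # A) ≡⟨ ℕₚ.+-assoc (r (∁ A)) _ _ ⟨
        r (∁ A) + # A + # A   ∎)
        where open ℕₚ.≤-Reasoning

    -- The symmetry of cutrank, `# A − r A` equal to `# (∁ A) − r (∁ A)`, written without truncated
    -- subtraction.
    duality : ∀ A → r A + # (∁ A) ≡ r (∁ A) + # A
    duality A = ℕₚ.≤-antisym (duality-≤′ A)
      (subst₂ (λ p q → r (∁ A) + p ≤ q + # (∁ A)) (#-cong dn) (r-cong {∁ (∁ A)} {A} dn) (duality-≤′ (∁ A)))
      where
      dn : ∁ (∁ A) ≗ A
      dn v = Boolₚ.not-involutive (A v)

    -- This is cutrank at least 2, found by looking for a nonsingular 2 by 2 minor of the cut. If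
    -- there is one, the coordinates at `x` and `x′` of a vector supported in `A` follow from the
    -- others; if there is none, the cut has rank at most 1, which is a split.
    prime-bound : Prime G → ∀ A → 2 ≤ # A → 2 ≤ # (∁ A) → 2 + r A ≤ # A
    prime-bound prime A 2≤A 2≤∁A with Finₚ.any? (λ x → Finₚ.any? λ x′ → Finₚ.any? λ y → Finₚ.any? λ y′ →
        (A x Boolₚ.≟ true) ×-dec (A x′ Boolₚ.≟ true) ×-dec (A y Boolₚ.≟ false) ×-dec (A y′ Boolₚ.≟ false)
        ×-dec ((G y x ∧ G y′ x′) xor (G y x′ ∧ G y′ x) Boolₚ.≟ true))
    ... | yes (x , x′ , y , y′ , Ax , Ax′ , ¬Ay , ¬Ay′ , det) = subst (2 + r A ≤_) (sym #A)
        (s≤s (s≤s (dim-bound _ (A ∖ x ∖ x′) (out A) refl trivial)))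
      where
      x≢x′ : x ≢ x′
      x≢x′ refl = true≢false det (Boolₚ.xor-same (G y x ∧ G y′ x))
      #A : # A ≡ 2 + # (A ∖ x ∖ x′)
      #A = trans (#-∖ A x Ax) (cong suc (#-∖ (A ∖ x) x′ (trans (∖-≢ A (x≢x′ ∘ sym)) Ax′)))
      cramer : ∀ a a′ b b′ p q → (a ∧ b′) xor (a′ ∧ b) ≡ true →
        (a ∧ p) xor (a′ ∧ q) ≡ false → (b ∧ p) xor (b′ ∧ q) ≡ false → p ≡ false × q ≡ false
      cramer a a′ b b′ false false _ _ _ = refl , refl
      cramer false a′ false b′ true false h _ _ = ⊥-elim (true≢false h (Boolₚ.∧-zeroʳ a′))
      cramer a false b false false true h _ _ = ⊥-elim (true≢false h (cong (_xor (false ∧ b)) (Boolₚ.∧-zeroʳ a)))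
      cramer true true true true true true () _ _
      cramer true true false false true true () _ _
      cramer false false true true true true () _ _
      cramer false false false false true true () _ _
      cramer a true b b′ false true h p q = ⊥-elim (true≢false (cong (_xor true) (Boolₚ.∧-zeroʳ a)) p)
      cramer a false b true false true h p q = ⊥-elim (true≢false (cong (_xor true) (Boolₚ.∧-zeroʳ b)) q)
      cramer true a′ b b′ true false h p q = ⊥-elim (true≢false (cong not (Boolₚ.∧-zeroʳ a′)) p)
      cramer false a′ true b′ true false h p q = ⊥-elim (true≢false (cong not (Boolₚ.∧-zeroʳ b′)) q)
      trivial : ∀ {c} → Ker (out A) c → (∀ v → (A ∖ x ∖ x′) v ≡ true → c v ≡ false) → ∀ v → c v ≡ false
      trivial {c} k h = all
        where
        s : Supp c A
        s = Ker-out⁻ {c} {A} k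
        off : ∀ v → v ≢ x → v ≢ x′ → c v ≡ false
        off v v≢x v≢x′ with A v in eq
        ... | false = cong proj₁ (s v eq)
        ... | true  = h v (trans (∖-≢ (A ∖ x) v≢x′) (trans (∖-≢ A v≢x) eq))
        row : ∀ u → A u ≡ false → (G u x ∧ c x) xor (G u x′ ∧ c x′) ≡ false
        row u e = trans (sym (⊕-pair (λ w → G u w ∧ c w) x x′ x≢x′
          λ w w≢x w≢x′ → trans (cong (G u w ∧_) (off w w≢x w≢x′)) (Boolₚ.∧-zeroʳ (G u w)))) (cong proj₂ (s u e))
        both : c x ≡ false × c x′ ≡ false
        both = cramer (G y x) (G y x′) (G y′ x) (G y′ x′) (c x) (c x′) det (row y ¬Ay) (row y′ ¬Ay′)
        all : ∀ v → c v ≡ false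
        all v with v ≟ x | v ≟ x′
        ... | yes refl | _        = proj₁ both
        ... | no _     | yes refl = proj₂ both
        ... | no p     | no q     = off v p q
    ... | no ¬minor = ⊥-elim (prime split)
      where
      det0 : ∀ {x x′ y y′} → A x ≡ true → A x′ ≡ true → A y ≡ false → A y′ ≡ false →
        (G y x ∧ G y′ x′) xor (G y x′ ∧ G y′ x) ≡ false
      det0 p q p′ q′ = ¬true⇒false λ e → ¬minor (_ , _ , _ , _ , p , q , p′ , q′ , e)
      split : Split G
      split with Finₚ.any? (λ x → Finₚ.any? λ y → (A x Boolₚ.≟ true) ×-dec (A y Boolₚ.≟ false) ×-dec (G y x Boolₚ.≟ true))
      ... | no ¬edge = mkSplit A (λ _ → false) (λ _ → false) 2≤A 2≤∁A
        λ x y Ax ¬Ay → ¬true⇒false λ e → ¬edge (x , y , Ax , ¬Ay , trans (G-sym y x) e)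
      -- As all minors vanish, an edge `x₀ y₀` across the cut makes each entry the product of its
      -- entries in row `y₀` and column `x₀`.
      ... | yes (x₀ , y₀ , Ax₀ , ¬Ay₀ , e₀) = mkSplit A (G y₀) (λ y → G y x₀) 2≤A 2≤∁A entry
        where
        entry : ∀ x y → A x ≡ true → A y ≡ false → G x y ≡ G y₀ x ∧ G y x₀
        entry x y Ax ¬Ay = trans (G-sym x y) (xor-false
          (trans (cong (λ k → (k ∧ G y x) xor (G y₀ x ∧ G y x₀)) (sym e₀)) (det0 Ax₀ Ax ¬Ay₀ ¬Ay)))
          where
          xor-false : ∀ {a b} → a xor b ≡ false → a ≡ b
          xor-false {false} {false} _ = refl
          xor-false {true}  {true}  _ = refl

-- Triples and nonprime minors

#-≥3 : ∀ {n} (A : Sub n) {a b e} → a ≢ b → a ≢ e → b ≢ e → A a ≡ true → A b ≡ true → A e ≡ true → 3 ≤ # A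
#-≥3 A {a} a≢b a≢e b≢e Aa Ab Ae = subst (3 ≤_) (sym (#-∖ A a Aa))
  (s≤s (#-≥2 (A ∖ a) b≢e (trans (∖-≢ A (a≢b ∘ sym)) Ab) (trans (∖-≢ A (a≢e ∘ sym)) Ae)))

#-≤2-elim : ∀ {n} (A : Sub n) {a b w} → # A ≤ 2 → a ≢ b → A a ≡ true → A b ≡ true → A w ≡ true → w ≢ a → w ≢ b → ⊥
#-≤2-elim A l a≢b Aa Ab Aw w≢a w≢b = ℕₚ.<⇒≱ (#-≥3 A a≢b (w≢a ∘ sym) (w≢b ∘ sym) Aa Ab Aw) l

#-≤3-elim : ∀ {n} (A : Sub n) {a b e w} → # A ≤ 3 → a ≢ b → a ≢ e → b ≢ e → A a ≡ true → A b ≡ true → A e ≡ true →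
  A w ≡ true → w ≢ a → w ≢ b → w ≢ e → ⊥
#-≤3-elim A {a} l a≢b a≢e b≢e Aa Ab Ae Aw w≢a w≢b w≢e = #-≤2-elim (A ∖ a)
  (ℕₚ.≤-pred (subst (_≤ 3) (#-∖ A a Aa) l)) b≢e
  (trans (∖-≢ A (a≢b ∘ sym)) Ab) (trans (∖-≢ A (a≢e ∘ sym)) Ae) (trans (∖-≢ A w≢a) Aw) w≢b w≢e

#-large-∁ : ∀ {n} (A : Sub n) k → # A ≤ k → k + 2 ≤ n → 2 ≤ # (∁ A)
#-large-∁ {n} A k l k+2≤n = ℕₚ.+-cancelˡ-≤ k _ _ (ℕₚ.≤-trans k+2≤n
  (ℕₚ.≤-trans (ℕₚ.≤-reflexive (sym (#-∁ A))) (ℕₚ.+-monoˡ-≤ (# (∁ A)) l)))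

set : ∀ {n} → List (Fin n) → Sub n
set []       _ = false
set (x ∷ xs) = set xs ∪₁ x

set-false : ∀ {n} {xs : List (Fin n)} {v} → All (v ≢_) xs → set xs v ≡ false
set-false []       = refl
set-false {xs = x ∷ xs} {v} (h ∷ hs) = trans (∪₁-≢ (set xs) h) (set-false hs)

set-false⁻ : ∀ {n} (xs : List (Fin n)) {v} → set xs v ≡ false → All (v ≢_) xs
set-false⁻ []       h = []
set-false⁻ (x ∷ xs) h = proj₁ (∪₁-false (set xs) h) ∷ set-false⁻ xs (proj₂ (∪₁-false (set xs) h))

set-∈ : ∀ {n} (xs : List (Fin n)) {v} → v ∈ xs → set xs v ≡ true
set-∈ (x ∷ xs) (here refl) = ∪₁-self (set xs) x
set-∈ (x ∷ xs) (there h)   = ∪₁-⊇ {A = set xs} {x} _ (set-∈ xs h)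

#-set : ∀ {n} {xs : List (Fin n)} → Unique xs → # (set xs) ≡ length xs
#-set {n} {[]} []      = #-empty {n} (set []) λ _ → refl
#-set {xs = x ∷ xs} (h ∷ u) = trans (#-∪₁ (set xs) x (set-false h)) (cong suc (#-set u))

module NonPrime {n : ℕ} (G : Graph n) where
  open Conn G

  -- A split (X , Y) of the elementary minor of colour k at v, seen in G: X and Y have cutrank at most 2,
  -- and both sides carry a vector of colour k at v.  The colours (0,1), (1,1), (1,0) belong to G∖v, G*v∖v, G/v.
  record NP (v : Fin n) (k : K) : Set where
    constructor np
    field
      X Y   : Sub n
      X∌v   : X v ≡ false
      Y∌v   : Y v ≡ false
      cover : ∀ w → w ≢ v → Y w ≡ not (X w)
      2≤X   : 2 ≤ # X
      2≤Y   : 2 ≤ # Y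
      wX wY : Vec₂ n
      sX    : Supp wX (X ∪₁ v)
      sY    : Supp wY (Y ∪₁ v)
      kX    : col wX v ≡ k
      kY    : col wY v ≡ k
      rX    : # X ≤ 2 + r X
      rY    : # Y ≤ 2 + r Y

  flip : ∀ {v k} → NP v k → NP v k
  flip (np X Y X∌v Y∌v cover 2≤X 2≤Y wX wY sX sY kX kY rX rY) = record
    { X = Y ; Y = X ; X∌v = Y∌v ; Y∌v = X∌v
    ; cover = λ w w≢v → sym (trans (cong not (cover w w≢v)) (Boolₚ.not-involutive (X w)))
    ; 2≤X = 2≤Y ; 2≤Y = 2≤X ; wX = wY ; wY = wX ; sX = sY ; sY = sX ; kX = kY ; kY = kX ; rX = rY ; rY = rX }

module Triples {n : ℕ} (G : Graph n) (G-simple : IsSimple G) (prime : Prime G) (5≤n : 5 ≤ n) where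
  open Conn G public
  open Simple G-simple public
  open NonPrime G public

  -- The premise `# A ≤ 2 + r A` says cutrank at most 2, and primality gives cutrank at least 2 for
  -- `A ∩ B` and `A ∪ B`; the 1 contributed by `x` breaks the tie.
  uncross : ∀ {A B} x → # A ≤ 2 + r A → # B ≤ 2 + r B → Supp x (A ∪ B) →
    (∀ s → Supp s B → ¬ Supp (x ⊞ s) A) → 2 ≤ # (A ∩ B) → 2 ≤ # (∁ (A ∪ B)) → ⊥
  uncross {A} {B} x hA hB sx ¬s 2≤∩ 2≤∁ = ℕₚ.1+n≰n (begin
    5 + (r A + r B)                       ≡⟨⟩
    2 + (2 + suc (r A + r B))             ≤⟨ ℕₚ.+-monoʳ-≤ 4 (r-supermodular {A} {B} x sx ¬s) ⟩
    4 + (r (A ∩ B) + r (A ∪ B))           ≡⟨ four (r (A ∩ B)) (r (A ∪ B)) ⟩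
    (2 + r (A ∩ B)) + (2 + r (A ∪ B))     ≤⟨ ℕₚ.+-mono-≤ (prime-bound prime (A ∩ B) 2≤∩ (ℕₚ.≤-trans 2≤∁ (#-mono ∁⊆)))
                                                          (prime-bound prime (A ∪ B) (ℕₚ.≤-trans 2≤∩ (#-mono ∩⊆)) 2≤∁) ⟩
    # (A ∩ B) + # (A ∪ B)                 ≡⟨ #-modular A B ⟨
    # A + # B                             ≤⟨ ℕₚ.+-mono-≤ hA hB ⟩
    (2 + r A) + (2 + r B)                 ≡⟨ four (r A) (r B) ⟨
    4 + (r A + r B)                       ∎)
    where
    open ℕₚ.≤-Reasoning
    four : ∀ p q → 4 + (p + q) ≡ (2 + p) + (2 + q)
    four p q = cong (2 +_) (trans (cong suc (sym (ℕₚ.+-suc p q))) (sym (ℕₚ.+-suc p (suc q))))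
    ∩⊆ : A ∩ B ⊆ A ∪ B
    ∩⊆ w h rewrite proj₁ (∧-true {A w} h) = refl
    ∁⊆ : ∁ (A ∪ B) ⊆ ∁ (A ∩ B)
    ∁⊆ w h = f (A w) (B w) h
      where
      f : ∀ a b → not (a ∨ b) ≡ true → not (a ∧ b) ≡ true
      f false b h = refl

  pair-zero : ∀ {c a b} → a ≢ b → (∀ w → w ≢ a → w ≢ b → col c w ≡ 0ᴷ) → ∀ v → col c v ≡ 0ᴷ
  pair-zero {c} {a} {b} a≢b h v with ≟0 (col c v)
  ... | yes e = e
  ... | no ≢0 = ⊥-elim (ℕₚ.<⇒≱ (r-pos {S} {c} s ≢0) (ℕₚ.≤-pred (ℕₚ.≤-pred (subst (2 + r S ≤_) #S
      (prime-bound prime S (ℕₚ.≤-reflexive (sym #S)) (#-large-∁ S 2 (ℕₚ.≤-reflexive #S) (ℕₚ.≤-trans (ℕₚ.n≤1+n 4) 5≤n)))))))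
    where
    S : Sub n
    S = set (a ∷ b ∷ [])
    #S : # S ≡ 2
    #S = #-set ((a≢b ∷ []) ∷ [] ∷ [])
    s : Supp c S
    s w e with set-false⁻ (a ∷ b ∷ []) e
    ... | w≢a ∷ w≢b ∷ [] = h w w≢a w≢b

  record Tri (a b e : Fin n) : Set where
    constructor triple
    field
      vec : Vec₂ n
      off : ∀ w → w ≢ a → w ≢ b → w ≢ e → col vec w ≡ 0ᴷ
      nz₁ : col vec a ≢ 0ᴷ
      nz₂ : col vec b ≢ 0ᴷ
      nz₃ : col vec e ≢ 0ᴷ
      ≢₁₂ : a ≢ b
      ≢₁₃ : a ≢ e
      ≢₂₃ : b ≢ e

    at : Fin n → K
    at = col vec

  open Tri public using (vec; at)

  swap₁₂ : ∀ {a b e} → Tri a b e → Tri b a e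
  swap₁₂ (triple c o p q s x y z) = triple c (λ w f g → o w g f) q p s (x ∘ sym) z y

  swap₂₃ : ∀ {a b e} → Tri a b e → Tri a e b
  swap₂₃ (triple c o p q s x y z) = triple c (λ w f g h → o w f h g) p s q y x (z ∘ sym)

  swap₁₃ : ∀ {a b e} → Tri a b e → Tri e b a
  swap₁₃ = swap₁₂ ∘ swap₂₃ ∘ swap₁₂

  -- If a colour vanished at one of the three vertices, the support would have size at most 2; hence
  -- one nonzero colour makes all three nonzero.
  mkTri : ∀ {a b e} c v → a ≢ b → a ≢ e → b ≢ e →
    (∀ w → w ≢ a → w ≢ b → w ≢ e → col c w ≡ 0ᴷ) → col c v ≢ 0ᴷ → Tri a b e
  mkTri {a} {b} {e} c v a≢b a≢e b≢e h ≢0 = triple c h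
    (λ z → ≢0 (pair-zero b≢e (λ w w≢b w≢e → at≢ a z w (λ w≢a → h w w≢a w≢b w≢e)) v))
    (λ z → ≢0 (pair-zero a≢e (λ w w≢a w≢e → at≢ b z w (λ w≢b → h w w≢a w≢b w≢e)) v))
    (λ z → ≢0 (pair-zero a≢b (λ w w≢a w≢b → at≢ e z w (λ w≢e → h w w≢a w≢b w≢e)) v))
    a≢b a≢e b≢e
    where
    at≢ : ∀ a → col c a ≡ 0ᴷ → ∀ w → (w ≢ a → col c w ≡ 0ᴷ) → col c w ≡ 0ᴷ
    at≢ a z w f with w ≟ a
    ... | yes refl = z
    ... | no  w≢a  = f w≢a

  ω-0ˡ : ∀ {k l} → k ≡ 0ᴷ → ω k l ≡ false
  ω-0ˡ refl = refl

  ω-0ʳ : ∀ {k l} → l ≡ 0ᴷ → ω k l ≡ false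
  ω-0ʳ {k} refl = ω-zeroʳ k

  -- Only `b` and `e` are shared, so the vectors commute at both or at neither. If at both, the
  -- colours agree there and the sum of the vectors is supported in `{a, u}` yet nonzero at `a`.
  differ : ∀ {a b e u} (t : Tri a b e) (t′ : Tri b e u) → a ≢ u →
    ω (at t b) (at t′ b) ≡ true × ω (at t e) (at t′ e) ≡ true
  differ {a} {b} {e} {u} t t′ a≢u = ω≡true , trans (sym ω≡) ω≡true
    where
    module T = Tri t
    module T′ = Tri t′
    elsewhere : ∀ w → w ≢ b → w ≢ e → ω (at t w) (at t′ w) ≡ false
    elsewhere w w≢b w≢e with w ≟ a
    ... | yes refl = ω-0ʳ {at t w} (T′.off w w≢b w≢e a≢u)
    ... | no  w≢a  = ω-0ˡ (T.off w w≢a w≢b w≢e)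
    ω≡ : ω (at t b) (at t′ b) ≡ ω (at t e) (at t′ e)
    ω≡ = commute-pair G-sym (vec t) (vec t′) b e T.≢₂₃ elsewhere
    ω≡true : ω (at t b) (at t′ b) ≡ true
    ω≡true = ¬false⇒true λ f → T.nz₁ (trans (sym (trans (col-⊞ (vec t) (vec t′) a)
        (trans (cong (at t a +ᴷ_) (T′.off a T.≢₁₂ T.≢₁₃ a≢u)) (+ᴷ-identityʳ (at t a)))))
      (pair-zero {vec t ⊞ vec t′} a≢u (λ w w≢a w≢u → trans (col-⊞ (vec t) (vec t′) w) (cancel f w w≢a w≢u)) a))
      where
      cancel : ω (at t b) (at t′ b) ≡ false → ∀ w → w ≢ a → w ≢ u → at t w +ᴷ at t′ w ≡ 0ᴷ
      cancel f w w≢a w≢u with w ≟ b | w ≟ e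
      ... | yes refl | _ = trans (cong (_+ᴷ at t′ w) (ω-false T.nz₂ T′.nz₁ f)) (+ᴷ-self (at t′ w))
      ... | no _ | yes refl = trans (cong (_+ᴷ at t′ w) (ω-false T.nz₃ T′.nz₂ (trans (sym ω≡) f))) (+ᴷ-self (at t′ w))
      ... | no w≢b | no w≢e = cong₂ _+ᴷ_ (T.off w w≢a w≢b w≢e) (T′.off w w≢b w≢e w≢u)

  -- The only shared vertex is `e`, so orthogonality reduces to the term at `e`.
  agree : ∀ {a b e u w} (t : Tri a b e) (t′ : Tri e u w) → a ≢ u → a ≢ w → b ≢ u → b ≢ w → at t e ≡ at t′ e
  agree {a} {b} {e} {u} {w} t t′ a≢u a≢w b≢u b≢w = ω-false T.nz₃ T′.nz₁
    (commute-at G-sym (vec t) (vec t′) e elsewhere)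
    where
    module T = Tri t
    module T′ = Tri t′
    elsewhere : ∀ y → y ≢ e → ω (at t y) (at t′ y) ≡ false
    elsewhere y y≢e with y ≟ a | y ≟ b
    ... | yes refl | _        = ω-0ʳ {at t y} (T′.off y y≢e a≢u a≢w)
    ... | no _     | yes refl = ω-0ʳ {at t y} (T′.off y y≢e b≢u b≢w)
    ... | no y≢a   | no y≢b   = ω-0ˡ (T.off y y≢a y≢b y≢e)

  module NPFacts {v : Fin n} {k : K} (N : NP v k) where
    open NP N public

    X⇒¬Y : ∀ {w} → X w ≡ true → Y w ≡ false
    X⇒¬Y {w} h = trans (cover w λ { refl → true≢false h X∌v }) (cong not h)

    Y⇒¬X : ∀ {w} → Y w ≡ true → X w ≡ false
    Y⇒¬X {w} h = Boolₚ.not-injective (trans (sym (cover w λ { refl → true≢false h Y∌v })) h)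

    X⇒≢v : ∀ {w} → X w ≡ true → w ≢ v
    X⇒≢v h refl = true≢false h X∌v

    X-or-Y : ∀ {w} → w ≢ v → X w ≡ true ⊎ Y w ≡ true
    X-or-Y {w} w≢v with X w in eq
    ... | true  = inj₁ refl
    ... | false = inj₂ (trans (cover w w≢v) (cong not eq))

    wX-off : ∀ w → w ≢ v → X w ≡ false → col wX w ≡ 0ᴷ
    wX-off w w≢v e = sX w (trans (∪₁-≢ X w≢v) e)

    -- `wX` is nonzero at `v`, so adding `v` raises `r` together with the size.
    X∪v-defect : k ≢ 0ᴷ → # (X ∪₁ v) ≤ 2 + r (X ∪₁ v)
    X∪v-defect k≢0 = subst (_≤ 2 + r (X ∪₁ v)) (sym (#-∪₁ X v X∌v))
      (ℕₚ.≤-trans (s≤s rX) (s≤s (s≤s (r-step {X} {X ∪₁ v} {wX} (∪₁-⊇ {A = X} {v}) X∌v sX λ e → k≢0 (trans (sym kX) e)))))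

    small₂ : # X ≤ 2 → k ≢ 0ᴷ → ∀ {b} → X b ≡ true → ∃ λ y → X y ≡ true × Tri v b y
    small₂ l k≢0 {b} Xb with #-nonempty (X ∖ b) (ℕₚ.≤-pred (subst (2 ≤_) (#-∖ X b Xb) 2≤X))
    ... | y , X∖y = y , Xy , mkTri wX v (X⇒≢v Xb ∘ sym) (X⇒≢v Xy ∘ sym) (y≢b ∘ sym)
        (λ w w≢v w≢b w≢y → wX-off w w≢v (¬true⇒false λ Xw → #-≤2-elim X l (y≢b ∘ sym) Xb Xy Xw w≢b w≢y))
        λ e → k≢0 (trans (sym kX) e)
      where
      Xy : X y ≡ true
      Xy = ∖-⊆ {A = X} y X∖y
      y≢b : y ≢ b
      y≢b = ∖-true⇒≢ X X∖y

  -- The sets uncrossed are `N.X ∪₁ v` and `M.X`, with `M.wX` as the extra vector. A sum `M.wX ⊞ s`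
  -- supported in `N.X ∪₁ v` would meet the support of `N.wY` only at `v`, where it has colour `j`;
  -- orthogonality would give `i ≡ j`.
  cross : ∀ {v i j} (N : NP v i) (M : NP v j) → i ≢ 0ᴷ → j ≢ 0ᴷ → i ≢ j →
    2 ≤ # (NP.X N ∩ NP.X M) → 2 ≤ # (NP.Y N ∩ NP.Y M) → ⊥
  cross {v} {i} {j} N M i≢0 j≢0 i≢j 2≤∩ 2≤∁ = uncross {A} {M.X} M.wX (N.X∪v-defect i≢0) M.rX
    (λ w e → M.sX w (cup w e)) clash
    (ℕₚ.≤-trans 2≤∩ (#-mono λ w h → cong₂ _∧_ (∪₁-⊇ {A = N.X} {v} w (proj₁ (∧-true {N.X w} h))) (proj₂ (∧-true {N.X w} h))))
    (ℕₚ.≤-trans 2≤∁ (#-mono λ w h → cong not (outside w (proj₁ (∧-true {N.Y w} h)) (proj₂ (∧-true {N.Y w} h)))))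
    where
    module N = NPFacts N
    module M = NPFacts M
    A : Sub n
    A = N.X ∪₁ v
    cup : ∀ w → (A ∪ M.X) w ≡ false → (M.X ∪₁ v) w ≡ false
    cup w e = f (N.X w) (same w v) (M.X w) e
      where
      f : ∀ a b c → (a ∨ b) ∨ c ≡ false → c ∨ b ≡ false
      f false false false _ = refl
    outside : ∀ w → N.Y w ≡ true → M.Y w ≡ true → (A ∪ M.X) w ≡ false
    outside w p q = cong₂ _∨_ (trans (∪₁-≢ N.X (NPFacts.X⇒≢v (flip N) p)) (N.Y⇒¬X p)) (M.Y⇒¬X q)
    clash : ∀ s → Supp s M.X → ¬ Supp (M.wX ⊞ s) A
    clash s t u = i≢j (trans (sym N.kY) (trans (ω-false (λ e → i≢0 (trans (sym N.kY) e)) (λ e → j≢0 (trans (sym M.kX) e)) ω≡) M.kX))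
      where
      c≡ : col (M.wX ⊞ s) v ≡ col M.wX v
      c≡ = trans (col-⊞ M.wX s v) (trans (cong (col M.wX v +ᴷ_) (t v M.X∌v)) (+ᴷ-identityʳ _))
      ω≡ : ω (col N.wY v) (col M.wX v) ≡ false
      ω≡ = trans (cong (ω (col N.wY v)) (sym c≡)) (commute-supp {N.wY} {M.wX ⊞ s} {N.Y ∪₁ v} {A} N.sY u
        λ w w≢v → [ (λ p → inj₁ (trans (∪₁-≢ N.Y w≢v) (N.X⇒¬Y p))) , (λ q → inj₂ (trans (∪₁-≢ N.X w≢v) (N.Y⇒¬X q))) ]′ (N.X-or-Y w≢v))

  #-cells : ∀ {v k} (A : Sub n) (M : NP v k) → A v ≡ false → # A ≤ # (A ∩ NP.X M) + # (A ∩ NP.Y M)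
  #-cells {v} A M A∌v = ℕₚ.≤-trans (ℕₚ.≤-reflexive (#-split A M.X)) (ℕₚ.+-monoʳ-≤ (# (A ∩ M.X))
    (#-mono λ w h → let p , q = ∧-true {A w} h in
      cong₂ _∧_ p (trans (M.cover w λ { refl → true≢false p A∌v }) q)))
    where module M = NP M

  -- The two splits cut the other vertices into four cells. By `cross`, opposite cells are not both
  -- of size at least 2, so two cells on a common side have size at most 1. That side has at most 2
  -- vertices and forms a triple with `v`.
  essential-in-triple : ∀ {v i j} → NP v i → NP v j → i ≢ 0ᴷ → j ≢ 0ᴷ → i ≢ j → ∃ λ a → ∃ λ b → Tri v a b
  essential-in-triple {v} N M i≢0 j≢0 i≢j = go (2 ℕ.≤? p) (2 ℕ.≤? q) (2 ℕ.≤? t) (2 ℕ.≤? s)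
    where
    module N = NP N
    module M = NP M
    p q t s : ℕ
    p = # (N.X ∩ M.X)
    q = # (N.X ∩ M.Y)
    t = # (N.Y ∩ M.X)
    s = # (N.Y ∩ M.Y)
    done₂ : ∀ {k} (L : NP v k) → k ≢ 0ᴷ → # (NP.X L) ≤ 2 → ∃ λ a → ∃ λ b → Tri v a b
    done₂ L k≢0 l with #-nonempty (NP.X L) (ℕₚ.≤-trans (s≤s z≤n) (NP.2≤X L))
    ... | a , Xa with NPFacts.small₂ L l k≢0 Xa
    ...   | b , _ , t = a , b , t
    lt : ∀ {a b} → ¬ 2 ≤ a → ¬ 2 ≤ b → a + b ≤ 2
    lt f g = ℕₚ.+-mono-≤ (ℕₚ.≤-pred (ℕₚ.≰⇒> f)) (ℕₚ.≤-pred (ℕₚ.≰⇒> g))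
    comm : ∀ A B → # (A ∩ B) ≡ # (B ∩ A)
    comm A B = #-cong λ w → Boolₚ.∧-comm (A w) (B w)
    go : Dec (2 ≤ p) → Dec (2 ≤ q) → Dec (2 ≤ t) → Dec (2 ≤ s) → ∃ λ a → ∃ λ b → Tri v a b
    go (no f) (no g) _ _ = done₂ N i≢0 (ℕₚ.≤-trans (#-cells N.X M N.X∌v) (lt f g))
    go (no f) _ (no g) _ = done₂ M j≢0 (ℕₚ.≤-trans (#-cells M.X N M.X∌v)
      (subst₂ (λ x y → x + y ≤ 2) (comm N.X M.X) (comm N.Y M.X) (lt f g)))
    go _ (no f) _ (no g) = done₂ (flip M) j≢0 (ℕₚ.≤-trans (#-cells M.Y N M.Y∌v)
      (subst₂ (λ x y → x + y ≤ 2) (comm N.X M.Y) (comm N.Y M.Y) (lt f g)))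
    go _ _ (no f) (no g) = done₂ (flip N) i≢0 (ℕₚ.≤-trans (#-cells N.Y M N.Y∌v) (lt f g))
    go (yes f) _ _ (yes g) = ⊥-elim (cross N M i≢0 j≢0 i≢j f g)
    go _ (yes f) (yes g) _ = ⊥-elim (cross N (flip M) i≢0 j≢0 i≢j f g)

-- The triangle lemma

⊕-triple : ∀ {n} (f : Fin n → Bool) u v w → u ≢ v → u ≢ w → v ≢ w →
  (∀ y → y ≢ u → y ≢ v → y ≢ w → f y ≡ false) → ⊕.sum f ≡ f u xor (f v xor f w)
⊕-triple {suc n} f u v w u≢v u≢w v≢w h = trans (⊕.sum-remove {i = u} f)
  (cong (f u xor_) (trans
    (⊕-pair (f ∘ punchIn u) v′ w′ (λ e → v≢w (trans (sym pv) (trans (cong (punchIn u) e) pw)))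
      λ y y≢v′ y≢w′ → h (punchIn u y) (Finₚ.punchInᵢ≢i u y)
        (λ e → y≢v′ (Finₚ.punchIn-injective u y v′ (trans e (sym pv))))
        (λ e → y≢w′ (Finₚ.punchIn-injective u y w′ (trans e (sym pw)))))
    (cong₂ _xor_ (cong f pv) (cong f pw))))
  where
  v′ = punchOut u≢v
  w′ = punchOut u≢w
  pv : punchIn u v′ ≡ v
  pv = Finₚ.punchIn-punchOut u≢v
  pw : punchIn u w′ ≡ w
  pw = Finₚ.punchIn-punchOut u≢w

module Triangle {n : ℕ} (G : Graph n) (G-simple : IsSimple G) (prime : Prime G) (5≤n : 5 ≤ n) where
  open Triples G G-simple prime 5≤n public

  -- Otherwise `wY` meets the triple only at `a`, and orthogonality makes their colours there equal.
  separated : ∀ {a b e i} (t : Tri a b e) (N : NP a i) → i ≢ 0ᴷ → i ≢ at t a →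
    NP.X N b ≡ true → NP.X N e ≡ true → ⊥
  separated {a} {b} {e} {i} t N i≢0 i≢t Xb Xe = i≢t (trans (sym N.kY) (ω-false (λ z → i≢0 (trans (sym N.kY) z)) T.nz₁
    (commute-at G-sym N.wY (vec t) a λ w w≢a → here? w w≢a (w ≟ b) (w ≟ e))))
    where
    module N = NPFacts N
    module T = Tri t
    here? : ∀ w → w ≢ a → Dec (w ≡ b) → Dec (w ≡ e) → ω (col N.wY w) (at t w) ≡ false
    here? w w≢a (yes refl) _ = ω-0ˡ (NPFacts.wX-off (flip N) w w≢a (N.X⇒¬Y Xb))
    here? w w≢a _ (yes refl) = ω-0ˡ (NPFacts.wX-off (flip N) w w≢a (N.X⇒¬Y Xe))
    here? w w≢a (no p) (no q) = ω-0ʳ {col N.wY w} (T.off w w≢a p q)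

  separates : ∀ {a b e i} (t : Tri a b e) (N : NP a i) → i ≢ 0ᴷ → i ≢ at t a →
    (NP.X N b ≡ true × NP.Y N e ≡ true) ⊎ (NP.Y N b ≡ true × NP.X N e ≡ true)
  separates t N i≢0 i≢t with NPFacts.X-or-Y N (Tri.≢₁₂ t ∘ sym) | NPFacts.X-or-Y N (Tri.≢₁₃ t ∘ sym)
  ... | inj₁ p | inj₂ q = inj₁ (p , q)
  ... | inj₂ p | inj₁ q = inj₂ (p , q)
  ... | inj₁ p | inj₁ q = ⊥-elim (separated t N i≢0 i≢t p q)
  ... | inj₂ p | inj₂ q = ⊥-elim (separated t (flip N) i≢0 i≢t p q)

  module Sep {a b e i} (t : Tri a b e) (N : NP a i) (i≢0 : i ≢ 0ᴷ) (i≢t : i ≢ at t a)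
             (Xb : NP.X N b ≡ true) (Ye : NP.Y N e ≡ true) where
    open NPFacts N public
    module T = Tri t

    private
      C : Sub n
      C = (Y ∪₁ a) ∪₁ b

      ¬Yb : (Y ∪₁ a) b ≡ false
      ¬Yb = trans (∪₁-≢ Y (T.≢₁₂ ∘ sym)) (X⇒¬Y Xb)

      t-in-C : Supp (vec t) C
      t-in-C w h with ∪₁-false (Y ∪₁ a) h
      ... | w≢b , h′ with ∪₁-false Y h′
      ...   | w≢a , ¬Yw = T.off w w≢a w≢b λ { refl → true≢false Ye ¬Yw }

      rC : 2 + r Y ≤ r C
      rC = ℕₚ.≤-trans (s≤s (r-step {Y} {Y ∪₁ a} {wY} (∪₁-⊇ {A = Y} {a}) Y∌v sY λ z → i≢0 (trans (sym kY) z)))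
        (r-step {Y ∪₁ a} {C} {vec t} (∪₁-⊇ {A = Y ∪₁ a} {b}) ¬Yb t-in-C T.nz₂)

      #C : # C ≡ 2 + # Y
      #C = trans (#-∪₁ (Y ∪₁ a) b ¬Yb) (cong suc (#-∪₁ Y a Y∌v))

      ∁X∖b : ∁ (X ∖ b) ≗ C
      ∁X∖b w with w ≟ b | w ≟ a
      ... | yes refl | yes refl = trans (cong not (Boolₚ.∧-zeroʳ (X w))) (sym (Boolₚ.∨-zeroʳ (Y w ∨ true)))
      ... | yes refl | no  _    = trans (cong not (Boolₚ.∧-zeroʳ (X w))) (sym (Boolₚ.∨-zeroʳ (Y w ∨ false)))
      ... | no _ | yes refl = trans (cong not (trans (Boolₚ.∧-identityʳ (X w)) X∌v))
                                    (sym (trans (Boolₚ.∨-identityʳ (Y w ∨ true)) (Boolₚ.∨-zeroʳ (Y w))))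
      ... | no _ | no w≢a = trans (cong not (Boolₚ.∧-identityʳ (X w)))
        (sym (trans (Boolₚ.∨-identityʳ (Y w ∨ false)) (trans (Boolₚ.∨-identityʳ (Y w)) (cover w w≢a))))

    -- By duality the complement `Y ∪₁ a ∪₁ b` may be considered instead. Its two vertices beyond
    -- `Y` are both paid for: `a` by `wY`, and `b` by the triple, whose vertex `e` is already in
    -- `Y`.
    X∖b-defect : # (X ∖ b) ≤ 2 + r (X ∖ b)
    X∖b-defect = ℕₚ.+-cancelˡ-≤ (2 + r Y) _ _ (begin
      2 + r Y + # (X ∖ b)            ≤⟨ ℕₚ.+-monoˡ-≤ (# (X ∖ b)) rC ⟩
      r C + # (X ∖ b)                ≡⟨ cong (_+ # (X ∖ b)) (r-cong {C} {∁ (X ∖ b)} (sym ∘ ∁X∖b)) ⟩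
      r (∁ (X ∖ b)) + # (X ∖ b)      ≡⟨ duality (X ∖ b) ⟨
      r (X ∖ b) + # (∁ (X ∖ b))      ≡⟨ cong (r (X ∖ b) +_) (trans (#-cong ∁X∖b) #C) ⟩
      r (X ∖ b) + (2 + # Y)          ≡⟨ ℕₚ.+-comm (r (X ∖ b)) (2 + # Y) ⟩
      2 + # Y + r (X ∖ b)            ≤⟨ ℕₚ.+-monoˡ-≤ (r (X ∖ b)) (ℕₚ.+-monoʳ-≤ 2 rY) ⟩
      2 + (2 + r Y) + r (X ∖ b)      ≡⟨ cong (_+ r (X ∖ b)) (ℕₚ.+-comm 2 (2 + r Y)) ⟩
      2 + r Y + 2 + r (X ∖ b)        ≡⟨ ℕₚ.+-assoc (2 + r Y) 2 _ ⟩
      2 + r Y + (2 + r (X ∖ b))      ∎)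
      where open ℕₚ.≤-Reasoning

    -- `X ∖ b` has cutrank at least 2 and `X` at most 2, so `r` grows when `b` is added and some
    -- vector supported in `X` is nonzero at `b`. It meets the triple only there, so its colour is
    -- that of `t`.
    like-t : 3 ≤ # X → ∃ λ x → Supp x X × col x b ≡ at t b
    like-t 3≤X with r-witness {X ∖ b} {X} (ℕₚ.≤-pred (ℕₚ.≤-pred (begin
        3 + r (X ∖ b)   ≤⟨ s≤s (prime-bound prime (X ∖ b) (ℕₚ.≤-pred (subst (3 ≤_) (#-∖ X b Xb) 3≤X))
                             (#-≥2 (∁ (X ∖ b)) T.≢₁₂ (cong not (trans (∖-≢ X T.≢₁₂) X∌v)) (cong not (∖-self X b)))) ⟩
        suc (# (X ∖ b)) ≡⟨ #-∖ X b Xb ⟨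
        # X             ≤⟨ rX ⟩
        2 + r X         ∎)))
      where open ℕₚ.≤-Reasoning
    ... | x , s , ¬s = x , s , ω-false (λ z → ¬s (Supp-∖ {x} {X} s z)) T.nz₂
        (commute-at G-sym x (vec t) b λ w w≢b → h w w≢b (w ≟ a) (w ≟ e))
      where
      h : ∀ w → w ≢ b → Dec (w ≡ a) → Dec (w ≡ e) → ω (col x w) (at t w) ≡ false
      h w _ (yes refl) _ = ω-0ˡ (s w X∌v)
      h w _ _ (yes refl) = ω-0ˡ (s w (Y⇒¬X Ye))
      h w w≢b (no p) (no q) = ω-0ʳ {col x w} (T.off w p w≢b q)

    -- The new case is `X` consisting of `b`, `y`, `y′`. The vector `u` of `like-t` and `wX` do not
    -- commute at `b`, so they commute at one of `y`, `y′`. At that vertex one of `wX`, `u`,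
    -- `wX ⊞ u` vanishes, and this vector yields the triple on the remaining vertices.
    small : # X ≤ 3 → ∃ λ y → X y ≡ true × Tri a b y
    small l with # X ℕ.≤? 2
    ... | yes l₂ = small₂ l₂ i≢0 Xb
    ... | no  l₃ with like-t (ℕₚ.≰⇒> l₃) | #-two (X ∖ b) (ℕₚ.≤-pred (subst (3 ≤_) (#-∖ X b Xb) (ℕₚ.≰⇒> l₃)))
    ...   | u , su , u≡t | y , y′ , y≢y′ , hy , hy′ = choose (ω (col wX y) (col u y)) refl (ω (col wX y′) (col u y′)) refl
      where
      Xy : X y ≡ true
      Xy = ∖-⊆ {A = X} y hy
      Xy′ : X y′ ≡ true
      Xy′ = ∖-⊆ {A = X} y′ hy′
      b≢y : b ≢ y
      b≢y = ∖-true⇒≢ X hy ∘ sym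
      b≢y′ : b ≢ y′
      b≢y′ = ∖-true⇒≢ X hy′ ∘ sym
      X-enum : ∀ w → w ≢ b → w ≢ y → w ≢ y′ → X w ≡ false
      X-enum w p q q′ = ¬true⇒false λ Xw → #-≤3-elim X l b≢y b≢y′ y≢y′ Xb Xy Xy′ Xw p q q′
      wXa≢0 : col wX a ≢ 0ᴷ
      wXa≢0 z = i≢0 (trans (sym kX) z)
      anti-b : ω (col wX b) (col u b) ≡ true
      anti-b = trans (cong (ω (col wX b)) u≡t) (trans (sym (commute-pair G-sym wX (vec t) a b T.≢₁₂ λ w w≢a w≢b → h w w≢a w≢b (w ≟ e)))
        (ω-true wXa≢0 T.nz₁ (λ z → i≢t (trans (sym kX) z))))
        where
        h : ∀ w → w ≢ a → w ≢ b → Dec (w ≡ e) → ω (col wX w) (at t w) ≡ false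
        h w w≢a _ (yes refl) = ω-0ˡ (wX-off w w≢a (Y⇒¬X Ye))
        h w w≢a w≢b (no q)   = ω-0ʳ {col wX w} (T.off w w≢a w≢b q)
      use : ∀ {y y′} → X y ≡ true → X y′ ≡ true → b ≢ y →
        (∀ w → w ≢ b → w ≢ y → w ≢ y′ → X w ≡ false) → ω (col wX y′) (col u y′) ≡ false → Tri a b y
      use {y} {y′} Xy Xy′ b≢y enum f = pick (≟0 (col wX y′)) (≟0 (col u y′))
        where
        a≢y : a ≢ y
        a≢y = X⇒≢v Xy ∘ sym
        u-a : col u a ≡ 0ᴷ
        u-a = su a X∌v
        via-wX : col wX y′ ≡ 0ᴷ → Tri a b y
        via-wX z = mkTri wX a T.≢₁₂ a≢y b≢y off wXa≢0
          where
          off : ∀ w → w ≢ a → w ≢ b → w ≢ y → col wX w ≡ 0ᴷ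
          off w p q s with w ≟ y′
          ... | yes refl = z
          ... | no  w≢y′ = wX-off w p (enum w q s w≢y′)
        pick : Dec (col wX y′ ≡ 0ᴷ) → Dec (col u y′ ≡ 0ᴷ) → Tri a b y
        pick (yes z) _ = via-wX z
        pick (no _) (yes z) = mkTri u b T.≢₁₂ a≢y b≢y off λ z → T.nz₂ (trans (sym u≡t) z)
          where
          off : ∀ w → w ≢ a → w ≢ b → w ≢ y → col u w ≡ 0ᴷ
          off w p q s with w ≟ y′
          ... | yes refl = z
          ... | no  w≢y′ = su w (enum w q s w≢y′)
        pick (no p₀) (no q₀) = mkTri (wX ⊞ u) a T.≢₁₂ a≢y b≢y off
          λ z → wXa≢0 (trans (sym (trans (col-⊞ wX u a) (trans (cong (col wX a +ᴷ_) u-a) (+ᴷ-identityʳ _)))) z)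
          where
          off : ∀ w → w ≢ a → w ≢ b → w ≢ y → col (wX ⊞ u) w ≡ 0ᴷ
          off w p q s with w ≟ y′
          ... | yes refl = trans (col-⊞ wX u w) (trans (cong (_+ᴷ col u w) (ω-false p₀ q₀ f)) (+ᴷ-self (col u w)))
          ... | no  w≢y′ = trans (col-⊞ wX u w) (cong₂ _+ᴷ_ (wX-off w p (enum w q s w≢y′)) (su w (enum w q s w≢y′)))
      choose : ∀ p → ω (col wX y) (col u y) ≡ p → ∀ q → ω (col wX y′) (col u y′) ≡ q → ∃ λ y → X y ≡ true × Tri a b y
      choose _ _ false f = y , Xy , use Xy Xy′ b≢y X-enum f
      choose false f _ _ = y′ , Xy′ , use Xy′ Xy b≢y′ (λ w p q q′ → X-enum w p q′ q) f
      choose true f true f′ = ⊥-elim (true≢false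
        (trans (sym (isotropic G-sym wX u)) (trans (⊕-triple _ b y y′ b≢y b≢y′ y≢y′ off) (cong₂ _xor_ anti-b (cong₂ _xor_ f f′)))) refl)
        where
        off : ∀ w → w ≢ b → w ≢ y → w ≢ y′ → ω (col wX w) (col u w) ≡ false
        off w p q q′ = ω-0ʳ {col wX w} (su w (X-enum w p q q′))

  -- If `u` is in `X`, the triple `t′` meets `Y` only at `e`, so it is orthogonal there to the
  -- vector of `like-t` in `Y`, which has the colour of `t`; but `differ` makes `t` and `t′` differ
  -- at `e`. The case of `u` in `Y` is symmetric, at `b`.
  no-triple : ∀ {a b e u i} (t : Tri a b e) (N : NP a i) (i≢0 : i ≢ 0ᴷ) (i≢t : i ≢ at t a)
    (Xb : NP.X N b ≡ true) (Ye : NP.Y N e ≡ true) → 3 ≤ # (NP.X N) → 3 ≤ # (NP.Y N) → u ≢ a → ¬ Tri b e u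
  no-triple {a} {b} {e} {u} t N i≢0 i≢t Xb Ye 3≤X 3≤Y u≢a t′ =
    [ (λ Xu → clash (S′.like-t 3≤Y) (λ { w w≢e p → off′ w w≢e (λ { refl → true≢false p (X⇒¬Y Xb) }) λ { refl → true≢false p (X⇒¬Y Xu) } }) (proj₂ dif))
    , (λ Yu → clash (S.like-t 3≤X) (λ { w w≢b p → off″ w w≢b (λ { refl → true≢false p (Y⇒¬X Ye) }) λ { refl → true≢false p (Y⇒¬X Yu) } }) (proj₁ dif)) ]′ (X-or-Y u≢a)
    where
    module S = Sep t N i≢0 i≢t Xb Ye
    module S′ = Sep (swap₂₃ t) (flip N) i≢0 i≢t Ye Xb
    open NPFacts N
    module T′ = Tri t′
    dif : ω (at t b) (at t′ b) ≡ true × ω (at t e) (at t′ e) ≡ true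
    dif = differ t t′ (u≢a ∘ sym)
    off′ : ∀ w → w ≢ e → w ≢ b → w ≢ u → at t′ w ≡ 0ᴷ
    off′ w p q s = T′.off w q p s
    off″ : ∀ w → w ≢ b → w ≢ e → w ≢ u → at t′ w ≡ 0ᴷ
    off″ w p q s = T′.off w p q s
    clash : ∀ {A : Sub n} {y} → (∃ λ x → Supp x A × col x y ≡ at t y) →
      (∀ w → w ≢ y → A w ≡ true → at t′ w ≡ 0ᴷ) → ω (at t y) (at t′ y) ≡ true → ⊥
    clash {A} {y} (x , s , x≡t) h a = true≢false a (trans (cong (λ k → ω k (at t′ y)) (sym x≡t))
      (commute-at G-sym x (vec t′) y λ w w≢y → g w w≢y (A w) refl))
      where
      g : ∀ w → w ≢ y → ∀ α → A w ≡ α → ω (col x w) (at t′ w) ≡ false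
      g w w≢y true  Aw = ω-0ʳ {col x w} (h w w≢y Aw)
      g w w≢y false Aw = ω-0ˡ (s w Aw)

  -- The vector x of Sep.like-t has colour at t b at b; the vector of M on its other side has a different colour
  -- there, so x is not a sum of vectors supported in NP.X M ∪ {a , b , e} and in NP.X N ∖ b: this is the strict
  -- gain that uncrossing needs.
  crossing : ∀ {a b e i j m} (t : Tri a b e) (N : NP a i) (i≢0 : i ≢ 0ᴷ) (i≢t : i ≢ at t a)
    (Xb : NP.X N b ≡ true) (Ye : NP.Y N e ≡ true) → 3 ≤ # (NP.X N) →
    (M : NP b j) → j ≢ 0ᴷ → j ≢ at t b →
    m ≡ a ⊎ m ≡ e → NP.Y M m ≡ true → (∀ w → w ≢ m → w ≢ b → NP.X M w ≡ false → at t w ≡ 0ᴷ) →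
    2 ≤ # (NP.X N ∩ NP.X M) → 2 ≤ # ((NP.Y N ∩ NP.Y M) ∖ e) → ⊥
  crossing {a} {b} {e} {i} {j} {m} t N i≢0 i≢t Xb Ye 3≤X M j≢0 j≢t m-is Wm t-off 2≤∩ 2≤∁ with Sep.like-t t N i≢0 i≢t Xb Ye 3≤X
  ... | x , sx , x≡t = uncross {A} {N.X ∖ b} x A-defect (Sep.X∖b-defect t N i≢0 i≢t Xb Ye) sx′ clash
      (ℕₚ.≤-trans 2≤∩ (#-mono λ w h → let p , q = ∧-true {N.X w} h; w≢b = M.X⇒≢v q in
         cong₂ _∧_ (∪₁-⊇ {A = M.X ∪₁ b} {m} w (∪₁-⊇ {A = M.X} {b} w q)) (trans (∖-≢ N.X w≢b) p)))
      (ℕₚ.≤-trans 2≤∁ (#-mono λ w h → cong not (outside w (∖-true⇒≢ (N.Y ∩ M.Y) h) (∧-true {N.Y w} (∖-⊆ {A = N.Y ∩ M.Y} w h)))))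
    where
    module N = NPFacts N
    module M = NPFacts M
    module T = Tri t
    A : Sub n
    A = (M.X ∪₁ b) ∪₁ m
    m≢b : m ≢ b
    m≢b refl = true≢false Wm M.Y∌v
    ¬Xm : N.X m ≡ false
    ¬Xm = [ (λ { refl → N.X∌v }) , (λ { refl → N.Y⇒¬X Ye }) ]′ m-is
    ¬Am : (M.X ∪₁ b) m ≡ false
    ¬Am = trans (∪₁-≢ M.X m≢b) (M.Y⇒¬X Wm)
    tm≢0 : at t m ≢ 0ᴷ
    tm≢0 = [ (λ { refl → T.nz₁ }) , (λ { refl → T.nz₃ }) ]′ m-is
    t-in-A : Supp (vec t) A
    t-in-A w h with ∪₁-false (M.X ∪₁ b) h
    ... | w≢m , h′ with ∪₁-false M.X h′
    ...   | w≢b , ¬Zw = t-off w w≢m w≢b ¬Zw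
    -- `M.wX` pays for adding `b` and `t` pays for adding `m`, so `A` still has cutrank at most 2.
    A-defect : # A ≤ 2 + r A
    A-defect = subst (_≤ 2 + r A) (sym (#-∪₁ (M.X ∪₁ b) m ¬Am))
      (ℕₚ.≤-trans (s≤s (M.X∪v-defect j≢0)) (s≤s (s≤s (r-step {M.X ∪₁ b} {A} {vec t} (∪₁-⊇ {A = M.X ∪₁ b} {m}) ¬Am t-in-A tm≢0))))
    sx′ : Supp x (A ∪ (N.X ∖ b))
    sx′ w h with ∨-false {A w} h
      where
      ∨-false : ∀ {p q} → p ∨ q ≡ false → p ≡ false × q ≡ false
      ∨-false {false} {false} _ = refl , refl
    ... | ¬Aw , ¬Xw = sx w (trans (sym (∖-≢ N.X w≢b)) ¬Xw)
      where
      w≢b : w ≢ b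
      w≢b refl = true≢false (∪₁-⊇ {A = M.X ∪₁ b} {m} w (∪₁-self M.X b)) ¬Aw
    outside : ∀ w → w ≢ e → N.Y w ≡ true × M.Y w ≡ true → (A ∪ (N.X ∖ b)) w ≡ false
    outside w w≢e (p , q) = cong₂ _∨_ (trans (∪₁-≢ (M.X ∪₁ b) w≢m) (trans (∪₁-≢ M.X w≢b) (M.Y⇒¬X q)))
      (cong (_∧ not (same w b)) (N.Y⇒¬X p))
      where
      w≢b : w ≢ b
      w≢b refl = true≢false q M.Y∌v
      w≢m : w ≢ m
      w≢m refl = [ (λ { refl → true≢false p N.Y∌v }) , w≢e ]′ m-is
    clash : ∀ s → Supp s (N.X ∖ b) → ¬ Supp (x ⊞ s) A
    clash s ss u = j≢t (trans (sym M.kY) (trans (ω-false (λ z → j≢0 (trans (sym M.kY) z)) (λ z → T.nz₂ (trans (sym c≡) z)) ω≡) c≡))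
      where
      c≡ : col (x ⊞ s) b ≡ at t b
      c≡ = trans (col-⊞ x s b) (trans (cong (col x b +ᴷ_) (ss b (∖-self N.X b))) (trans (+ᴷ-identityʳ _) x≡t))
      ω≡ : ω (col M.wY b) (col (x ⊞ s) b) ≡ false
      ω≡ = commute-at G-sym M.wY (x ⊞ s) b λ w w≢b → g w w≢b (w ≟ m) (M.X-or-Y w≢b)
        where
        g : ∀ w → w ≢ b → Dec (w ≡ m) → M.X w ≡ true ⊎ M.Y w ≡ true → ω (col M.wY w) (col (x ⊞ s) w) ≡ false
        g w w≢b (yes refl) _ = ω-0ʳ {col M.wY w} (trans (col-⊞ x s w) (cong₂ _+ᴷ_ (sx w ¬Xm) (ss w (trans (∖-≢ N.X w≢b) ¬Xm))))
        g w w≢b (no w≢m) (inj₁ Zw) = ω-0ˡ (NPFacts.wX-off (flip M) w w≢b (M.X⇒¬Y Zw))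
        g w w≢b (no w≢m) (inj₂ Ww) = ω-0ʳ {col M.wY w} (u w (trans (∪₁-≢ (M.X ∪₁ b) w≢m) (trans (∪₁-≢ M.X w≢b) (M.Y⇒¬X Ww))))

  -- Each of the two splits separates the other two vertices of the triple. If one of the four sides
  -- has at most 3 vertices, `small` gives a new triple, which `no-triple` excludes when it contains
  -- `b` and `e`. If all sides are larger, their intersections are large enough for `crossing`.
  triangle-lemma : ∀ {a b e i j} (t : Tri a b e) → NP a i → i ≢ 0ᴷ → i ≢ at t a →
    NP b j → j ≢ 0ᴷ → j ≢ at t b →
    ∃ λ x → x ≢ a × x ≢ b × x ≢ e × (Tri a b x ⊎ Tri a e x)
  triangle-lemma {a} {b} {e} {i} {j} t N₀ i≢0 i≢t M₀ j≢0 j≢t =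
    [ (λ { (p , q) → orient N₀ p q }) , (λ { (p , q) → orient (flip N₀) p q }) ]′ (separates t N₀ i≢0 i≢t)
    where
    Goal : Set
    Goal = ∃ λ x → x ≢ a × x ≢ b × x ≢ e × (Tri a b x ⊎ Tri a e x)
    module T = Tri t
    main : (N : NP a i) → NP.X N b ≡ true → NP.Y N e ≡ true →
           (M : NP b j) → NP.X M a ≡ true → NP.Y M e ≡ true → Goal
    main N Xb Ye M Za We = sizes (# N.X ℕ.≤? 3) (# N.Y ℕ.≤? 3) (# M.X ℕ.≤? 3) (# M.Y ℕ.≤? 3)
      where
      module N = NPFacts N
      module M = NPFacts M
      module S  = Sep t N i≢0 i≢t Xb Ye
      module S′ = Sep (swap₂₃ t) (flip N) i≢0 i≢t Ye Xb
      module R  = Sep (swap₁₂ t) M j≢0 j≢t Za We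
      module R′ = Sep (swap₂₃ (swap₁₂ t)) (flip M) j≢0 j≢t We Za
      p q s u : ℕ
      p = # (N.X ∩ M.X)
      q = # (N.X ∩ M.Y)
      s = # ((N.Y ∩ M.X) ∖ e)
      u = # ((N.Y ∩ M.Y) ∖ e)
      cells : ∀ {v k y} {P Q : Sub n} (A : Sub n) (L : NP v k) → A y ≡ true → ¬ # A ≤ 3 → (A ∖ y) v ≡ false →
        (A ∖ y) ∩ NP.X L ⊆ P → (A ∖ y) ∩ NP.Y L ⊆ Q → 3 ≤ # P + # Q
      cells {y = y} A L Ay big ∌v hP hQ = ℕₚ.≤-trans (ℕₚ.≤-pred (subst (4 ≤_) (#-∖ A y Ay) (ℕₚ.≰⇒> big)))
        (ℕₚ.≤-trans (#-cells (A ∖ y) L ∌v) (ℕₚ.+-mono-≤ (#-mono hP) (#-mono hQ)))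
      d₁ : 3 ≤ # N.X → 2 ≤ p → 2 ≤ u → ⊥
      d₁ l = crossing t N i≢0 i≢t Xb Ye l M j≢0 j≢t (inj₂ refl) We
        λ w w≢e w≢b ¬Zw → T.off w (λ { refl → true≢false Za ¬Zw }) w≢b w≢e
      d₂ : 3 ≤ # N.X → 2 ≤ q → 2 ≤ s → ⊥
      d₂ l = crossing t N i≢0 i≢t Xb Ye l (flip M) j≢0 j≢t (inj₁ refl) Za
        λ w w≢a w≢b ¬Ww → T.off w w≢a w≢b (λ { refl → true≢false We ¬Ww })
      force : ∀ {x y} → 3 ≤ x + y → ¬ 2 ≤ x → 2 ≤ y
      force {x} {y} l h = ℕₚ.+-cancelˡ-≤ 1 _ _ (ℕₚ.≤-trans l (ℕₚ.+-monoˡ-≤ y (ℕₚ.≤-pred (ℕₚ.≰⇒> h))))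
      -- Every row and column of the 2 by 2 table of cells sums to at least 3, so a cell below 2
      -- forces both its neighbours, which form a diagonal, to be at least 2.
      finish : 3 ≤ # N.X → 3 ≤ p + q → 3 ≤ s + u → 3 ≤ p + s → 3 ≤ q + u → ⊥
      finish l pq su ps qu with 2 ℕ.≤? p
      ... | no ¬p = d₂ l (force pq ¬p) (force ps ¬p)
      ... | yes 2≤p = d₂ l (force (subst (3 ≤_) (ℕₚ.+-comm q u) qu) ¬u) (force (subst (3 ≤_) (ℕₚ.+-comm s u) su) ¬u)
        where
        ¬u : ¬ 2 ≤ u
        ¬u = d₁ l 2≤p
      ∩-swap : ∀ {A B : Sub n} {w} → (A ∩ B) w ≡ true → (B ∩ A) w ≡ true
      ∩-swap {A} {B} {w} h = trans (Boolₚ.∧-comm (B w) (A w)) h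
      sizes : Dec (# N.X ≤ 3) → Dec (# N.Y ≤ 3) → Dec (# M.X ≤ 3) → Dec (# M.Y ≤ 3) → Goal
      sizes (yes l) _ _ _ with S.small l
      ... | x , Xx , t′ = x , Tri.≢₁₃ t′ ∘ sym , Tri.≢₂₃ t′ ∘ sym , (λ { refl → true≢false Ye (N.X⇒¬Y Xx) }) , inj₁ t′
      sizes _ (yes l) _ _ with S′.small l
      ... | x , Yx , t′ = x , Tri.≢₁₃ t′ ∘ sym , (λ { refl → true≢false Yx (N.X⇒¬Y Xb) }) , Tri.≢₂₃ t′ ∘ sym , inj₂ t′
      sizes _ _ (yes l) _ with R.small l
      ... | x , Zx , t′ = x , Tri.≢₂₃ t′ ∘ sym , Tri.≢₁₃ t′ ∘ sym , (λ { refl → true≢false We (M.X⇒¬Y Zx) }) , inj₁ (swap₁₂ t′)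
      sizes (no l₁) (no l₂) _ (yes l) with R′.small l
      ... | x , Wx , t′ = ⊥-elim (no-triple t N i≢0 i≢t Xb Ye (three l₁) (three l₂)
                            (λ { refl → true≢false Wx (M.X⇒¬Y Za) }) t′)
        where
        three : ∀ {k} → ¬ k ≤ 3 → 3 ≤ k
        three h = ℕₚ.≤-trans (ℕₚ.n≤1+n 3) (ℕₚ.≰⇒> h)
      sizes (no l₁) (no l₂) (no l₃) (no l₄) = ⊥-elim (finish (ℕₚ.≤-trans (ℕₚ.n≤1+n 3) (ℕₚ.≰⇒> l₁))
        (cells N.X M Xb l₁ (∖-self N.X b) (drop N.X M.X) (drop N.X M.Y))
        (cells N.Y M Ye l₂ (trans (∖-≢ N.Y T.≢₂₃) (N.X⇒¬Y Xb)) (keep N.Y M.X) (keep N.Y M.Y))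
        (cells M.X N Za l₃ (∖-self M.X a) (λ w h → ∩-swap {M.X} {N.X} {w} (drop M.X N.X w h))
          (λ w h → let k = drop M.X N.Y w h in trans (∖-≢ (N.Y ∩ M.X) λ { refl → true≢false (proj₁ (∧-true {M.X w} k)) (M.Y⇒¬X We) }) (∩-swap {M.X} {N.Y} {w} k)))
        (cells M.Y N We l₄ (trans (∖-≢ M.Y T.≢₁₃) (M.X⇒¬Y Za))
          (λ w h → ∩-swap {M.Y} {N.X} {w} (drop M.Y N.X w h))
          (λ w h → trans (∖-≢ (N.Y ∩ M.Y) (∖-true⇒≢ M.Y (proj₁ (∧-true {(M.Y ∖ e) w} h)))) (∩-swap {M.Y} {N.Y} {w} (drop M.Y N.Y w h)))))
        where
        drop : ∀ (A B : Sub n) {y} w → ((A ∖ y) ∩ B) w ≡ true → (A ∩ B) w ≡ true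
        drop A B {y} w h = let k , l = ∧-true {(A ∖ y) w} h in cong₂ _∧_ (∖-⊆ {A = A} w k) l
        keep : ∀ (A B : Sub n) {y} w → ((A ∖ y) ∩ B) w ≡ true → ((A ∩ B) ∖ y) w ≡ true
        keep A B {y} w h = trans (∖-≢ (A ∩ B) (∖-true⇒≢ A (proj₁ (∧-true {(A ∖ y) w} h)))) (drop A B w h)
    orient : (N : NP a i) → NP.X N b ≡ true → NP.Y N e ≡ true → Goal
    orient N Xb Ye = [ (λ { (p , q) → main N Xb Ye M₀ p q }) , (λ { (p , q) → main N Xb Ye (flip M₀) p q }) ]′
      (separates (swap₁₂ t) M₀ j≢0 j≢t)

  -- The split isolates `{b, e}`, and `vec t` is the witness on that side. On the other side `Y` has
  -- cutrank at least 2 while `Y ∪₁ a`, the complement of a pair, has at most 2; so a vector nonzero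
  -- at `a` appears, and it meets the triple only at `a`.
  triple⇒NP : ∀ {a b e} (t : Tri a b e) → NP a (at t a)
  triple⇒NP {a} {b} {e} t = result
    where
    module T = Tri t
    X Y : Sub n
    X = set (b ∷ e ∷ [])
    Y = ∁ (X ∪₁ a)
    #X : # X ≡ 2
    #X = #-set ((T.≢₂₃ ∷ []) ∷ [] ∷ [])
    X∌a : X a ≡ false
    X∌a = set-false (T.≢₁₂ ∷ T.≢₁₃ ∷ [])
    Y∌a : Y a ≡ false
    Y∌a = cong not (∪₁-self X a)
    2≤Y : 2 ≤ # Y
    2≤Y = #-large-∁ (X ∪₁ a) 3 (ℕₚ.≤-reflexive (trans (#-∪₁ X a X∌a) (cong suc #X))) 5≤n
    s : Supp (vec t) (X ∪₁ a)
    s w h with ∪₁-false X h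
    ... | w≢a , h′ with set-false⁻ (b ∷ e ∷ []) h′
    ...   | w≢b ∷ w≢e ∷ [] = T.off w w≢a w≢b w≢e
    #∁ : r Y + 3 ≡ r (X ∪₁ a) + # Y
    #∁ = trans (cong (r Y +_) (sym (trans (#-cong dn) (trans (#-∪₁ X a X∌a) (cong suc #X)))))
      (trans (duality Y) (cong (_+ # Y) (r-cong {∁ Y} {X ∪₁ a} dn)))
      where
      dn : ∁ Y ≗ X ∪₁ a
      dn w = Boolₚ.not-involutive ((X ∪₁ a) w)
    rY : # Y ≤ 2 + r Y
    rY = ℕₚ.≤-pred (ℕₚ.≤-trans (ℕₚ.+-monoˡ-≤ (# Y) (r-pos {X ∪₁ a} {vec t} s T.nz₁))
      (ℕₚ.≤-reflexive (trans (sym #∁) (ℕₚ.+-comm (r Y) 3))))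
    grows : r Y < r (Y ∪₁ a)
    grows = ℕₚ.≤-pred (ℕₚ.≤-pred (begin
      3 + r Y            ≤⟨ s≤s (prime-bound prime Y 2≤Y (#-≥2 (∁ Y) T.≢₁₂ (cong not Y∌a)
                              (trans (Boolₚ.not-involutive ((X ∪₁ a) b)) (∪₁-⊇ {A = X} {a} b (∪₁-self (set (e ∷ [])) b))))) ⟩
      suc (# Y)          ≡⟨ #-∪₁ Y a Y∌a ⟨
      # (Y ∪₁ a)         ≤⟨ ℕₚ.m≤n+m _ (r (∁ (Y ∪₁ a))) ⟩
      r (∁ (Y ∪₁ a)) + # (Y ∪₁ a) ≡⟨ duality (Y ∪₁ a) ⟨
      r (Y ∪₁ a) + # (∁ (Y ∪₁ a)) ≡⟨ cong (r (Y ∪₁ a) +_) (trans (#-cong ∁≗) #X) ⟩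
      r (Y ∪₁ a) + 2     ≡⟨ ℕₚ.+-comm _ 2 ⟩
      2 + r (Y ∪₁ a)     ∎))
      where
      open ℕₚ.≤-Reasoning
      ∁≗ : ∁ (Y ∪₁ a) ≗ X
      ∁≗ w with w ≟ a
      ... | yes refl = trans (cong not (Boolₚ.∨-zeroʳ _)) (sym X∌a)
      ... | no  _    = trans (cong not (Boolₚ.∨-identityʳ _)) (trans (Boolₚ.not-involutive _) (Boolₚ.∨-identityʳ (X w)))
    cover : ∀ w → w ≢ a → Y w ≡ not (X w)
    cover w w≢a = cong not (∪₁-≢ X w≢a)
    result : NP a (at t a)
    result with r-witness {Y} {Y ∪₁ a} grows
    ... | c , sc , ¬sc = record
      { X = X ; Y = Y ; X∌v = X∌a ; Y∌v = Y∌a ; cover = cover ; 2≤X = ℕₚ.≤-reflexive (sym #X) ; 2≤Y = 2≤Y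
      ; wX = vec t ; wY = c ; sX = s ; sY = sc ; kX = refl
      ; kY = ω-false c≢0 T.nz₁ (commute-supp {c} {vec t} {Y ∪₁ a} {X ∪₁ a} sc s disjoint)
      ; rX = subst (_≤ 2 + r X) (sym #X) (ℕₚ.m≤m+n 2 _) ; rY = rY }
      where
      c≢0 : col c a ≢ 0ᴷ
      c≢0 z = ¬sc λ w Yw → off w Yw (w ≟ a)
        where
        off : ∀ w → Y w ≡ false → Dec (w ≡ a) → col c w ≡ 0ᴷ
        off w Yw (yes refl) = z
        off w Yw (no w≢a)   = sc w (trans (∪₁-≢ Y w≢a) Yw)
      disjoint : ∀ w → w ≢ a → (Y ∪₁ a) w ≡ false ⊎ (X ∪₁ a) w ≡ false
      disjoint w w≢a with X w in eq
      ... | false = inj₂ (same-≢ w≢a)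
      ... | true  = inj₁ (same-≢ w≢a)

-- Local complementation

module _ {n : ℕ} (G : Graph n) (G-simple : IsSimple G) (u : Fin n) where

  private
    H : Graph n
    H = G * u
    module G = Conn G
    module H = Conn H

    G-sym : ∀ x y → G x y ≡ G y x
    G-sym = proj₁ G-simple

    G-irr : ∀ x → G x x ≡ false
    G-irr = proj₂ G-simple

  *-simple : IsSimple (G * u)
  *-simple = (λ x y → cong₂ _xor_ (G-sym x y) (symm x y))
           , λ x → trans (cong₂ _xor_ (G-irr x) (trans (cong (λ b → G u x ∧ (G u x ∧ not b)) (same-refl x)) (last (G u x)))) refl
    where
    last : ∀ a → a ∧ (a ∧ false) ≡ false
    last false = refl
    last true  = refl
    same-sym : ∀ x y → same x y ≡ same y x
    same-sym x y with x ≟ y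
    ... | yes refl = sym (same-refl x)
    ... | no  x≢y  = sym (same-≢ (x≢y ∘ sym))
    symm : ∀ x y → G u x ∧ (G u y ∧ not (same x y)) ≡ G u y ∧ (G u x ∧ not (same y x))
    symm x y = trans (cong (λ b → G u x ∧ (G u y ∧ not b)) (same-sym x y))
      (trans (sym (Boolₚ.∧-assoc (G u x) _ _)) (trans (cong (_∧ not (same y x)) (Boolₚ.∧-comm (G u x) (G u y))) (Boolₚ.∧-assoc (G u y) _ _)))

  *-row : ∀ y → (G * u) u y ≡ G u y
  *-row y = trans (cong (λ b → G u y xor (b ∧ (G u y ∧ not (same u y)))) (G-irr u)) (Boolₚ.xor-identityʳ _)

  *-involutive : ∀ x y → (H * u) x y ≡ G x y
  *-involutive x y = trans (cong₂ (λ a b → H x y xor (a ∧ (b ∧ not (same x y)))) (*-row x) (*-row y)) (xor-cancelʳ (G x y) _)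

  -- The coordinatewise change of colours relating the isotropic systems of G and G * u.
  ψ : Fin n → K → K
  ψ y (x , z) = (x xor (same y u ∧ z)) , (z xor (G u y ∧ x))

  ψ-zero : ∀ y {k} → k ≡ 0ᴷ → ψ y k ≡ 0ᴷ
  ψ-zero y refl = cong₂ _,_ (Boolₚ.∧-zeroʳ (same y u)) (Boolₚ.∧-zeroʳ (G u y))

  ψ-involutive : ∀ y k → ψ y (ψ y k) ≡ k
  ψ-involutive y k with y ≟ u
  ... | yes refl = f (G u y) (G-irr u) k
    where
    f : ∀ g → g ≡ false → ∀ ((x , z) : K) → ((x xor z) xor (z xor (g ∧ x)) , (z xor (g ∧ x)) xor (g ∧ (x xor z))) ≡ (x , z)
    f _ refl (x , z) = cong₂ _,_ (trans (cong ((x xor z) xor_) (Boolₚ.xor-identityʳ z)) (xor-cancelʳ x z)) (xor-cancelʳ z false)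
  ... | no _ = f (G u y) k
    where
    f : ∀ g ((x , z) : K) → ((x xor false) xor false , (z xor (g ∧ x)) xor (g ∧ (x xor false))) ≡ (x , z)
    f g (x , z) = cong₂ _,_ (xor-cancelʳ x false)
      (trans (cong (λ x′ → (z xor (g ∧ x)) xor (g ∧ x′)) (Boolₚ.xor-identityʳ x)) (xor-cancelʳ z (g ∧ x)))

  ψ-≢0 : ∀ y {k} → k ≢ 0ᴷ → ψ y k ≢ 0ᴷ
  ψ-≢0 y {k} ≢0 e = ≢0 (trans (sym (ψ-involutive y k)) (ψ-zero y e))

  ψ-≢ : ∀ y {k l} → k ≢ l → ψ y k ≢ ψ y l
  ψ-≢ y {k} {l} k≢l e = k≢l (trans (sym (ψ-involutive y k)) (trans (cong (ψ y) e) (ψ-involutive y l)))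

  -- At `u` the recolouring exchanges (0,1) and (1,1), so the coordinate of the vector at `u` has to
  -- gain `z c u`; all other first coordinates are kept.
  push : Vec₂ n → Vec₂ n
  push c = c ⊞ λ v → same v u ∧ G.z c u

  -- At a neighbour `y` of `u`, complementation adds the sum of `c` over the other neighbours of
  -- `u`, that is `ζ xor c y`. The correction of `c` at `u` adds `ζ` again, so only `c y` remains.
  col-push : ∀ c y → H.col (push c) y ≡ ψ y (G.col c y)
  col-push c y = cong₂ _,_ first (begin
    H.z (push c) y                        ≡⟨ H.z-⊞ c _ y ⟩
    H.z c y xor H.z (λ v → same v u ∧ ζ) y ≡⟨ cong₂ _xor_ z-H shift ⟩
    (G.z c y xor (G u y ∧ (ζ xor (G u y ∧ c y)))) xor (G u y ∧ ζ) ≡⟨ algebra (G.z c y) (G u y) ζ (c y) ⟩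
    G.z c y xor (G u y ∧ c y)             ∎)
    where
    open ≡-Reasoning
    ζ : Bool
    ζ = G.z c u
    first : push c y ≡ c y xor (same y u ∧ G.z c y)
    first with y ≟ u
    ... | yes refl = refl
    ... | no _     = refl
    algebra : ∀ a g ζ x → (a xor (g ∧ (ζ xor (g ∧ x)))) xor (g ∧ ζ) ≡ a xor (g ∧ x)
    algebra a false ζ x = Boolₚ.xor-identityʳ (a xor false)
    algebra a true  ζ x = trans (cong (λ b → (a xor b) xor ζ) (Boolₚ.xor-comm ζ x))
      (trans (cong (_xor ζ) (sym (Boolₚ.xor-assoc a x ζ))) (xor-cancelʳ (a xor x) ζ))
    shift : H.z (λ v → same v u ∧ ζ) y ≡ G u y ∧ ζ
    shift = trans (⊕-single _ u λ w w≢u → trans (cong (λ b → H y w ∧ (b ∧ ζ)) (same-≢ w≢u)) (Boolₚ.∧-zeroʳ (H y w)))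
      (trans (cong (λ b → H y u ∧ (b ∧ ζ)) (same-refl u)) (cong (_∧ ζ) (trans (proj₁ *-simple y u) (*-row y))))
    term : ∀ g h g′ s c → (g xor (h ∧ (g′ ∧ not s))) ∧ c ≡ (g ∧ c) xor (h ∧ ((g′ ∧ c) xor (s ∧ (g′ ∧ c))))
    term g false g′ s c = trans (cong (_∧ c) (Boolₚ.xor-identityʳ g)) (sym (Boolₚ.xor-identityʳ (g ∧ c)))
    term g true g′ false c = trans (cong (λ b → (g xor b) ∧ c) (Boolₚ.∧-identityʳ g′))
      (trans (Boolₚ.∧-distribʳ-xor c g g′) (cong ((g ∧ c) xor_) (sym (Boolₚ.xor-identityʳ (g′ ∧ c)))))
    term g true g′ true c = trans (cong (λ b → (g xor b) ∧ c) (Boolₚ.∧-zeroʳ g′))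
      (trans (cong (_∧ c) (Boolₚ.xor-identityʳ g)) (trans (sym (Boolₚ.xor-identityʳ (g ∧ c))) (cong ((g ∧ c) xor_) (sym (Boolₚ.xor-same (g′ ∧ c))))))
    z-H : H.z c y ≡ G.z c y xor (G u y ∧ (ζ xor (G u y ∧ c y)))
    z-H = trans (⊕.sum-cong-≗ λ w → term (G y w) (G u y) (G u w) (same y w) (c w))
      (trans (⊕.∑-distrib-+ (λ w → G y w ∧ c w) (λ w → G u y ∧ ((G u w ∧ c w) xor (same y w ∧ (G u w ∧ c w)))))
      (cong (G.z c y xor_) (trans (sym (⊕.*-distribˡ-sum (G u y) (λ w → (G u w ∧ c w) xor (same y w ∧ (G u w ∧ c w)))))
        (cong (G u y ∧_) (trans (⊕.∑-distrib-+ (λ w → G u w ∧ c w) (λ w → same y w ∧ (G u w ∧ c w)))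
          (cong (ζ xor_) (trans (⊕-single _ y λ w w≢y → cong (_∧ (G u w ∧ c w)) (same-≢ (w≢y ∘ sym)))
             (cong (_∧ (G u y ∧ c y)) (same-refl y)))))))))

col-ext : ∀ {n} {G H : Graph n} → (∀ x y → G x y ≡ H x y) → ∀ c v → Space.col G c v ≡ Space.col H c v
col-ext h c v = cong (c v ,_) (⊕.sum-cong-≗ λ w → cong (_∧ c w) (h v w))

module _ {n : ℕ} (G : Graph n) (G-simple : IsSimple G) (u : Fin n) where

  private
    H : Graph n
    H = G * u
    module G = Conn G
    module H = Conn H
    φ : Fin n → K → K
    φ = ψ G G-simple u

  pull : Vec₂ n → Vec₂ n
  pull = push H (*-simple G G-simple u) u

  col-pull : ∀ c y → G.col (pull c) y ≡ φ y (H.col c y)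
  col-pull c y = trans (col-ext (λ x y → sym (*-involutive G G-simple u x y)) (pull c) y)
    (trans (col-push H (*-simple G G-simple u) u c y)
      (cong (λ g → (c y xor (same y u ∧ H.z c y)) , (H.z c y xor (g ∧ c y))) (*-row G G-simple u y)))

  Supp-pull : ∀ {c A} → H.Supp c A → G.Supp (pull c) A
  Supp-pull {c} s y e = trans (col-pull c y) (ψ-zero G G-simple u y (s y e))

  private
    pull-≢0 : ∀ {c v} → H.col c v ≢ 0ᴷ → G.col (pull c) v ≢ 0ᴷ
    pull-≢0 {c} {v} ≢0 e = ψ-≢0 G G-simple u v ≢0 (trans (sym (col-pull c v)) e)

    d-≤ : ∀ A v → H.d A v ≤ G.d A v
    d-≤ A v with 2 ℕ.≤? H.d A v | 1 ℕ.≤? H.d A v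
    ... | yes 2≤ | _ = ℕₚ.≤-trans (H.d-≤2 A v) (two (H.d-two⁻ A v 2≤))
      where
      two : (∃ λ c → ∃ λ c′ → H.Supp c A × H.Supp c′ A × ω (H.col c v) (H.col c′ v) ≡ true) → 2 ≤ G.d A v
      two (c , c′ , s , s′ , t) = G.d-two {pull c} {pull c′} {A} (Supp-pull {c} {A} s) (Supp-pull {c′} {A} s′)
        (ω-true (pull-≢0 {c} (ω-true⇒≢0ˡ {H.col c v} {H.col c′ v} t)) (pull-≢0 {c′} (ω-true⇒≢0ʳ {H.col c v} {H.col c′ v} t))
          λ e → ψ-≢ G G-simple u v (ω-true⇒≢ {H.col c v} {H.col c′ v} t) (trans (sym (col-pull c v)) (trans e (col-pull c′ v))))
    ... | no ¬2 | yes 1≤ = ℕₚ.≤-trans (ℕₚ.≤-pred (ℕₚ.≰⇒> ¬2)) (one (H.d-pos⁻ A v 1≤))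
      where
      one : (∃ λ c → H.Supp c A × H.col c v ≢ 0ᴷ) → 1 ≤ G.d A v
      one (c , s , ≢0) = G.d-pos {pull c} {A} (Supp-pull {c} {A} s) (pull-≢0 {c} ≢0)
    ... | no _ | no ¬1 = ℕₚ.≤-trans (ℕₚ.≤-pred (ℕₚ.≰⇒> ¬1)) z≤n

  -- Recolouring keeps nonzero colours nonzero and different colours different, so the dimensions
  -- `d` compare vertex by vertex. This direction carries low cutrank in `G * u` back to `G`.
  r-* : ∀ m A → # A ≡ m → H.r A ≤ G.r A
  r-* zero A e = ℕₚ.≤-trans (ℕₚ.≤-reflexive (H.r-∅ A λ v → ¬true⇒false λ Av → ℕₚ.1+n≰n (subst (1 ≤_) e (#-pos A Av)))) z≤n
  r-* (suc m) A e with #-nonempty A (subst (1 ≤_) (sym e) (s≤s z≤n))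
  ... | v , Av = subst₂ _≤_ (sym (H.marginal A v)) (sym (G.marginal A v))
    (ℕₚ.+-mono-≤ (d-≤ A v) (r-* m (A ∖ v) (ℕₚ.suc-injective (trans (sym (#-∖ A v Av)) e))))

  NP-* : ∀ {v k} → NonPrime.NP (G * u) v k → NonPrime.NP G v (φ v k)
  NP-* {v} N = record
    { X = X ; Y = Y ; X∌v = X∌v ; Y∌v = Y∌v ; cover = cover ; 2≤X = 2≤X ; 2≤Y = 2≤Y
    ; wX = pull wX ; wY = pull wY ; sX = Supp-pull {wX} {X ∪₁ v} sX ; sY = Supp-pull {wY} {Y ∪₁ v} sY
    ; kX = trans (col-pull wX v) (cong (φ v) kX) ; kY = trans (col-pull wY v) (cong (φ v) kY)
    ; rX = ℕₚ.≤-trans rX (ℕₚ.+-monoʳ-≤ 2 (r-* (# X) X refl)) ; rY = ℕₚ.≤-trans rY (ℕₚ.+-monoʳ-≤ 2 (r-* (# Y) Y refl)) }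
    where open NonPrime.NP N

-- Splits translated into dimensions and witness vectors

split-entry : ∀ {g a b} → (g ≡ true → a ≡ true × b ≡ true) × (a ≡ true × b ≡ true → g ≡ true) → g ≡ a ∧ b
split-entry {true} (f , _) with f refl
... | refl , refl = refl
split-entry {false} {false} _ = refl
split-entry {false} {true} {false} _ = refl
split-entry {false} {true} {true} (_ , g) = g (refl , refl)

module _ {n : ℕ} (G : Graph n) (G-simple : IsSimple G) where
  open Conn G
  open Simple G-simple

  dim-drop : ∀ F f → dim F ≤ suc (dim (f ∷ F))
  dim-drop F f = subst (_≤ suc (dim (f ∷ F))) (sym (dim-∷ F f)) (ℕₚ.+-monoˡ-≤ (dim (f ∷ F)) (char-≤1 (moves? F f)))

  -- On `X`, each row indexed by `Y` is zero or equal to `A′`. Hence annihilating one row with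
  -- `B′ y₀` true annihilates them all, at the cost of a single dimension.
  rank-one : ∀ (X Y A′ B′ : Sub n) F → (∀ x y → X x ≡ true → Y y ≡ true → G x y ≡ A′ x ∧ B′ y) →
    (∀ {c} → Ker F c → ∀ v → X v ≡ false → c v ≡ false) →
    (∀ {c} → Ker F c → (∀ y → Y y ≡ true → z c y ≡ false) → Supp c X) → dim F ≤ suc (r X)
  rank-one X Y A′ B′ F h off supp = go (Finₚ.any? λ y → (Y y Boolₚ.≟ true) ×-dec (B′ y Boolₚ.≟ true))
    where
    terms : ∀ {c} → Ker F c → ∀ y β → Y y ≡ true → B′ y ≡ β → ∀ w → G y w ∧ c w ≡ (A′ w ∧ β) ∧ c w
    terms {c} k y β Yy e w with X w in eq
    ... | true  = cong (_∧ c w) (trans (G-sym y w) (trans (h w y eq Yy) (cong (A′ w ∧_) e)))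
    ... | false = trans (trans (cong (G y w ∧_) (off k w eq)) (Boolₚ.∧-zeroʳ (G y w)))
      (sym (trans (cong ((A′ w ∧ β) ∧_) (off k w eq)) (Boolₚ.∧-zeroʳ (A′ w ∧ β))))
    zero-row : ∀ {c} → Ker F c → ∀ y → Y y ≡ true → B′ y ≡ false → z c y ≡ false
    zero-row {c} k y Yy e = trans (⊕.sum-cong-≗ λ w → trans (terms k y false Yy e w) (cong (_∧ c w) (Boolₚ.∧-zeroʳ (A′ w)))) (⊕.sum-replicate-zero n)
    go : Dec (∃ λ y → Y y ≡ true × B′ y ≡ true) → dim F ≤ suc (r X)
    go (no ¬y) = ℕₚ.≤-trans (dim-mono λ {c} k → Ker-out⁺ {c} {X} (supp k λ y Yy → zero-row k y Yy (¬true⇒false λ e → ¬y (y , Yy , e)))) (ℕₚ.n≤1+n (r X))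
    go (yes (y₀ , Yy₀ , e₀)) = ℕₚ.≤-trans (dim-drop F (zbit y₀)) (s≤s (dim-mono λ {c} → inside {c}))
      where
      inside : ∀ {c} → Ker (zbit y₀ ∷ F) c → Ker (out X) c
      inside {c} (p ∷ k) = Ker-out⁺ {c} {X} (supp k λ y Yy → row y Yy (B′ y) refl)
        where
        row : ∀ y → Y y ≡ true → ∀ β → B′ y ≡ β → z c y ≡ false
        row y Yy false e = zero-row k y Yy e
        row y Yy true  e = trans (⊕.sum-cong-≗ λ w → trans (terms k y true Yy e w) (sym (terms k y₀ true Yy₀ e₀ w))) p

  split-defect : ((A , _) : Split G) → 2 ≤ # A × 2 ≤ # (∁ A) × # A ≤ suc (r A)
  split-defect (A , (a₁ , a₂ , a≢ , Aa₁ , Aa₂) , (b₁ , b₂ , b≢ , Ab₁ , Ab₂) , A′ , B′ , _ , _ , h) =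
      #-≥2 A a≢ Aa₁ Aa₂ , #-≥2 (∁ A) b≢ (cong not Ab₁) (cong not Ab₂)
    , ℕₚ.≤-trans (dim-xout (# A) A refl) (rank-one A (∁ A) A′ B′ (xout A)
        (λ x y Ax ¬Ay → split-entry (h x y Ax (Boolₚ.not-injective ¬Ay)))
        (λ {c} → Ker-xout⁻ {c} {A})
        λ {c} k q w ¬Aw → cong₂ _,_ (Ker-xout⁻ {c} {A} k w ¬Aw) (q w (cong not ¬Aw)))

  module OneSided (X Y A′ B′ : Sub n) (v : Fin n) (X∌v : X v ≡ false)
      (cover : ∀ w → w ≢ v → Y w ≡ not (X w)) (h : ∀ x y → X x ≡ true → Y y ≡ true → G x y ≡ A′ x ∧ B′ y) where

    -- The block between `X` and `Y` has rank at most 1, and the row of `v` adds at most 1.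
    defect : # X ≤ 2 + r X
    defect = ℕₚ.≤-trans (dim-xout (# X) X refl) (ℕₚ.≤-trans (dim-drop (xout X) (zbit v))
      (s≤s (rank-one X Y A′ B′ (zbit v ∷ xout X) h (λ { {c} (_ ∷ k) → Ker-xout⁻ {c} {X} k }) supp)))
      where
      supp : ∀ {c} → Ker (zbit v ∷ xout X) c → (∀ y → Y y ≡ true → z c y ≡ false) → Supp c X
      supp {c} (p ∷ k) q w ¬Xw with w ≟ v
      ... | yes refl = cong₂ _,_ (Ker-xout⁻ {c} {X} k w ¬Xw) p
      ... | no  w≢v  = cong₂ _,_ (Ker-xout⁻ {c} {X} k w ¬Xw) (q w (trans (cover w w≢v) (cong not ¬Xw)))

    module _ (prime : Prime G) (2≤X : 2 ≤ # X) (2≤Y : 2 ≤ # Y) where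

      private
        Witness : Set
        Witness = ∃ λ w → Supp w (X ∪₁ v) × col w v ≡ (false , true)

        mk : ∀ c → (∀ w → X w ≡ false → c w ≡ false) → (∀ y → Y y ≡ true → z c y ≡ false) → z c v ≡ true → Witness
        mk c p q e = c , (λ w h → let w≢v , ¬Xw = ∪₁-false X h in
            cong₂ _,_ (p w ¬Xw) (q w (trans (cover w w≢v) (cong not ¬Xw))))
          , cong₂ _,_ (p v X∌v) e

        unit-off : ∀ {x} → X x ≡ true → ∀ w → X w ≡ false → unit x w ≡ false
        unit-off Xx w ¬Xw = same-≢ λ { refl → true≢false Xx ¬Xw }

        entry : ∀ {x y} → X x ≡ true → Y y ≡ true → z (unit x) y ≡ A′ x ∧ B′ y
        entry {x} {y} Xx Yy = trans (z-unit x y) (trans (G-sym y x) (h x y Xx Yy))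

      -- A vector on `X` is sought that is annihilated by `A′` but not by the row of `v`. It exists
      -- as a unit vector or a sum of two, unless that row restricted to `X` is zero or equal to
      -- `A′`; then `v` could join the other side and G itself would have a split.
      witness : Witness
      witness with Finₚ.any? (λ x → (X x Boolₚ.≟ true) ×-dec (A′ x Boolₚ.≟ false) ×-dec (G v x Boolₚ.≟ true))
      ... | yes (x , Xx , ¬A′x , e) = mk (unit x) (unit-off Xx)
        (λ y Yy → trans (entry Xx Yy) (cong (_∧ B′ y) ¬A′x)) (trans (z-unit x v) e)
      ... | no ¬₁ with Finₚ.any? (λ x → (X x Boolₚ.≟ true) ×-dec (G v x Boolₚ.≟ true))
                   | Finₚ.any? (λ x → (X x Boolₚ.≟ true) ×-dec (A′ x Boolₚ.≟ true) ×-dec (G v x Boolₚ.≟ false))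
      ...   | yes (x , Xx , e) | yes (x′ , Xx′ , A′x′ , e′) = mk (unit x ⊞ unit x′)
        (λ w ¬Xw → cong₂ _xor_ (unit-off Xx w ¬Xw) (unit-off Xx′ w ¬Xw))
        (λ y Yy → trans (z-⊞ (unit x) (unit x′) y) (trans (cong₂ _xor_
           (trans (entry Xx Yy) (cong (_∧ B′ y) (¬false⇒true λ a → ¬₁ (x , Xx , a , e))))
           (trans (entry Xx′ Yy) (cong (_∧ B′ y) A′x′))) (Boolₚ.xor-same (B′ y))))
        (trans (z-⊞ (unit x) (unit x′) v) (cong₂ _xor_ (trans (z-unit x v) e) (trans (z-unit x′ v) e′)))
      ...   | no ¬₂ | _ = ⊥-elim (prime (mkSplit X A′ (λ y → B′ y ∧ not (same y v)) 2≤X (ℕₚ.≤-trans 2≤Y (#-mono Y⊆∁X))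
        λ x y Xx ¬Xy → split x y Xx ¬Xy (y ≟ v)))
        where
        Y⊆∁X : Y ⊆ ∁ X
        Y⊆∁X w Yw with w ≟ v
        ... | yes refl = cong not X∌v
        ... | no  w≢v  = trans (sym (cover w w≢v)) Yw
        split : ∀ x y → X x ≡ true → X y ≡ false → Dec (y ≡ v) → G x y ≡ A′ x ∧ (B′ y ∧ not (same y v))
        split x y Xx ¬Xy (yes refl) = trans (trans (G-sym x v) (¬true⇒false λ e → ¬₂ (x , Xx , e)))
          (sym (trans (cong (A′ x ∧_) (∖-self B′ v)) (Boolₚ.∧-zeroʳ (A′ x))))
        split x y Xx ¬Xy (no y≢v) = trans (h x y Xx (trans (cover y y≢v) (cong not ¬Xy))) (cong (A′ x ∧_) (sym (∖-≢ B′ y≢v)))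
      ...   | yes _ | no ¬₃ = ⊥-elim (prime (mkSplit X A′ (B′ ∪₁ v) 2≤X (ℕₚ.≤-trans 2≤Y (#-mono Y⊆∁X))
        λ x y Xx ¬Xy → split x y Xx ¬Xy (y ≟ v)))
        where
        Y⊆∁X : Y ⊆ ∁ X
        Y⊆∁X w Yw with w ≟ v
        ... | yes refl = cong not X∌v
        ... | no  w≢v  = trans (sym (cover w w≢v)) Yw
        col-v : ∀ x → X x ≡ true → ∀ α → A′ x ≡ α → G v x ≡ α
        col-v x Xx false e = ¬true⇒false λ g → ¬₁ (x , Xx , e , g)
        col-v x Xx true  e = ¬false⇒true λ g → ¬₃ (x , Xx , e , g)
        split : ∀ x y → X x ≡ true → X y ≡ false → Dec (y ≡ v) → G x y ≡ A′ x ∧ (B′ ∪₁ v) y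
        split x y Xx ¬Xy (yes refl) = trans (trans (G-sym x v) (col-v x Xx (A′ x) refl))
          (sym (trans (cong (A′ x ∧_) (∪₁-self B′ v)) (Boolₚ.∧-identityʳ (A′ x))))
        split x y Xx ¬Xy (no y≢v) = trans (h x y Xx (trans (cover y y≢v) (cong not ¬Xy))) (cong (A′ x ∧_) (sym (∪₁-≢ B′ y≢v)))

*-prime : ∀ {n} (G : Graph n) → IsSimple G → Prime G → ∀ u → Prime (G * u)
*-prime G G-simple prime u S with split-defect (G * u) (*-simple G G-simple u) S
... | 2≤A , 2≤∁A , l = ℕₚ.1+n≰n (ℕₚ.≤-trans (Conn.Simple.prime-bound G G-simple prime A 2≤A 2≤∁A)
    (ℕₚ.≤-trans l (s≤s (r-* G G-simple u (# A) A refl))))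
  where A = proj₁ S

-- Deletion is the only minor treated directly; the other two are deletions from locally equivalent
-- graphs, and `NP-*` translates their colour back to `G`.
split⇒NP : ∀ {m} (G : Graph (suc m)) → IsSimple G → Prime G → ∀ v → Split (delete G v) →
  NonPrime.NP G v (false , true)
split⇒NP {m} G G-simple prime v (A , (a₁ , a₂ , a≢ , Aa₁ , Aa₂) , (b₁ , b₂ , b≢ , Ab₁ , Ab₂) , A′ , B′ , _ , _ , h) = record
  { X = X ; Y = Y ; X∌v = at-v A ; Y∌v = at-v (∁ A) ; cover = cover
  ; 2≤X = 2≤X ; 2≤Y = 2≤Y ; wX = proj₁ P.witness′ ; wY = proj₁ Q.witness′
  ; sX = proj₁ (proj₂ P.witness′) ; sY = proj₁ (proj₂ Q.witness′)
  ; kX = proj₂ (proj₂ P.witness′) ; kY = proj₂ (proj₂ Q.witness′)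
  ; rX = P.defect ; rY = Q.defect }
  where
  extend : Sub m → Sub (suc m)
  extend A w with v ≟ w
  ... | yes _  = false
  ... | no v≢w = A (punchOut v≢w)
  at-v : ∀ A → extend A v ≡ false
  at-v A with v ≟ v
  ... | yes _ = refl
  ... | no ¬p = ⊥-elim (¬p refl)
  at-punch : ∀ A i → extend A (punchIn v i) ≡ A i
  at-punch A i with v ≟ punchIn v i
  ... | yes e  = ⊥-elim (Finₚ.punchInᵢ≢i v i (sym e))
  ... | no v≢w = cong A (Finₚ.punchOut-punchIn v)
  extend-true : ∀ A {w} → extend A w ≡ true → ∃ λ i → punchIn v i ≡ w × A i ≡ true
  extend-true A {w} e with v ≟ w
  ... | no v≢w = punchOut v≢w , Finₚ.punchIn-punchOut v≢w , e
  X Y X′ Y′ : Sub (suc m)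
  X = extend A
  Y = extend (∁ A)
  X′ = extend A′
  Y′ = extend B′
  cover : ∀ w → w ≢ v → Y w ≡ not (X w)
  cover w w≢v with v ≟ w
  ... | yes e = ⊥-elim (w≢v (sym e))
  ... | no _  = refl
  2≤X : 2 ≤ # X
  2≤X = #-≥2 X (a≢ ∘ Finₚ.punchIn-injective v a₁ a₂) (trans (at-punch A a₁) Aa₁) (trans (at-punch A a₂) Aa₂)
  2≤Y : 2 ≤ # Y
  2≤Y = #-≥2 Y (b≢ ∘ Finₚ.punchIn-injective v b₁ b₂) (trans (at-punch (∁ A) b₁) (cong not Ab₁)) (trans (at-punch (∁ A) b₂) (cong not Ab₂))
  entry : ∀ x y → X x ≡ true → Y y ≡ true → G x y ≡ X′ x ∧ Y′ y
  entry x y Xx Yy with extend-true A Xx | extend-true (∁ A) Yy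
  ... | i , refl , Ai | j , refl , ¬Aj = trans (split-entry (h i j Ai (Boolₚ.not-injective ¬Aj)))
      (sym (cong₂ _∧_ (at-punch A′ i) (at-punch B′ j)))
  module P where
    open OneSided G G-simple X Y X′ Y′ v (at-v A) cover entry public
    witness′ = witness prime 2≤X 2≤Y
  module Q where
    open OneSided G G-simple Y X Y′ X′ v (at-v (∁ A))
      (λ w w≢v → sym (trans (cong not (cover w w≢v)) (Boolₚ.not-involutive (X w))))
      (λ y x Yy Xx → trans (proj₁ G-simple y x) (trans (entry x y Xx Yy) (Boolₚ.∧-comm (X′ x) (Y′ y)))) public
    witness′ = witness prime 2≤Y 2≤X

-- Recovering a graph from its coloured rows

module _ {n : ℕ} (H : Graph n) (H-irr : ∀ x → H x x ≡ false) where

  -- For a simple `H`, the graph `H` itself has such data with `b w` equal to (0,1) and `t w` the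
  -- unit vector at `w`. The record keeps only the part of this pattern that survives recolouring
  -- each coordinate.
  record Presentation (G : Graph n) : Set where
    open Space G
    field
      b      : Fin n → K
      t      : Fin n → Vec₂ n
      b≢0    : ∀ w → b w ≢ 0ᴷ
      c≢0    : ∀ w → col (t w) w ≢ 0ᴷ
      c≢b    : ∀ w → col (t w) w ≢ b w
      around : ∀ w y → y ≢ w → col (t w) y ≡ (if H w y then b y else 0ᴷ)

  present-* : ∀ {G} (G-simple : IsSimple G) u → Presentation G → Presentation (G * u)
  present-* {G} G-simple u P = record
    { b = λ y → φ y (b y) ; t = λ w → push G G-simple u (t w)
    ; b≢0 = λ w → ψ-≢0 G G-simple u w (b≢0 w)
    ; c≢0 = λ w e → ψ-≢0 G G-simple u w (c≢0 w) (trans (sym (col-push G G-simple u (t w) w)) e)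
    ; c≢b = λ w e → ψ-≢ G G-simple u w (c≢b w) (trans (sym (col-push G G-simple u (t w) w)) e)
    ; around = λ w y y≢w → trans (col-push G G-simple u (t w) y) (trans (cong (φ y) (around w y y≢w)) (push-if y (H w y))) }
    where
    open Presentation P
    φ : Fin n → K → K
    φ = ψ G G-simple u
    push-if : ∀ y h → φ y (if h then b y else 0ᴷ) ≡ (if h then φ y (b y) else 0ᴷ)
    push-if y true  = refl
    push-if y false = ψ-zero G G-simple u y refl

  -- b w is the colour at w of an Eulerian vector; a graph is read off once b is everywhere (0,1).
  present⇒LocEq : ∀ k {G} (G-simple : IsSimple G) (P : Presentation G) →
    # (proj₁ ∘ Presentation.b P) ≡ k → LocEq G H
  present⇒LocEq k {G} G-simple P e with Finₚ.any? (λ w → (proj₁ (Presentation.b P w) Boolₚ.≟ true) ×-dec (proj₂ (Presentation.b P w) Boolₚ.≟ true))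
  present⇒LocEq zero {G} G-simple P e | yes (w , p , _) = ⊥-elim (ℕₚ.1+n≰n (subst (1 ≤_) e (#-pos (proj₁ ∘ Presentation.b P) p)))
  -- Complementing at `w` turns `b w` from (1,1) into (0,1) and changes no other first coordinate,
  -- so the measure drops by one.
  present⇒LocEq (suc k) {G} G-simple P e | yes (w , p , q) = step w (present⇒LocEq k (*-simple G G-simple w) (present-* G-simple w P)
    (ℕₚ.suc-injective (trans (cong suc (#-cong drops)) (trans (sym (#-∖ (proj₁ ∘ b) w p)) e))))
    where
    open Presentation P
    drops : (λ y → proj₁ (b y) xor (same y w ∧ proj₂ (b y))) ≗ (proj₁ ∘ b) ∖ w
    drops y with y ≟ w
    ... | yes refl = trans (cong₂ _xor_ p q) (sym (Boolₚ.∧-zeroʳ _))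
    ... | no _     = trans (Boolₚ.xor-identityʳ _) (sym (Boolₚ.∧-identityʳ _))
  present⇒LocEq k {G} G-simple P e | no ¬11 with Finₚ.any? (λ w → proj₁ (Presentation.b P w) Boolₚ.≟ true)
  -- Now `b` is (0,1) throughout, so `t w` has first coordinate 1 only at `w`. It is the unit vector
  -- there, and its second coordinates are both the row of `G` and that of `H`.
  present⇒LocEq k {G} G-simple P e | no ¬11 | no ¬1 = done λ x y → eq x y (x ≟ y)
    where
    open Presentation P
    open Conn G hiding (b)
    open Simple G-simple
    b₁ : ∀ y → proj₁ (b y) ≡ false
    b₁ y = ¬true⇒false λ h → ¬1 (y , h)
    b₂ : ∀ y → proj₂ (b y) ≡ true
    b₂ y = ¬false⇒true λ h → b≢0 y (cong₂ _,_ (b₁ y) h)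
    t-off : ∀ w y → y ≢ w → t w y ≡ false
    t-off w y y≢w = trans (cong proj₁ (around w y y≢w)) (f (H w y))
      where
      f : ∀ h → proj₁ (if h then b y else 0ᴷ) ≡ false
      f true  = b₁ y
      f false = refl
    t-on : ∀ w → t w w ≡ true
    t-on w = ¬false⇒true λ h → c≢b w (ω-false (c≢0 w) (b≢0 w)
      (cong₂ _xor_ (cong (_∧ proj₂ (b w)) h) (trans (cong (z (t w) w ∧_) (b₁ w)) (Boolₚ.∧-zeroʳ _))))
    t-unit : ∀ w → t w ≗ unit w
    t-unit w y with y ≟ w
    ... | yes refl = t-on w
    ... | no  y≢w  = t-off w y y≢w
    eq : ∀ x y → Dec (x ≡ y) → G x y ≡ H x y
    eq x y (yes refl) = trans (proj₂ G-simple x) (sym (H-irr x))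
    eq x y (no x≢y) = begin
      G x y          ≡⟨ G-sym x y ⟩
      G y x          ≡⟨ z-unit x y ⟨
      z (unit x) y   ≡⟨ z-cong (sym ∘ t-unit x) y ⟩
      z (t x) y      ≡⟨ cong proj₂ (around x y (x≢y ∘ sym)) ⟩
      proj₂ (if H x y then b y else 0ᴷ) ≡⟨ f (H x y) ⟩
      H x y          ∎
      where
      open ≡-Reasoning
      f : ∀ h → proj₂ (if h then b y else 0ᴷ) ≡ h
      f true  = b₂ y
      f false = refl
  present⇒LocEq zero {G} G-simple P e | no ¬11 | yes (w , p) = ⊥-elim (ℕₚ.1+n≰n (subst (1 ≤_) e (#-pos (proj₁ ∘ Presentation.b P) p)))
  present⇒LocEq (suc k) {G} G-simple P e | no ¬11 | yes (w , p) with Finₚ.any? (λ y → (G w y Boolₚ.≟ true) ×-dec (proj₁ (Presentation.b P y) Boolₚ.≟ true))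
  -- Otherwise `unit w` has colour `b` on all of its support and commutes with `t w` away from `w`.
  -- It would then commute with it at `w`, where `t w` avoids `b w`.
  ... | no ¬nb = ⊥-elim (true≢false (ω-true (λ h → true≢false (same-refl w) (cong proj₁ h)) (c≢0 w) (λ h → c≢b w (trans (sym h) bw)))
      (commute-at G-sym (unit w) (t w) w λ y y≢w → off y y≢w (G y w) refl))
    where
    open Presentation P
    open Conn G hiding (b)
    open Simple G-simple
    bw : col (unit w) w ≡ b w
    bw = cong₂ _,_ (trans (same-refl w) (sym p)) (trans (z-unit w w) (trans (proj₂ G-simple w) (sym (¬true⇒false λ h → ¬11 (w , p , h)))))
    off : ∀ y → y ≢ w → ∀ g → G y w ≡ g → ω (col (unit w) y) (col (t w) y) ≡ false
    off y y≢w false g = cong (λ k → ω k (col (t w) y)) (cong₂ _,_ (same-≢ y≢w) (trans (z-unit w y) g))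
    off y y≢w true  g = trans (cong₂ ω unit≡b (around w y y≢w)) (f (H w y))
      where
      b₁ : proj₁ (b y) ≡ false
      b₁ = ¬true⇒false λ h → ¬nb (y , trans (G-sym w y) g , h)
      unit≡b : col (unit w) y ≡ b y
      unit≡b = cong₂ _,_ (trans (same-≢ y≢w) (sym b₁)) (trans (z-unit w y) (trans g (sym (¬false⇒true λ h → b≢0 y (cong₂ _,_ b₁ h)))))
      f : ∀ h → ω (b y) (if h then b y else 0ᴷ) ≡ false
      f true  = ω-self (b y)
      f false = ω-zeroʳ (b y)
  -- `b y` is (1,0) as well. Complementing at `y` fixes it and turns `b w` from (1,0) into (1,1),
  -- which complementing at `w` then turns into (0,1).
  ... | yes (y , g , q) = step y (step w (present⇒LocEq k (*-simple (G * y) simple′ w) (present-* simple′ w P′)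
      (ℕₚ.suc-injective (trans (cong suc (#-cong drops)) (trans (sym (#-∖ (proj₁ ∘ b) w p)) e)))))
    where
    open Presentation P
    simple′ : IsSimple (G * y)
    simple′ = *-simple G G-simple y
    P′ : Presentation (G * y)
    P′ = present-* G-simple y P
    kept : ∀ v → proj₁ (Presentation.b P′ v) ≡ proj₁ (b v)
    kept v with v ≟ y
    ... | yes refl = trans (cong (proj₁ (b v) xor_) (¬true⇒false λ h → ¬11 (v , q , h))) (Boolₚ.xor-identityʳ _)
    ... | no _     = Boolₚ.xor-identityʳ _
    becomes-11 : proj₂ (Presentation.b P′ w) ≡ true
    becomes-11 = cong₂ _xor_ (¬true⇒false λ h → ¬11 (w , p , h)) (cong₂ _∧_ (trans (proj₁ G-simple y w) g) p)
    drops : (λ v → proj₁ (Presentation.b P′ v) xor (same v w ∧ proj₂ (Presentation.b P′ v))) ≗ (proj₁ ∘ b) ∖ w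
    drops v with v ≟ w
    ... | yes refl = trans (cong₂ _xor_ (trans (kept v) p) becomes-11) (sym (Boolₚ.∧-zeroʳ _))
    ... | no _     = trans (Boolₚ.xor-identityʳ _) (trans (kept v) (sym (Boolₚ.∧-identityʳ _)))

-- Chains of triples

module Cyclic (m : ℕ) where

  nxt prv : ℕ → ℕ
  nxt i = if i ℕ.≡ᵇ 4 + m then 0 else suc i
  prv zero    = 4 + m
  prv (suc i) = i

  nxt-last : ∀ {i} → i ≡ 4 + m → nxt i ≡ 0
  nxt-last {i} e with i ℕ.≡ᵇ 4 + m in eq
  ... | true  = refl
  ... | false = ⊥-elim (subst T eq (ℕₚ.≡⇒≡ᵇ i (4 + m) e))

  nxt-suc : ∀ {i} → i ≢ 4 + m → nxt i ≡ suc i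
  nxt-suc {i} ne with i ℕ.≡ᵇ 4 + m in eq
  ... | true  = ⊥-elim (ne (ℕₚ.≡ᵇ⇒≡ i (4 + m) (subst T (sym eq) tt)))
  ... | false = refl

  prv-< : ∀ {i} → i < 5 + m → prv i < 5 + m
  prv-< {zero}  l = ℕₚ.n<1+n _
  prv-< {suc i} l = ℕₚ.<-trans (ℕₚ.n<1+n i) l

  nxt-< : ∀ {i} → i < 5 + m → nxt i < 5 + m
  nxt-< {i} l with i ℕ.≟ 4 + m
  ... | yes e = subst (_< 5 + m) (sym (nxt-last e)) (s≤s z≤n)
  ... | no ne  = subst (_< 5 + m) (sym (nxt-suc ne)) (s≤s (ℕₚ.≤∧≢⇒< (ℕₚ.≤-pred l) ne))

  nxt-prv : ∀ {i} → i < 5 + m → nxt (prv i) ≡ i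
  nxt-prv {zero}  l = nxt-last {4 + m} refl
  nxt-prv {suc i} l = nxt-suc λ { refl → ℕₚ.<-irrefl refl l }

  prv-nxt : ∀ i → prv (nxt i) ≡ i
  prv-nxt i with i ℕ.≟ 4 + m
  ... | yes e = trans (cong prv (nxt-last e)) (sym e)
  ... | no ne  = cong prv (nxt-suc ne)

  record Spread (i : ℕ) : Set where
    field
      p≢n   : prv i ≢ nxt i
      pp≢n  : prv (prv i) ≢ nxt i
      p≢nn  : prv i ≢ nxt (nxt i)
      pp≢nn : prv (prv i) ≢ nxt (nxt i)

  -- A cyclic length of at least 5 keeps the two predecessors of a position apart from its two
  -- successors. The cases follow where the successors wrap around.
  spread : ∀ i → Spread i
  spread 0 = record { p≢n = λ () ; pp≢n = λ () ; p≢nn = λ () ; pp≢nn = λ () }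
  spread 1 = record { p≢n = λ () ; pp≢n = λ () ; p≢nn = λ () ; pp≢nn = λ () }
  spread (suc (suc i)) with (2 + i) ℕ.≟ 4 + m | (3 + i) ℕ.≟ 4 + m
  ... | yes refl | _ = record
    { p≢n = λ e → ℕₚ.1+n≢0 (trans e n≡) ; pp≢n = λ e → ℕₚ.1+n≢0 (trans e n≡)
    ; p≢nn = λ e → ℕₚ.1+n≢0 (ℕₚ.suc-injective (trans e nn≡)) ; pp≢nn = λ e → ℕₚ.1+n≢0 (ℕₚ.suc-injective (trans e nn≡)) }
    where
    n≡ : nxt (4 + m) ≡ 0
    n≡ = nxt-last {4 + m} refl
    nn≡ : nxt (nxt (4 + m)) ≡ 1
    nn≡ = cong nxt n≡
  ... | no ne | yes e′ = record
    { p≢n = λ e → ℕₚ.<⇒≢ (s≤s (s≤s (ℕₚ.n≤1+n i))) (trans e n≡) ; pp≢n = λ e → ℕₚ.<⇒≢ (s≤s (ℕₚ.m≤n+m i 2)) (trans e n≡)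
    ; p≢nn = λ e → ℕₚ.1+n≢0 (trans e nn≡)
    ; pp≢nn = λ e → ℕₚ.1+n≢0 (trans (sym (ℕₚ.suc-injective (ℕₚ.suc-injective (ℕₚ.suc-injective e′)))) (trans e nn≡)) }
    where
    n≡ : nxt (2 + i) ≡ 3 + i
    n≡ = nxt-suc ne
    nn≡ : nxt (nxt (2 + i)) ≡ 0
    nn≡ = trans (cong nxt n≡) (nxt-last e′)
  ... | no ne | no ne′ = record
    { p≢n = λ e → ℕₚ.<⇒≢ (s≤s (s≤s (ℕₚ.n≤1+n i))) (trans e n≡) ; pp≢n = λ e → ℕₚ.<⇒≢ (s≤s (ℕₚ.m≤n+m i 2)) (trans e n≡)
    ; p≢nn = λ e → ℕₚ.<⇒≢ (s≤s (s≤s (ℕₚ.m≤n+m i 2))) (trans e nn≡)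
    ; pp≢nn = λ e → ℕₚ.<⇒≢ (s≤s (ℕₚ.m≤n+m i 3)) (trans e nn≡) }
    where
    n≡ : nxt (2 + i) ≡ 3 + i
    n≡ = nxt-suc ne
    nn≡ : nxt (nxt (2 + i)) ≡ 4 + i
    nn≡ = trans (cong nxt n≡) (nxt-suc ne′)

  adj : ℕ → ℕ → ℕ → Bool
  adj k a b = (suc a ℕ.≡ᵇ b) ∨ (suc b ℕ.≡ᵇ a) ∨ ((a ℕ.≡ᵇ 0) ∧ (suc b ℕ.≡ᵇ k)) ∨ ((b ℕ.≡ᵇ 0) ∧ (suc a ℕ.≡ᵇ k))

  private
    ≡ᵇ-true : ∀ {a b} → (a ℕ.≡ᵇ b) ≡ true → a ≡ b
    ≡ᵇ-true {a} {b} e = ℕₚ.≡ᵇ⇒≡ a b (subst T (sym e) tt)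

    true-≡ᵇ : ∀ {a b} → a ≡ b → (a ℕ.≡ᵇ b) ≡ true
    true-≡ᵇ {a} refl = h a
      where
      h : ∀ a → (a ℕ.≡ᵇ a) ≡ true
      h zero    = refl
      h (suc a) = h a

    ∨-true : ∀ {a b} → a ∨ b ≡ true → a ≡ true ⊎ b ≡ true
    ∨-true {true}  _ = inj₁ refl
    ∨-true {false} e = inj₂ e

    ∨-introʳ : ∀ a {b} → b ≡ true → a ∨ b ≡ true
    ∨-introʳ a refl = Boolₚ.∨-zeroʳ a

    ∨-introˡ : ∀ {a} b → a ≡ true → a ∨ b ≡ true
    ∨-introˡ b refl = refl

  adj-sound : ∀ a b → a < 5 + m → b < 5 + m → adj (5 + m) a b ≡ true → b ≡ prv a ⊎ b ≡ nxt a
  adj-sound a b a< b< e with ∨-true {suc a ℕ.≡ᵇ b} e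
  ... | inj₁ h = inj₂ (trans (sym (≡ᵇ-true h)) (sym (nxt-suc λ { refl → ℕₚ.<-irrefl (sym (≡ᵇ-true {suc a} {b} h)) b< })))
  ... | inj₂ e₁ with ∨-true {suc b ℕ.≡ᵇ a} e₁
  ...   | inj₁ h = inj₁ (cong prv (≡ᵇ-true {suc b} {a} h))
  ...   | inj₂ e₂ with ∨-true {(a ℕ.≡ᵇ 0) ∧ (suc b ℕ.≡ᵇ 5 + m)} e₂
  ...     | inj₁ h = let p , q = ∧-true {a ℕ.≡ᵇ 0} h in
    inj₁ (trans (ℕₚ.suc-injective (≡ᵇ-true {suc b} {5 + m} q)) (cong prv (sym (≡ᵇ-true {a} {0} p))))
  ...     | inj₂ h = let p , q = ∧-true {b ℕ.≡ᵇ 0} h in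
    inj₂ (trans (≡ᵇ-true {b} {0} p) (sym (nxt-last (ℕₚ.suc-injective (≡ᵇ-true {suc a} {5 + m} q)))))

  adj-nxt : ∀ a → adj (5 + m) a (nxt a) ≡ true
  adj-nxt a with a ℕ.≟ 4 + m
  ... | no ne  = ∨-introˡ {suc a ℕ.≡ᵇ nxt a} _ (true-≡ᵇ (sym (nxt-suc ne)))
  ... | yes e = ∨-introʳ (suc a ℕ.≡ᵇ nxt a) (∨-introʳ (suc (nxt a) ℕ.≡ᵇ a) (∨-introʳ ((a ℕ.≡ᵇ 0) ∧ (suc (nxt a) ℕ.≡ᵇ 5 + m))
    (cong₂ _∧_ (true-≡ᵇ (nxt-last e)) (true-≡ᵇ (cong suc e)))))

  adj-prv : ∀ a → adj (5 + m) a (prv a) ≡ true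
  adj-prv zero    = ∨-introʳ (1 ℕ.≡ᵇ 4 + m) (∨-introʳ (5 + m ℕ.≡ᵇ 0) (∨-introˡ {5 + m ℕ.≡ᵇ 5 + m} _ (true-≡ᵇ {5 + m} refl)))
  adj-prv (suc a) = ∨-introʳ (suc (suc a) ℕ.≡ᵇ a) (∨-introˡ {suc a ℕ.≡ᵇ suc a} _ (true-≡ᵇ {suc a} refl))

module Chains {n : ℕ} (G : Graph n) (G-simple : IsSimple G) (prime : Prime G) (5≤n : 5 ≤ n) where
  open Triangle G G-simple prime 5≤n public

  -- Values of `v` at positions from `k` on are arbitrary; indexing by `ℕ` avoids casts when a chain
  -- is lengthened, shifted or reversed.
  record Chain (k : ℕ) : Set where
    field
      v   : ℕ → Fin n
      inj : ∀ {i j} → i < k → j < k → v i ≡ v j → i ≡ j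
      tri : ∀ i → 2 + i < k → Tri (v i) (v (1 + i)) (v (2 + i))

    distinct : ∀ {i j} → i < k → j < k → i ≢ j → v i ≢ v j
    distinct i< j< i≢j e = i≢j (inj i< j< e)

    pre : ℕ → Sub n
    pre zero    _ = false
    pre (suc i) = pre i ∪₁ v i

    pre-∈ : ∀ {i j} → i < j → pre j (v i) ≡ true
    pre-∈ {i} {suc j} (s≤s i≤j) with i ℕ.≟ j
    ... | yes refl = ∪₁-self (pre j) (v j)
    ... | no  i≢j  = ∪₁-⊇ {A = pre j} {v j} (v i) (pre-∈ (ℕₚ.≤∧≢⇒< i≤j i≢j))

    pre-∈⁻ : ∀ j {w} → pre j w ≡ true → ∃ λ i → i < j × v i ≡ w
    pre-∈⁻ (suc j) h with ∪₁-true (pre j) h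
    ... | inj₁ e = j , ℕₚ.n<1+n j , sym e
    ... | inj₂ h′ with pre-∈⁻ j h′
    ...   | i , i<j , e = i , ℕₚ.<-trans i<j (ℕₚ.n<1+n j) , e

    pre-∉ : ∀ {i j} → i < k → j ≤ i → pre j (v i) ≡ false
    pre-∉ {i} {j} i<k j≤i = ¬true⇒false λ h → let l , l<j , e = pre-∈⁻ j h in
      ℕₚ.<-irrefl (inj (ℕₚ.<-trans (ℕₚ.<-≤-trans l<j j≤i) i<k) i<k e) (ℕₚ.<-≤-trans l<j j≤i)

    #-pre : ∀ j → j ≤ k → # (pre j) ≡ j
    #-pre zero    _   = #-empty (pre 0) λ _ → refl
    #-pre (suc j) j<k = trans (#-∪₁ (pre j) (v j) (pre-∉ j<k ℕₚ.≤-refl)) (cong suc (#-pre j (ℕₚ.<⇒≤ j<k)))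

    tri-pre : ∀ i (l : 2 + i < k) → Supp (vec (tri i l)) (pre (3 + i))
    tri-pre i l w h = Tri.off (tri i l) w (ne (ℕₚ.m≤n+m (suc i) 2)) (ne (ℕₚ.m≤n+m (2 + i) 1)) (ne ℕₚ.≤-refl)
      where
      ne : ∀ {j} → j < 3 + i → w ≢ v j
      ne j< refl = true≢false (pre-∈ j<) h

    -- Each new vertex is the last one of a triple inside the prefix and so raises `r`; every such
    -- prefix has cutrank at most 2.
    r-pre : ∀ i → 2 + i ≤ k → i ≤ r (pre (2 + i))
    r-pre zero    _ = z≤n
    r-pre (suc i) l = ℕₚ.≤-trans (s≤s (r-pre i (ℕₚ.<⇒≤ l)))
      (r-step {pre (2 + i)} {pre (3 + i)} {vec (tri i l)} (∪₁-⊇ {A = pre (2 + i)} {v (2 + i)}) (pre-∉ l ℕₚ.≤-refl) (tri-pre i l) (Tri.nz₃ (tri i l)))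

  shift : ∀ {k} → Chain (suc k) → Chain k
  shift C = record
    { v = v ∘ suc ; inj = λ i< j< e → ℕₚ.suc-injective (inj (s≤s i<) (s≤s j<) e) ; tri = λ i l → tri (suc i) (s≤s l) }
    where open Chain C

  nonzero-in : ∀ {A} → 1 ≤ r A → ∃ λ c → Supp c A × ∃ λ v → col c v ≢ 0ᴷ
  nonzero-in {A} 1≤ with r-witness {λ _ → false} {A} (subst (_< r A) (sym (r-∅ (λ _ → false) λ _ → refl)) 1≤)
  ... | c , s , ¬s with Finₚ.any? (λ v → ¬? (≟0 (col c v)))
  ...   | yes nz = c , s , nz
  ...   | no ¬nz = ⊥-elim (¬s λ v _ → zero? v)
    where
    zero? : ∀ v → col c v ≡ 0ᴷ
    zero? v with ≟0 (col c v)
    ... | yes e = e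
    ... | no ≢0 = ⊥-elim (¬nz (v , ≢0))

  set-tri : ∀ {a b e} → a ≢ b → a ≢ e → b ≢ e → 1 ≤ r (set (a ∷ b ∷ e ∷ [])) → Tri a b e
  set-tri a≢b a≢e b≢e 1≤ with nonzero-in 1≤
  ... | c , s , v , ≢0 = mkTri c v a≢b a≢e b≢e (λ w p q q′ → s w (set-false (p ∷ q ∷ q′ ∷ []))) ≢0

  module Closing (m : ℕ) (C : Chain (5 + m)) (t₀ : Tri (Chain.v C 0) (Chain.v C 1) (Chain.v C (4 + m))) where
    open Chain C
    open Cyclic m

    private
      -- These numerals count from `m`: `3<` bounds `3 + m`, whereas `0<k` and `1<k` bound 0 and 1.
      1< 2< 3< 4< : _ < 5 + m
      1< = ℕₚ.m≤n+m (2 + m) 3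
      2< = ℕₚ.m≤n+m (3 + m) 2
      3< = ℕₚ.m≤n+m (4 + m) 1
      4< = ℕₚ.≤-refl {5 + m}
      0<k : 0 < 5 + m
      0<k = s≤s z≤n
      1<k : 1 < 5 + m
      1<k = s≤s (s≤s z≤n)

      t₁ : Tri (v (1 + m)) (v (2 + m)) (v (3 + m))
      t₁ = tri (1 + m) 3<
      t₂ : Tri (v (2 + m)) (v (3 + m)) (v (4 + m))
      t₂ = tri (2 + m) 4<

      -- The colours of `t₀` and `t₂` at their common vertex `v (4 + m)` agree and cancel, so `u` is
      -- supported in the first `4 + m` vertices.
      u : Vec₂ n
      u = vec t₀ ⊞ vec t₂

      t₀≡t₂ : at t₀ (v (4 + m)) ≡ at t₂ (v (4 + m))
      t₀≡t₂ = agree t₀ (swap₁₃ t₂) (distinct 0<k 3< λ ()) (distinct 0<k 2< λ ()) (distinct 1<k 3< λ ()) (distinct 1<k 2< λ ())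

      u-supp : Supp u (pre (4 + m))
      u-supp w h = trans (col-⊞ (vec t₀) (vec t₂) w) (go (w ≟ v (4 + m)))
        where
        ne : ∀ {j} → j < 4 + m → w ≢ v j
        ne j< refl = true≢false (pre-∈ j<) h
        go : Dec (w ≡ v (4 + m)) → at t₀ w +ᴷ at t₂ w ≡ 0ᴷ
        go (yes refl) = trans (cong (_+ᴷ at t₂ w) t₀≡t₂) (+ᴷ-self (at t₂ w))
        go (no w≢) = cong₂ _+ᴷ_ (Tri.off t₀ w (ne (s≤s z≤n)) (ne (s≤s (s≤s z≤n))) w≢)
                                (Tri.off t₂ w (ne (ℕₚ.m≤n+m (3 + m) 1)) (ne ℕₚ.≤-refl) w≢)

      u-colour : col u (v (3 + m)) ≡ at t₂ (v (3 + m))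
      u-colour = trans (col-⊞ (vec t₀) (vec t₂) (v (3 + m))) (cong (_+ᴷ at t₂ (v (3 + m)))
        (Tri.off t₀ (v (3 + m)) (distinct 3< 0<k λ ()) (distinct 3< 1<k λ ()) (distinct 3< 4< (ℕₚ.<⇒≢ ℕₚ.≤-refl))))

      -- At `v (3 + m)` both `t₁` and `u` contribute, with different colours, so this vertex adds 2
      -- to `r`. The prefix then has cutrank at most 1, and primality leaves at most one vertex
      -- outside it.
      r-large : 3 + m ≤ r (pre (4 + m))
      r-large = ℕₚ.≤-trans (ℕₚ.+-monoʳ-≤ 2 (r-pre (1 + m) 2<))
        (r-step₂ {pre (3 + m)} {pre (4 + m)} {vec t₁} {u} (∪₁-⊇ {A = pre (3 + m)} {v (3 + m)}) (pre-∉ 3< ℕₚ.≤-refl)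
          (tri-pre (1 + m) 3<) u-supp
          (trans (cong (ω (at t₁ (v (3 + m)))) u-colour) (proj₂ (differ t₁ t₂ (distinct 1< 4< (ℕₚ.<⇒≢ (ℕₚ.m≤n+m (2 + m) 2)))))))

    surjective : ∀ w → ∃ λ i → i < 5 + m × v i ≡ w
    surjective w with pre (4 + m) w in eq
    ... | true = let i , i< , e = pre-∈⁻ (4 + m) eq in i , ℕₚ.<-trans i< ℕₚ.≤-refl , e
    ... | false with v (4 + m) ≟ w
    ...   | yes e = 4 + m , ℕₚ.≤-refl , e
    ...   | no ne  = ⊥-elim (ℕₚ.<⇒≱ (s≤s (s≤s r-large)) (subst (2 + r (pre (4 + m)) ≤_) (#-pre (4 + m) (ℕₚ.n≤1+n _))
        (prime-bound prime (pre (4 + m)) (subst (2 ≤_) (sym (#-pre (4 + m) (ℕₚ.n≤1+n _))) (s≤s (s≤s z≤n)))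
          (#-≥2 (∁ (pre (4 + m))) ne (cong not (pre-∉ 4< ℕₚ.≤-refl)) (cong not eq)))))

    private
      module S = Chain (shift C)
      A : Sub n
      A = S.pre (2 + m)

      ∁A : ∁ A ≗ set (v (3 + m) ∷ v (4 + m) ∷ v 0 ∷ [])
      ∁A w with A w in eq
      ... | true = let i , i< , e = S.pre-∈⁻ (2 + m) eq in sym (set-false
          ((λ h → ℕₚ.<⇒≢ (s≤s i<) (inj (ℕₚ.<-trans (s≤s i<) 3<) 3< (trans e h)))
          ∷ (λ h → ℕₚ.<⇒≢ (ℕₚ.<-trans (s≤s i<) ℕₚ.≤-refl) (inj (ℕₚ.<-trans (s≤s i<) 3<) 4< (trans e h)))
          ∷ (λ h → ℕₚ.1+n≢0 (inj (ℕₚ.<-trans (s≤s i<) 3<) 0<k (trans e h))) ∷ []))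
      ... | false = sym (¬false⇒true λ h → out-of-range (set-false⁻ (v (3 + m) ∷ v (4 + m) ∷ v 0 ∷ []) h) (surjective w))
        where
        out-of-range : All (w ≢_) (v (3 + m) ∷ v (4 + m) ∷ v 0 ∷ []) → (∃ λ i → i < 5 + m × v i ≡ w) → ⊥
        out-of-range (p ∷ q ∷ q′ ∷ []) (zero , _ , e) = q′ (sym e)
        out-of-range (p ∷ q ∷ q′ ∷ []) (suc i , s≤s i< , e) = true≢false
          (subst (λ x → A x ≡ true) e (S.pre-∈ (ℕₚ.≤∧≢⇒< (ℕₚ.≤-pred (ℕₚ.≤∧≢⇒< (ℕₚ.≤-pred i<) λ { refl → q (sym e) })) λ { refl → p (sym e) }))) eq

      #∁A : # (∁ A) ≡ 3
      #∁A = trans (#-cong ∁A) (#-set ((distinct 3< 4< (ℕₚ.<⇒≢ ℕₚ.≤-refl) ∷ distinct 3< 0<k (λ ()) ∷ []) ∷ (distinct 4< 0<k (λ ()) ∷ []) ∷ [] ∷ []))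

    -- Its complement is the prefix of length `2 + m` of the shifted chain, of cutrank at most 2. By
    -- duality the 3-set also has cutrank at most 2 and so supports a nonzero vector.
    last : Tri (v (3 + m)) (v (4 + m)) (v 0)
    last = set-tri (distinct 3< 4< (ℕₚ.<⇒≢ ℕₚ.≤-refl)) (distinct 3< 0<k (λ ())) (distinct 4< 0<k (λ ()))
      (ℕₚ.+-cancelʳ-≤ (2 + m) 1 _ (begin
        3 + m                   ≡⟨ ℕₚ.+-comm 3 m ⟩
        m + 3                   ≤⟨ ℕₚ.+-mono-≤ (S.r-pre m (ℕₚ.m≤n+m (2 + m) 2)) (ℕₚ.≤-reflexive (sym #∁A)) ⟩
        r A + # (∁ A)           ≡⟨ duality A ⟩
        r (∁ A) + # A           ≡⟨ cong₂ _+_ (r-cong {∁ A} {set (v (3 + m) ∷ v (4 + m) ∷ v 0 ∷ [])} ∁A) (S.#-pre (2 + m) (ℕₚ.m≤n+m (2 + m) 2)) ⟩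
        r (set (v (3 + m) ∷ v (4 + m) ∷ v 0 ∷ [])) + (2 + m) ∎))
      where open ℕₚ.≤-Reasoning

    around : ∀ i → i < 5 + m → Tri (v (prv i)) (v i) (v (nxt i))
    around zero _ = swap₁₂ (swap₂₃ t₀)
    around (suc i) l with suc i ℕ.≟ 4 + m
    ... | yes refl = subst (λ j → Tri (v (3 + m)) (v (4 + m)) (v j)) (sym (nxt-last {4 + m} refl)) last
    ... | no ne     = subst (λ j → Tri (v i) (v (suc i)) (v j)) (sym (nxt-suc ne)) (tri i (s≤s (ℕₚ.≤∧≢⇒< (ℕₚ.≤-pred l) ne)))

    private
      idx : Fin n → ℕ
      idx w = proj₁ (surjective w)
      idx< : ∀ w → idx w < 5 + m
      idx< w = proj₁ (proj₂ (surjective w))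
      v-idx : ∀ w → v (idx w) ≡ w
      v-idx w = proj₂ (proj₂ (surjective w))

      n≡k : n ≡ 5 + m
      n≡k = ℕₚ.≤-antisym
        (Finₚ.injective⇒≤ {f = λ w → fromℕ< (idx< w)} λ {x} {y} e → trans (sym (v-idx x)) (trans (cong v
           (trans (sym (Finₚ.toℕ-fromℕ< (idx< x))) (trans (cong toℕ e) (Finₚ.toℕ-fromℕ< (idx< y))))) (v-idx y)))
        (Finₚ.injective⇒≤ {f = v ∘ toℕ} λ {x} {y} e → Finₚ.toℕ-injective (inj (Finₚ.toℕ<n x) (Finₚ.toℕ<n y) e))

      idx<n : ∀ w → idx w < n
      idx<n w = subst (idx w <_) (sym n≡k) (idx< w)

      label : Fin n ↔ Fin n
      label = mk↔ₛ′ (λ w → fromℕ< (idx<n w)) (v ∘ toℕ)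
        (λ i → Finₚ.toℕ-injective (trans (Finₚ.toℕ-fromℕ< (idx<n (v (toℕ i))))
           (inj (idx< _) (subst (toℕ i <_) n≡k (Finₚ.toℕ<n i)) (v-idx (v (toℕ i))))))
        (λ w → trans (cong v (Finₚ.toℕ-fromℕ< (idx<n w))) (v-idx w))

      H : Graph n
      H x y = cycAdj n (Inverse.to label x) (Inverse.to label y)

      H≡ : ∀ x y → H x y ≡ adj (5 + m) (idx x) (idx y)
      H≡ x y = trans (cong₂ (adj n) (Finₚ.toℕ-fromℕ< (idx<n x)) (Finₚ.toℕ-fromℕ< (idx<n y))) (cong (λ k → adj k (idx x) (idx y)) n≡k)

      vecAt : ∀ i → i < 5 + m → Vec₂ n
      vecAt i l = vec (around i l)

      vecAt-irr : ∀ {i j} (l : i < 5 + m) (l′ : j < 5 + m) → i ≡ j → vecAt i l ≡ vecAt j l′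
      vecAt-irr l l′ refl = cong (vecAt _) (ℕₚ.<-irrelevant l l′)

      -- Vertex v i is centre of the triple at i and end of the triples at prv i and nxt i;
      -- the two ends have the same colour there, and it differs from the colour of the centre.
      end : ∀ i → i < 5 + m → K
      end i l = col (vecAt (prv i) (prv-< l)) (v i)

      neighbours-agree : ∀ i (l : i < 5 + m) → end i l ≡ col (vecAt (nxt i) (nxt-< l)) (v i)
      neighbours-agree i l = go (around (prv i) (prv-< l)) (around (nxt i) (nxt-< l)) (nxt-prv l) (prv-nxt i)
        where
        open Spread (spread i)
        p< : prv i < 5 + m
        p< = prv-< l
        n< : nxt i < 5 + m
        n< = nxt-< l
        go : ∀ {x y} (t : Tri (v (prv (prv i))) (v (prv i)) (v x)) (t′ : Tri (v y) (v (nxt i)) (v (nxt (nxt i)))) →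
          x ≡ i → y ≡ i → at t (v i) ≡ at t′ (v i)
        go t t′ refl refl = agree t t′ (distinct (prv-< p<) n< pp≢n) (distinct (prv-< p<) (nxt-< n<) pp≢nn)
          (distinct p< n< p≢n) (distinct p< (nxt-< n<) p≢nn)

      centre-differs : ∀ i (l : i < 5 + m) → ω (end i l) (col (vecAt i l) (v i)) ≡ true
      centre-differs i l = go (around (prv i) (prv-< l)) (around i l) (nxt-prv l)
        where
        open Spread (spread i)
        go : ∀ {x} (t : Tri (v (prv (prv i))) (v (prv i)) (v x)) (t′ : Tri (v (prv i)) (v i) (v (nxt i))) →
          x ≡ i → ω (at t (v i)) (at t′ (v i)) ≡ true
        go t t′ refl = proj₂ (differ t t′ (distinct (prv-< (prv-< l)) (nxt-< l) pp≢n))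

      H-irr : ∀ x → H x x ≡ false
      H-irr x = trans (H≡ x x) (¬true⇒false λ e → irr (idx x) (idx< x) (adj-sound (idx x) (idx x) (idx< x) (idx< x) e))
        where
        irr : ∀ i → i < 5 + m → i ≡ prv i ⊎ i ≡ nxt i → ⊥
        irr i l (inj₁ e) = Tri.≢₁₂ (around i l) (cong v (sym e))
        irr i l (inj₂ e) = Tri.≢₂₃ (around i l) (cong v e)

      presentation : Presentation H H-irr G
      presentation = record
        { b = λ w → end (idx w) (idx< w) ; t = λ w → vecAt (idx w) (idx< w)
        ; b≢0 = λ w → ω-true⇒≢0ˡ (centre-differs (idx w) (idx< w))
        ; c≢0 = λ w → subst (λ x → col (vecAt (idx w) (idx< w)) x ≢ 0ᴷ) (v-idx w) (Tri.nz₂ (around (idx w) (idx< w)))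
        ; c≢b = λ w e → ω-true⇒≢ (centre-differs (idx w) (idx< w)) (trans (sym e) (cong (col (vecAt (idx w) (idx< w))) (sym (v-idx w))))
        ; around = λ w y y≢w → case w y y≢w (H w y) refl }
        where
        case : ∀ w y → y ≢ w → ∀ h → H w y ≡ h → col (vecAt (idx w) (idx< w)) y ≡ (if h then end (idx y) (idx< y) else 0ᴷ)
        case w y y≢w true h with adj-sound (idx w) (idx y) (idx< w) (idx< y) (trans (sym (H≡ w y)) h)
        ... | inj₁ e = trans (cong₂ col (vecAt-irr (idx< w) (nxt-< (idx< y)) (trans (sym (nxt-prv (idx< w))) (cong nxt (sym e)))) (sym (v-idx y)))
                         (sym (neighbours-agree (idx y) (idx< y)))
        ... | inj₂ e = cong₂ col (vecAt-irr (idx< w) (prv-< (idx< y)) (trans (sym (prv-nxt (idx w))) (cong prv (sym e)))) (sym (v-idx y))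
        case w y y≢w false h = Tri.off (around (idx w) (idx< w)) y
          (λ e → absurd (trans (cong (adj (5 + m) (idx w)) (inj (idx< y) (prv-< (idx< w)) (trans (v-idx y) e))) (adj-prv (idx w))))
          (λ e → y≢w (trans e (v-idx w)))
          (λ e → absurd (trans (cong (adj (5 + m) (idx w)) (inj (idx< y) (nxt-< (idx< w)) (trans (v-idx y) e))) (adj-nxt (idx w))))
          where
          absurd : adj (5 + m) (idx w) (idx y) ≡ true → ⊥
          absurd e = true≢false e (trans (sym (H≡ w y)) h)

    closed : LocEqCycle G
    closed = H , (label , λ x y → refl) , present⇒LocEq H H-irr _ G-simple presentation refl

-- Essential vertices and the growth of chains

pattern X-colour = (true , false)
pattern Y-colour = (true , true)
pattern Z-colour = (false , true)

module Growth {n : ℕ} (G : Graph n) (G-simple : IsSimple G) (prime : Prime G) (5≤n : 5 ≤ n) where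
  open Chains G G-simple prime 5≤n public

  record Essential (a : Fin n) : Set where
    field
      {i j} : K
      i≢0   : i ≢ 0ᴷ
      j≢0   : j ≢ 0ᴷ
      i≢j   : i ≢ j
      NPᵢ   : NP a i
      NPⱼ   : NP a j

  -- Having two colours allows avoiding the colour of a given triple, as the triangle lemma demands.
  other-colour : ∀ {a} → Essential a → ∀ k → ∃ λ i → i ≢ 0ᴷ × i ≢ k × NP a i
  other-colour E k with ≟0 (Essential.i E +ᴷ k)
  ... | no ≢0 = Essential.i E , Essential.i≢0 E , (λ e → ≢0 (trans (cong (_+ᴷ k) e) (+ᴷ-self k))) , Essential.NPᵢ E
  ... | yes e = Essential.j E , Essential.j≢0 E , (λ h → +ᴷ-≢0 (Essential.i≢j E) (trans (cong (Essential.i E +ᴷ_) h) e)) , Essential.NPⱼ E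

  essential-triangle : ∀ {a b e j} (t : Tri a b e) → Essential a → NP b j → j ≢ 0ᴷ → j ≢ at t b →
    ∃ λ x → x ≢ a × x ≢ b × x ≢ e × (Tri a b x ⊎ Tri a e x)
  essential-triangle {a} t E M j≢0 j≢t = let i , i≢0 , i≢t , N = other-colour E (at t a) in
    triangle-lemma t N i≢0 i≢t M j≢0 j≢t

  private
    supp-within : ∀ {a b e} (t : Tri a b e) {A} → A a ≡ true → A b ≡ true → A e ≡ true → Supp (vec t) A
    supp-within t Aa Ab Ae w h = Tri.off t w (λ { refl → true≢false Aa h }) (λ { refl → true≢false Ab h }) (λ { refl → true≢false Ae h })

  -- `t` gives one dimension on `{a, b, e}`, and `t′`, `t″` have different colours at `f`, which
  -- adds two. The 4-set thus has cutrank at most 1; this contradicts primality because 6 vertices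
  -- leave two outside.
  no-K₄ : 6 ≤ n → ∀ {a b e f} → Tri a b e → Tri b e f → Tri a b f → ⊥
  no-K₄ 6≤n {a} {b} {e} {f} t t′ t″ = ℕₚ.<⇒≱ (s≤s (s≤s r-large)) (subst (2 + r S ≤_) #S
      (prime-bound prime S (subst (2 ≤_) (sym #S) (s≤s (s≤s z≤n))) (#-large-∁ S 4 (ℕₚ.≤-reflexive #S) 6≤n)))
    where
    module T = Tri t
    module T′ = Tri t′
    S₀ S : Sub n
    S₀ = set (e ∷ b ∷ a ∷ [])
    S = S₀ ∪₁ f
    e-fresh : All (e ≢_) (b ∷ a ∷ [])
    e-fresh = (T.≢₂₃ ∘ sym) ∷ (T.≢₁₃ ∘ sym) ∷ []
    f-fresh : All (f ≢_) (e ∷ b ∷ a ∷ [])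
    f-fresh = (T′.≢₂₃ ∘ sym) ∷ (T′.≢₁₃ ∘ sym) ∷ (Tri.≢₁₃ t″ ∘ sym) ∷ []
    #S : # S ≡ 4
    #S = #-set (f-fresh ∷ e-fresh ∷ ((T.≢₁₂ ∘ sym) ∷ []) ∷ [] ∷ [])
    S₀∋ : ∀ {x} → x ∈ e ∷ b ∷ a ∷ [] → S₀ x ≡ true
    S₀∋ = set-∈ (e ∷ b ∷ a ∷ [])
    S∋ : ∀ {x} → x ∈ f ∷ e ∷ b ∷ a ∷ [] → S x ≡ true
    S∋ = set-∈ (f ∷ e ∷ b ∷ a ∷ [])
    r-large : 3 ≤ r S
    r-large = ℕₚ.≤-trans (ℕₚ.+-monoʳ-≤ 2 (r-pos {S₀} {vec t} (supp-within t {S₀} (S₀∋ (there (there (here refl)))) (S₀∋ (there (here refl))) (S₀∋ (here refl))) T.nz₁))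
      (r-step₂ {S₀} {S} {vec t″} {vec t′} (∪₁-⊇ {A = S₀} {f}) (set-false f-fresh)
        (supp-within t″ {S} (S∋ (there (there (there (here refl))))) (S∋ (there (there (here refl)))) (S∋ (here refl)))
        (supp-within t′ {S} (S∋ (there (there (here refl)))) (S∋ (there (here refl))) (S∋ (here refl)))
        (proj₂ (differ t″ (swap₂₃ t′) T.≢₁₃)))

  chain-≤ : ∀ {k} → Chain k → k ≤ n
  chain-≤ C = Finₚ.injective⇒≤ {f = Chain.v C ∘ toℕ} λ {x} {y} e →
    Finₚ.toℕ-injective (Chain.inj C (Finₚ.toℕ<n x) (Finₚ.toℕ<n y) e)

  chain₃ : ∀ {a b e} → Tri a b e → Chain 3
  chain₃ {a} {b} {e} t = record { v = v ; inj = inj ; tri = λ { zero _ → t ; (suc i) (s≤s (s≤s (s≤s ()))) } }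
    where
    module T = Tri t
    v : ℕ → Fin n
    v 0 = a
    v 1 = b
    v _ = e
    inj : ∀ {i j} → i < 3 → j < 3 → v i ≡ v j → i ≡ j
    inj {0} {0} _ _ _ = refl
    inj {1} {1} _ _ _ = refl
    inj {2} {2} _ _ _ = refl
    inj {0} {1} _ _ h = ⊥-elim (T.≢₁₂ h)
    inj {0} {2} _ _ h = ⊥-elim (T.≢₁₃ h)
    inj {1} {0} _ _ h = ⊥-elim (T.≢₁₂ (sym h))
    inj {1} {2} _ _ h = ⊥-elim (T.≢₂₃ h)
    inj {2} {0} _ _ h = ⊥-elim (T.≢₁₃ (sym h))
    inj {2} {1} _ _ h = ⊥-elim (T.≢₂₃ (sym h))
    inj {suc (suc (suc i))} (s≤s (s≤s (s≤s ())))
    inj {i} {suc (suc (suc j))} _ (s≤s (s≤s (s≤s ())))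

  prepend : ∀ {k} (C : Chain k) x → (∀ {i} → i < k → Chain.v C i ≢ x) → Tri x (Chain.v C 0) (Chain.v C 1) → Chain (suc k)
  prepend {k} C x fresh t = record { v = v′ ; inj = inj′ ; tri = λ { zero _ → t ; (suc i) (s≤s l) → tri i l } }
    where
    open Chain C
    v′ : ℕ → Fin n
    v′ zero    = x
    v′ (suc i) = v i
    inj′ : ∀ {i j} → i < suc k → j < suc k → v′ i ≡ v′ j → i ≡ j
    inj′ {zero}  {zero}  _ _ _ = refl
    inj′ {zero}  {suc j} _ (s≤s l) e = ⊥-elim (fresh l (sym e))
    inj′ {suc i} {zero}  (s≤s l) _ e = ⊥-elim (fresh l e)
    inj′ {suc i} {suc j} (s≤s l) (s≤s l′) e = cong suc (inj l l′ e)

  fresh₃ : ∀ {a b e} (t : Tri a b e) {x} → x ≢ a → x ≢ b → x ≢ e → ∀ {i} → i < 3 → Chain.v (chain₃ t) i ≢ x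
  fresh₃ t p q s {0} _ h = p (sym h)
  fresh₃ t p q s {1} _ h = q (sym h)
  fresh₃ t p q s {2} _ h = s (sym h)
  fresh₃ t p q s {suc (suc (suc i))} (s≤s (s≤s (s≤s ())))

  reverse : ∀ {k} → Chain (suc k) → Chain (suc k)
  reverse {k} C = record
    { v = λ i → v (k ℕ.∸ i)
    ; inj = λ {i} {j} i< j< e → ℕₚ.∸-cancelˡ-≡ (ℕₚ.≤-pred i<) (ℕₚ.≤-pred j<) (inj (s≤s (ℕₚ.m∸n≤m k i)) (s≤s (ℕₚ.m∸n≤m k j)) e)
    ; tri = λ i l → rev i (ℕₚ.≤-pred l) }
    where
    open Chain C
    rev : ∀ i → 2 + i ≤ k → Tri (v (k ℕ.∸ i)) (v (k ℕ.∸ (1 + i))) (v (k ℕ.∸ (2 + i)))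
    rev i l = subst₂ (λ x y → Tri (v x) (v y) (v (k ℕ.∸ (2 + i)))) (sym eq₂) (sym eq₁)
      (swap₁₃ (tri (k ℕ.∸ (2 + i)) (s≤s (subst (_≤ k) eq₂ (ℕₚ.m∸n≤m k i)))))
      where
      eq₁ : k ℕ.∸ (1 + i) ≡ 1 + (k ℕ.∸ (2 + i))
      eq₁ = ℕₚ.+-∸-assoc 1 l
      eq₂ : k ℕ.∸ i ≡ 2 + (k ℕ.∸ (2 + i))
      eq₂ = trans (ℕₚ.+-∸-assoc 1 (ℕₚ.<⇒≤ l)) (cong suc eq₁)

  module Step (6≤n : 6 ≤ n) {m : ℕ} (C : Chain (4 + m)) where
    open Chain C

    private
      <k : ∀ i {i≤3 : True (i ℕ.≤? 3)} → i < 4 + m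
      <k i {i≤3} = s≤s (ℕₚ.≤-trans (toWitness i≤3) (ℕₚ.m≤m+n 3 m))

      t₀ : Tri (v 0) (v 1) (v 2)
      t₀ = tri 0 (<k 2)
      t₁ : Tri (v 1) (v 2) (v 3)
      t₁ = tri 1 (<k 3)

    Goal : Set
    Goal = LocEqCycle G ⊎ Chain (5 + m)

    private
      -- A triple from the front that returns to the chain must hit its last vertex, and then the
      -- cycle closes. Position 3 is excluded by `no-K₄` unless, as at any interior position,
      -- another argument applies: from position 4 on, two consecutive triples through the vertex
      -- clash.
      at-index : ∀ {x} i → i < 4 + m → v i ≡ x → x ≢ v 0 → x ≢ v 1 → x ≢ v 2 → Tri (v 0) (v 1) x → LocEqCycle G
      at-index 0 l e p q s t = ⊥-elim (p (sym e))
      at-index 1 l e p q s t = ⊥-elim (q (sym e))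
      at-index 2 l e p q s t = ⊥-elim (s (sym e))
      at-index 3 l refl p q s t = ⊥-elim (no-K₄ 6≤n t₀ t₁ t)
      at-index (suc (suc (suc (suc j)))) l refl p q s t with (5 + j) ℕ.≤? 3 + m
      -- `t` meets each of `tₗ` and `tᵣ` only at `v (4 + j)`, so it has the colour of both there,
      -- although these two differ.
      ... | yes l′ = ⊥-elim (ω-true⇒≢ {at tₗ (v (4 + j))} {at tᵣ (v (4 + j))} (proj₂ (differ tₗ tᵣ (distinct 2< 5< λ e → ℕₚ.<⇒≢ (ℕₚ.m≤n+m (3 + j) 2) e)))
          (trans (sym (agree t (swap₁₂ (swap₂₃ tₗ)) (dist₀ 2 2< λ ()) (dist₀ 3 3< λ ()) (dist₁ 2 2< λ ()) (dist₁ 3 3< λ ())))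
                 (agree t (swap₁₂ tᵣ) (dist₀ 3 3< λ ()) (dist₀ 5 5< λ ()) (dist₁ 3 3< λ ()) (dist₁ 5 5< λ ()))))
        where
        5< : 5 + j < 4 + m
        5< = s≤s l′
        3< : 3 + j < 4 + m
        3< = ℕₚ.<-trans (ℕₚ.n<1+n _) l
        2< : 2 + j < 4 + m
        2< = ℕₚ.<-trans (ℕₚ.n<1+n _) 3<
        tₗ : Tri (v (2 + j)) (v (3 + j)) (v (4 + j))
        tₗ = tri (2 + j) l
        tᵣ : Tri (v (3 + j)) (v (4 + j)) (v (5 + j))
        tᵣ = tri (3 + j) 5<
        dist₀ : ∀ b → b + j < 4 + m → 0 ≢ b + j → v 0 ≢ v (b + j)
        dist₀ b = distinct (<k 0)
        dist₁ : ∀ b → b + j < 4 + m → 1 ≢ b + j → v 1 ≢ v (b + j)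
        dist₁ b = distinct (<k 1)
      ... | no ¬l = close (ℕₚ.≤-antisym (ℕₚ.≤-pred (ℕₚ.≤-pred (ℕₚ.≤-pred (ℕₚ.≤-pred l)))) (ℕₚ.≤-pred (ℕₚ.≤-pred (ℕₚ.≤-pred (ℕₚ.≤-pred (ℕₚ.≰⇒> ¬l))))))
        where
        close : suc j ≡ m → LocEqCycle G
        close refl = Closing.closed j C t

    front : ∀ x → x ≢ v 0 → x ≢ v 1 → x ≢ v 2 → Tri (v 0) (v 1) x → Goal
    front x p q s t with pre (4 + m) x in eq
    ... | true  = let i , l , e = pre-∈⁻ (4 + m) eq in inj₁ (at-index i l e p q s t)
    ... | false = inj₂ (prepend C x (λ l e → true≢false (subst (λ y → pre (4 + m) y ≡ true) e (pre-∈ l)) eq) (swap₁₂ (swap₂₃ t)))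

  -- In the six-vertex cycle the alternate triples are triples as well, so here the front of the chain
  -- is reached through a complementary triple.
  module Hexagon (6≤n : 6 ≤ n) {m : ℕ} (C : Chain (5 + m))
      (t : Tri (Chain.v C 0) (Chain.v C 2) (Chain.v C 4)) where
    open Chain C

    private
      <k : ∀ i {i≤4 : True (i ℕ.≤? 4)} → i < 5 + m
      <k i {i≤4} = s≤s (ℕₚ.≤-trans (toWitness i≤4) (ℕₚ.m≤m+n 4 m))

      ≢ᵥ : ∀ i j {i≤4 : True (i ℕ.≤? 4)} {j≤4 : True (j ℕ.≤? 4)} {i≢j : True (¬? (i ℕ.≟ j))} → v i ≢ v j
      ≢ᵥ i j {i≤4} {j≤4} {i≢j} = distinct (<k i {i≤4}) (<k j {j≤4}) (toWitness i≢j)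

      t₂ : Tri (v 2) (v 3) (v 4)
      t₂ = tri 2 (<k 4)

      -- The first four vertices give 2, and `t` and `t₂` have different colours at `v 4`. So five
      -- vertices have cutrank at most 1, which forces `n ≡ 6`.
      r-large : 4 ≤ r (pre 5)
      r-large = ℕₚ.≤-trans (ℕₚ.+-monoʳ-≤ 2 (r-pre 2 (ℕₚ.≤-trans (ℕₚ.m≤m+n 4 m) (ℕₚ.n≤1+n _))))
        (r-step₂ {pre 4} {pre 5} {vec t} {vec t₂} (∪₁-⊇ {A = pre 4} {v 4}) (pre-∉ (<k 4) ℕₚ.≤-refl)
          (supp-within t {pre 5} (pre-∈ (s≤s z≤n)) (pre-∈ (s≤s (s≤s (s≤s z≤n)))) (pre-∈ ℕₚ.≤-refl)) (tri-pre 2 (<k 4))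
          (proj₂ (differ t (swap₂₃ t₂) (≢ᵥ 0 3))))

      #pre : # (pre 5) ≡ 5
      #pre = #-pre 5 (ℕₚ.m≤m+n 5 m)

      ¬2≤∁ : ¬ 2 ≤ # (∁ (pre 5))
      ¬2≤∁ h = ℕₚ.<⇒≱ (s≤s (s≤s r-large)) (subst (2 + r (pre 5) ≤_) #pre
        (prime-bound prime (pre 5) (subst (2 ≤_) (sym #pre) (s≤s (s≤s z≤n))) h))

      n≡6 : n ≡ 6
      n≡6 = ℕₚ.≤-antisym (ℕₚ.≤-trans (ℕₚ.≤-reflexive (sym (#-∁ (pre 5))))
        (ℕₚ.+-mono-≤ (ℕₚ.≤-reflexive #pre) (ℕₚ.≤-pred (ℕₚ.≰⇒> ¬2≤∁)))) 6≤n

      sixth : ∃ λ z → ∁ (pre 5) z ≡ true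
      sixth = #-nonempty (∁ (pre 5)) (ℕₚ.+-cancelˡ-≤ 5 1 _ (ℕₚ.≤-trans 6≤n
        (ℕₚ.≤-reflexive (trans (sym (#-∁ (pre 5))) (cong (_+ # (∁ (pre 5))) #pre)))))

      A : Sub n
      A = set (v 2 ∷ v 3 ∷ v 4 ∷ [])

      A∋ : ∀ {w} → w ∈ v 2 ∷ v 3 ∷ v 4 ∷ [] → A w ≡ true
      A∋ = set-∈ (v 2 ∷ v 3 ∷ v 4 ∷ [])

      #A : # A ≡ 3
      #A = #-set ((≢ᵥ 2 3 ∷ ≢ᵥ 2 4 ∷ []) ∷ (≢ᵥ 3 4 ∷ []) ∷ [] ∷ [])

      #∁A : # (∁ A) ≡ 3
      #∁A = ℕₚ.+-cancelˡ-≡ 3 _ _ (trans (cong (_+ # (∁ A)) (sym #A)) (trans (#-∁ A) n≡6))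

      -- On six vertices the complement of a triple has size 3 and, by duality, the same cutrank, so
      -- it is a triple too.
      1≤r∁A : 1 ≤ r (∁ A)
      1≤r∁A = ℕₚ.+-cancelʳ-≤ 3 1 _ (ℕₚ.≤-trans
        (ℕₚ.+-mono-≤ (r-pos {A} {vec t₂} (supp-within t₂ {A} (A∋ (here refl)) (A∋ (there (here refl))) (A∋ (there (there (here refl))))) (Tri.nz₁ t₂)) (ℕₚ.≤-reflexive (sym #∁A)))
        (ℕₚ.≤-reflexive (trans (duality A) (cong (r (∁ A) +_) #A))))

    bypass : ∃ λ z → z ≢ v 0 × z ≢ v 1 × z ≢ v 2 × Tri (v 0) (v 1) z
    bypass with sixth | nonzero-in {∁ A} 1≤r∁A
    ... | z , ¬z | c , s , w , ≢0 = z , z≢ 0 , z≢ 1 , z≢ 2 , mkTri c w (≢ᵥ 0 1) (z≢ 0 ∘ sym) (z≢ 1 ∘ sym) off ≢0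
      where
      z≢ : ∀ i {i≤4 : True (i ℕ.≤? 4)} → z ≢ v i
      z≢ i {i≤4} refl = true≢false (pre-∈ {i} {5} (s≤s (toWitness i≤4))) (Boolₚ.not-injective ¬z)
      off : ∀ y → y ≢ v 0 → y ≢ v 1 → y ≢ z → col c y ≡ 0ᴷ
      off y p q y≢z = s y (cong not (in-A (pre 5 y) refl))
        where
        in-A : ∀ α → pre 5 y ≡ α → A y ≡ true
        in-A false e = ⊥-elim (¬2≤∁ (#-≥2 (∁ (pre 5)) y≢z (cong not e) ¬z))
        in-A true  e with pre-∈⁻ 5 e
        ... | 0 , _ , h = ⊥-elim (p (sym h))
        ... | 1 , _ , h = ⊥-elim (q (sym h))
        ... | 2 , _ , refl = A∋ (here refl)
        ... | 3 , _ , refl = A∋ (there (here refl))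
        ... | 4 , _ , refl = A∋ (there (there (here refl)))
        ... | suc (suc (suc (suc (suc _)))) , s≤s (s≤s (s≤s (s≤s (s≤s ())))) , _

  -- A chain of length 4 is rearranged to `x, v 0, v 2, v 1, v 3`. In a longer chain with `x`
  -- different from `v 4`, the new triple meets the triples at positions 1 and 2 only in `v 2`,
  -- where those two differ.
  skip : 6 ≤ n → ∀ m (C : Chain (4 + m)) x → x ≢ Chain.v C 0 → x ≢ Chain.v C 1 → x ≢ Chain.v C 2 →
    x ≢ Chain.v C 3 → Tri (Chain.v C 0) (Chain.v C 2) x → LocEqCycle G ⊎ Chain (5 + m)
  skip 6≤n zero C x p q s x≢3 t = inj₂ (prepend (prepend (chain₃ (swap₁₂ (C.tri 1 ℕₚ.≤-refl))) (C.v 0)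
      (fresh₃ (swap₁₂ (C.tri 1 ℕₚ.≤-refl)) (≢₀ 2 ℕₚ.≤-refl) (≢₀ 1 (ℕₚ.n≤1+n _)) (C.distinct (s≤s z≤n) ℕₚ.≤-refl λ ()))
      (swap₂₃ (C.tri 0 (ℕₚ.n≤1+n _)))) x
      (λ { {zero} _ h → p (sym h) ; {suc i} (s≤s l) → fresh₃ (swap₁₂ (C.tri 1 ℕₚ.≤-refl)) s q x≢3 {i} l })
      (swap₁₂ (swap₂₃ t)))
    where
    module C = Chain C
    ≢₀ : ∀ i → suc i < 4 → {i≢ : True (¬? (0 ℕ.≟ i))} → C.v 0 ≢ C.v i
    ≢₀ i l {i≢} = C.distinct (s≤s z≤n) (ℕₚ.<-trans (ℕₚ.n<1+n _) l) (toWitness i≢)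
  skip 6≤n (suc m) C x p q s x≢3 t with x ≟ Chain.v C 4
  ... | yes refl = let z , p , q , s , t′ = Hexagon.bypass 6≤n C t in Step.front 6≤n C z p q s t′
  ... | no x≢4 = ⊥-elim (ω-true⇒≢ {at t₁ (C.v 2)} {at t₂ (C.v 2)} (proj₁ (differ t₁ t₂ (C.distinct 1< 4< λ ())))
      (trans (sym (agree (swap₂₃ t) (swap₁₂ t₁) (C.distinct 0< 1< λ ()) (C.distinct 0< 3< λ ()) q x≢3))
             (agree (swap₂₃ t) t₂ (C.distinct 0< 3< λ ()) (C.distinct 0< 4< λ ()) x≢3 x≢4)))
    where
    module C = Chain C
    0< : 0 < 5 + m
    0< = s≤s z≤n
    1< : 1 < 5 + m
    1< = s≤s (s≤s z≤n)
    3< : 3 < 5 + m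
    3< = s≤s (s≤s (s≤s (s≤s z≤n)))
    4< : 4 < 5 + m
    4< = s≤s (s≤s (s≤s (s≤s (s≤s z≤n))))
    t₁ : Tri (C.v 1) (C.v 2) (C.v 3)
    t₁ = C.tri 1 3<
    t₂ : Tri (C.v 2) (C.v 3) (C.v 4)
    t₂ = C.tri 2 4<

  -- The triangle lemma needs a second colour at `v 1` as well, but `v 1` may be non-essential: the
  -- next triple of the chain supplies the colour through `triple⇒NP`, and `differ` shows that it is
  -- a new one.
  extend : 6 ≤ n → ∀ {m} (C : Chain (4 + m)) → Essential (Chain.v C 0) → LocEqCycle G ⊎ Chain (5 + m)
  extend 6≤n {m} C E = go (essential-triangle t₀ E (triple⇒NP t₁) (Tri.nz₁ t₁)
      λ e → ω-true⇒≢ {at t₀ (v 1)} {at t₁ (v 1)} (proj₁ (differ t₀ t₁ (≢ᵥ 0 3))) (sym e))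
    where
    open Chain C
    <k : ∀ i {i≤3 : True (i ℕ.≤? 3)} → i < 4 + m
    <k i {i≤3} = s≤s (ℕₚ.≤-trans (toWitness i≤3) (ℕₚ.m≤m+n 3 m))
    ≢ᵥ : ∀ i j {i≤3 : True (i ℕ.≤? 3)} {j≤3 : True (j ℕ.≤? 3)} {i≢j : True (¬? (i ℕ.≟ j))} → v i ≢ v j
    ≢ᵥ i j {i≤3} {j≤3} {i≢j} = distinct (<k i {i≤3}) (<k j {j≤3}) (toWitness i≢j)
    t₀ : Tri (v 0) (v 1) (v 2)
    t₀ = tri 0 (<k 2)
    t₁ : Tri (v 1) (v 2) (v 3)
    t₁ = tri 1 (<k 3)
    go : (∃ λ x → x ≢ v 0 × x ≢ v 1 × x ≢ v 2 × (Tri (v 0) (v 1) x ⊎ Tri (v 0) (v 2) x)) → LocEqCycle G ⊎ Chain (5 + m)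
    go (x , p , q , s , inj₁ t) = Step.front 6≤n C x p q s t
    go (x , p , q , s , inj₂ t) with x ≟ v 3
    ... | yes refl = ⊥-elim (no-K₄ 6≤n (swap₂₃ t₀) (swap₁₂ t₁) t)
    ... | no x≢3   = skip 6≤n m C x p q s x≢3 t

  module _ (6≤n : 6 ≤ n) (one-of : ∀ u w → u ≢ w → Essential u ⊎ Essential w) where

    -- Of the two ends at least one is essential, and reversing brings it to the front. The fuel `f`
    -- bounds the vertices left; at zero the chain would have more than `n` vertices.
    grow : ∀ f m → n ≤ f + (3 + m) → Chain (4 + m) → LocEqCycle G
    grow zero    m l C = ⊥-elim (ℕₚ.1+n≰n (ℕₚ.≤-trans (chain-≤ C) l))
    grow (suc f) m l C = [ id , grow f (suc m) (subst (n ≤_) (sym (ℕₚ.+-suc f (3 + m))) l) ]′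
      ([ extend 6≤n C , extend 6≤n (reverse C) ]′ (one-of (v 0) (v (3 + m)) (distinct (s≤s z≤n) ℕₚ.≤-refl λ ())))
      where open Chain C

    -- There is no neighbouring triple yet, so the colour at `b` has to come from `b` being
    -- essential. The vertex common to neither triple's pair is put at the end of the chain on each
    -- side.
    start : ∀ {a b e} → Tri a b e → Essential a → Essential b → Chain 4
    start {a} {b} {e} t Ea Eb with other-colour Eb (at t b)
    ... | j , j≢0 , j≢t , M with essential-triangle t Ea M j≢0 j≢t
    ...   | x , p , q , s , inj₁ t′ = prepend (chain₃ (swap₁₂ t′)) e (fresh₃ (swap₁₂ t′) (Tri.≢₂₃ t ∘ sym) (Tri.≢₁₃ t ∘ sym) (s ∘ sym)) (swap₁₃ t)
    ...   | x , p , q , s , inj₂ t′ = prepend (chain₃ t′) b (fresh₃ t′ (Tri.≢₁₂ t ∘ sym) (Tri.≢₂₃ t) (q ∘ sym)) (swap₁₂ t)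

    begin-with : ∀ {a} → Essential a → LocEqCycle G
    begin-with E with essential-in-triple (Essential.NPᵢ E) (Essential.NPⱼ E) (Essential.i≢0 E) (Essential.j≢0 E) (Essential.i≢j E)
    ... | b , e , t = grow n 0 (ℕₚ.m≤m+n n 3) ([ start t E , start (swap₂₃ t) E ]′ (one-of b e (Tri.≢₂₃ t)))

    cycle : LocEqCycle G
    cycle = [ begin-with , begin-with ]′ (one-of (fromℕ< 0<n) (fromℕ< 1<n) λ e →
      ℕₚ.1+n≢0 (trans (sym (Finₚ.toℕ-fromℕ< 1<n)) (trans (cong toℕ (sym e)) (Finₚ.toℕ-fromℕ< 0<n))))
      where
      0<n : 0 < n
      0<n = ℕₚ.≤-trans (s≤s z≤n) 6≤n
      1<n : 1 < n
      1<n = ℕₚ.≤-trans (s≤s (s≤s z≤n)) 6≤n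

-- On 5 vertices a 3-set has a complement of size 2, hence cutrank at most 2, hence it supports a
-- nonzero vector. Any ordering of the vertices is then a chain that closes.
pentagon : ∀ (G : Graph 5) → IsSimple G → Prime G → LocEqCycle G
pentagon G G-simple prime = Closing.closed 0 C (any-three 0F≢1F 0F≢4F 1F≢4F)
  where
  open Chains G G-simple prime ℕₚ.≤-refl
  any-three : ∀ {a b e} → a ≢ b → a ≢ e → b ≢ e → Tri a b e
  any-three {a} {b} {e} a≢b a≢e b≢e = set-tri a≢b a≢e b≢e (ℕₚ.+-cancelʳ-≤ 2 1 _ (begin
    3                 ≤⟨ ℕₚ.m≤n+m 3 (r (∁ A)) ⟩
    r (∁ A) + 3       ≡⟨ cong (r (∁ A) +_) #A ⟨
    r (∁ A) + # A     ≡⟨ duality A ⟨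
    r A + # (∁ A)     ≡⟨ cong (r A +_) (ℕₚ.+-cancelˡ-≡ 3 _ _ (trans (cong (_+ # (∁ A)) (sym #A)) (#-∁ A))) ⟩
    r A + 2           ∎))
    where
    open ℕₚ.≤-Reasoning
    A : Sub 5
    A = set (a ∷ b ∷ e ∷ [])
    #A : # A ≡ 3
    #A = #-set ((a≢b ∷ a≢e ∷ []) ∷ (b≢e ∷ []) ∷ [] ∷ [])
  v : ℕ → Fin 5
  v 0 = 0F
  v 1 = 1F
  v 2 = 2F
  v 3 = 3F
  v _ = 4F
  toℕ-v : ∀ {i} → i < 5 → toℕ (v i) ≡ i
  toℕ-v {0} _ = refl
  toℕ-v {1} _ = refl
  toℕ-v {2} _ = refl
  toℕ-v {3} _ = refl
  toℕ-v {4} _ = refl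
  toℕ-v {suc (suc (suc (suc (suc _))))} (s≤s (s≤s (s≤s (s≤s (s≤s ())))))
  v-inj : ∀ {i j} → i < 5 → j < 5 → v i ≡ v j → i ≡ j
  v-inj l l′ e = trans (sym (toℕ-v l)) (trans (cong toℕ e) (toℕ-v l′))
  0F≢1F : 0F ≢ 1F
  0F≢1F ()
  0F≢4F : 0F ≢ 4F
  0F≢4F ()
  1F≢4F : 1F ≢ 4F
  1F≢4F ()
  C : Chain 5
  C = record { v = v ; inj = v-inj ; tri = λ i l →
    let l₁ = ℕₚ.<-trans (ℕₚ.n<1+n (1 + i)) l; l₀ = ℕₚ.<-trans (ℕₚ.n<1+n i) l₁ in
    any-three (λ e → ℕₚ.<⇒≢ ℕₚ.≤-refl (v-inj l₀ l₁ e)) (λ e → ℕₚ.<⇒≢ (ℕₚ.m≤n+m (1 + i) 1) (v-inj l₀ l e))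
              (λ e → ℕₚ.<⇒≢ ℕₚ.≤-refl (v-inj l₁ l e)) }

-- Decidability and the colours of the three minors

split? : ∀ {n} (G : Graph n) → Dec (Split G)
split? {n} G = vec?
  (λ { h ((a₁ , a₂ , p , q , s) , (b₁ , b₂ , p′ , q′ , s′) , A′ , B′ , f , g , k) →
     (a₁ , a₂ , p , trans (sym (h a₁)) q , trans (sym (h a₂)) s) , (b₁ , b₂ , p′ , trans (sym (h b₁)) q′ , trans (sym (h b₂)) s′) ,
     A′ , B′ , (λ x e → trans (sym (h x)) (f x e)) , (λ y e → trans (sym (h y)) (g y e)) ,
     λ x y e e′ → k x y (trans (h x) e) (trans (h y) e′) })
  λ A → two? A true ×-dec two? A false ×-dec vec?
    (λ { h (B′ , f , g , k) → B′ , (λ x e → f x (trans (h x) e)) , g , λ x y e e′ →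
       (λ i → let p , q = proj₁ (k x y e e′) i in trans (sym (h x)) p , q) ,
       λ { (p , q) → proj₂ (k x y e e′) (trans (h x) p , q) } })
    λ A′ → vec?
      (λ { h (f , g , k) → f , (λ y e → g y (trans (h y) e)) , λ x y e e′ →
         (λ i → let p , q = proj₁ (k x y e e′) i in p , trans (sym (h y)) q) ,
         λ { (p , q) → proj₂ (k x y e e′) (p , trans (h y) q) } })
      λ B′ → (Finₚ.all? λ x → (A′ x Boolₚ.≟ true) →-dec (A x Boolₚ.≟ true))
        ×-dec (Finₚ.all? λ y → (B′ y Boolₚ.≟ true) →-dec (A y Boolₚ.≟ false))
        ×-dec (Finₚ.all? λ x → Finₚ.all? λ y → (A x Boolₚ.≟ true) →-dec ((A y Boolₚ.≟ false) →-dec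
          (((G x y Boolₚ.≟ true) →-dec ((A′ x Boolₚ.≟ true) ×-dec (B′ y Boolₚ.≟ true)))
           ×-dec (((A′ x Boolₚ.≟ true) ×-dec (B′ y Boolₚ.≟ true)) →-dec (G x y Boolₚ.≟ true)))))
  where
  two? : ∀ (A : Sub n) β → Dec (∃[ a₁ ] ∃[ a₂ ] (a₁ ≢ a₂ × A a₁ ≡ β × A a₂ ≡ β))
  two? A β = Finₚ.any? λ a₁ → Finₚ.any? λ a₂ → ¬? (a₁ ≟ a₂) ×-dec (A a₁ Boolₚ.≟ β) ×-dec (A a₂ Boolₚ.≟ β)

prime? : ∀ {n} (G : Graph n) → Dec (Prime G)
prime? G = ¬? (split? G)

primeSlash? : ∀ {m} (G : Graph (suc m)) v → Dec (PrimeSlash G v)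
primeSlash? G v = ((Finₚ.all? λ w → G v w Boolₚ.≟ false) →-dec prime? (delete G v))
  ×-dec (Finₚ.all? λ w → (G v w Boolₚ.≟ true) →-dec prime? (delete (pivot G v w) v))

nonEssential? : ∀ {m} (G : Graph (suc m)) v → Dec (NonEssential G v)
nonEssential? G v = (p₁ ×-dec p₂) ⊎-dec ((p₁ ×-dec p₃) ⊎-dec (p₂ ×-dec p₃))
  where
  p₁ = prime? (delete G v)
  p₂ = prime? (delete (G * v) v)
  p₃ = primeSlash? G v

another : ∀ {m} (v : Fin (suc m)) → 1 ≤ m → ∃ λ w → v ≢ w
another {suc m} v _ = punchIn v zero , Finₚ.punchInᵢ≢i v zero ∘ sym

module _ {m : ℕ} (G : Graph (suc m)) (G-simple : IsSimple G) (prime : Prime G) (5≤n : 5 ≤ suc m) where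
  open Growth G G-simple prime 5≤n

  private
    -- Primality is a negation, so an actual split is recovered from its failure by exhaustive
    -- search.
    split! : ∀ {k} {H : Graph k} → ¬ Prime H → Split H
    split! {H = H} ¬p with split? H
    ... | yes s = s
    ... | no ¬s = ⊥-elim (¬p ¬s)

  deletion : ∀ v → ¬ Prime (delete G v) → NP v Z-colour
  deletion v ¬p = split⇒NP G G-simple prime v (split! ¬p)

  complementation : ∀ v → ¬ Prime (delete (G * v) v) → NP v Y-colour
  complementation v ¬p = subst (NP v) colour
    (NP-* G G-simple v (split⇒NP (G * v) (*-simple G G-simple v) (*-prime G G-simple prime v) v (split! ¬p)))
    where
    colour : ψ G G-simple v v Z-colour ≡ Y-colour
    colour = cong₂ _,_ (cong (λ b → b ∧ true) (same-refl v)) (cong not (Boolₚ.∧-zeroʳ (G v v)))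

  pivoting : ∀ v → ¬ PrimeSlash G v → NP v X-colour
  pivoting v ¬p with Finₚ.any? (λ w → (G v w Boolₚ.≟ true) ×-dec ¬? (prime? (delete (pivot G v w) v)))
  ... | no ¬w = ⊥-elim (¬p (isolated , λ w e → prime! λ ¬q → ¬w (w , e , ¬q)))
    where
    prime! : ∀ {k} {H : Graph k} → ¬ ¬ Prime H → Prime H
    prime! {H = H} ¬¬p s = ¬¬p λ p → p s
    isolated : (∀ w → G v w ≡ false) → Prime (delete G v)
    -- Without neighbours of `v`, the vector `unit v` would be nonzero and supported at `v` alone.
    isolated h = ⊥-elim (true≢false (same-refl v) (cong proj₁ (pair-zero {unit v} (proj₂ (another v (ℕₚ.≤-trans (s≤s z≤n) (ℕₚ.≤-pred 5≤n))))
      (λ w w≢v _ → cong₂ _,_ (same-≢ w≢v) (trans (z-unit v w) (trans (G-sym w v) (h w)))) v)))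
  -- Undoing the three complementations of the pivot in turn, the colour (0,1) at `v` becomes (1,1)
  -- through `v`, then (1,0) through its neighbour `w`, and is fixed by the last one at `v`.
  ... | yes (w , e , ¬q) = subst (NP v) colour (NP-* G G-simple v (NP-* G₁ s₁ w (NP-* G₂ s₂ v
      (split⇒NP (G₂ * v) (*-simple G₂ s₂ v) (*-prime G₂ s₂ (*-prime G₁ s₁ (*-prime G G-simple prime v) w) v) v (split! ¬q)))))
    where
    G₁ G₂ : Graph (suc m)
    G₁ = G * v
    s₁ : IsSimple G₁
    s₁ = *-simple G G-simple v
    G₂ = G₁ * w
    s₂ : IsSimple G₂
    s₂ = *-simple G₁ s₁ w
    v≢w : v ≢ w
    v≢w refl = true≢false e (proj₂ G-simple v)
    edge : G₁ w v ≡ true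
    edge = trans (proj₁ s₁ w v) (trans (*-row G G-simple v w) e)
    colour : ψ G G-simple v v (ψ G₁ s₁ w v (ψ G₂ s₂ v v Z-colour)) ≡ X-colour
    colour = trans (cong (λ k → ψ G G-simple v v (ψ G₁ s₁ w v k)) c₁) (trans (cong (ψ G G-simple v v) c₂) c₃)
      where
      c₁ : ψ G₂ s₂ v v Z-colour ≡ Y-colour
      c₁ = cong₂ _,_ (cong (λ b → b ∧ true) (same-refl v)) (cong not (Boolₚ.∧-zeroʳ (G₂ v v)))
      c₂ : ψ G₁ s₁ w v Y-colour ≡ X-colour
      c₂ = cong₂ _,_ (cong (λ b → not (b ∧ true)) (same-≢ v≢w)) (cong (λ b → not (b ∧ true)) edge)
      c₃ : ψ G G-simple v v X-colour ≡ X-colour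
      c₃ = cong₂ _,_ (cong not (Boolₚ.∧-zeroʳ (same v v))) (cong (_∧ true) (proj₂ G-simple v))

  essential : ∀ v → ¬ NonEssential G v → Essential v
  essential v ¬ne with prime? (delete G v) | prime? (delete (G * v) v) | primeSlash? G v
  ... | yes p | yes q | _     = ⊥-elim (¬ne (inj₁ (p , q)))
  ... | yes p | _     | yes q = ⊥-elim (¬ne (inj₂ (inj₁ (p , q))))
  ... | _     | yes p | yes q = ⊥-elim (¬ne (inj₂ (inj₂ (p , q))))
  ... | no p  | no q  | _     = record { i≢0 = λ () ; j≢0 = λ () ; i≢j = λ () ; NPᵢ = deletion v p ; NPⱼ = complementation v q }
  ... | no p  | yes _ | no q  = record { i≢0 = λ () ; j≢0 = λ () ; i≢j = λ () ; NPᵢ = deletion v p ; NPⱼ = pivoting v q }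
  ... | yes _ | no p  | no q  = record { i≢0 = λ () ; j≢0 = λ () ; i≢j = λ () ; NPᵢ = complementation v p ; NPⱼ = pivoting v q }

  few-nonEssential⇒cycle : (∀ u w → u ≢ w → ¬ (NonEssential G u × NonEssential G w)) → 6 ≤ suc m → LocEqCycle G
  few-nonEssential⇒cycle h 6≤n = cycle 6≤n λ u w u≢w → go u w u≢w (nonEssential? G u) (nonEssential? G w)
    where
    go : ∀ u w → u ≢ w → Dec (NonEssential G u) → Dec (NonEssential G w) → Essential u ⊎ Essential w
    go u w _ (no ¬u) _        = inj₁ (essential u ¬u)
    go u w _ _       (no ¬w)  = inj₂ (essential w ¬w)
    go u w u≢w (yes p) (yes q) = ⊥-elim (h u w u≢w (p , q))

theorem1p1 : ∀ (m : ℕ) (G : Graph (suc m)) → IsSimple G → 5 ≤ suc m → Prime G →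
    ¬ LocEqCycle G →
    ∃[ u ] ∃[ v ] (u ≢ v × NonEssential G u × NonEssential G v)
theorem1p1 m G G-simple 5≤n prime ¬cycle
  with Finₚ.any? (λ u → Finₚ.any? λ v → ¬? (u ≟ v) ×-dec (nonEssential? G u ×-dec nonEssential? G v))
... | yes found = found
-- Being non-essential is decidable, so it suffices to refute that the search finds no pair.
... | no ¬found = ⊥-elim (¬cycle (go m G G-simple 5≤n prime λ u w u≢w p → ¬found (u , w , u≢w , p)))
  where
  go : ∀ m (G : Graph (suc m)) → IsSimple G → 5 ≤ suc m → Prime G →
    (∀ u w → u ≢ w → ¬ (NonEssential G u × NonEssential G w)) → LocEqCycle G
  -- Five vertices are separate because `no-K₄` needs two vertices outside a 4-set.
  go m G G-simple 5≤n prime few with m ℕ.≟ 4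
  ... | yes refl = pentagon G G-simple prime
  ... | no m≢4   = few-nonEssential⇒cycle G G-simple prime 5≤n few (ℕₚ.≤∧≢⇒< 5≤n λ e → m≢4 (sym (ℕₚ.suc-injective e)))
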